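{- For every $n\ge1$, the restriction of $\rho$ is an isomorphism from the weak order on $S_n$ restricted to Baxter permutations to the lattice $\mathrm{dRec}_n$ of diagonal rectangulations of size $n$, with inverse $\beta$.
   Context: Permutations are in one-line notation $x=x_1\cdots x_n\in S_n$. The weak order on $S_n$ is the partial order in which one moves up by a cover by swapping adjacent entries $x_i<x_{i+1}$. Patterns, always with $a<b<c<d$: $x$ contains 3-41-2 if it has a subsequence $c\,d\,a\,b$ with $d$ immediately before $a$ in $x$; 2-41-3 if it has a subsequence $b\,d\,a\,c$ with $d$ immediately before $a$; 3-14-2 if it has a subsequence $c\,a\,d\,b$ with $a$ immediately before $d$. Baxter permutations avoid 3-14-2 and 2-41-3; twisted Baxter permutations avoid 3-41-2 and 2-41-3. Diagonal rectangulations. Let $S$ be a square with sides parallel to the coordinate axes; its diagonal is the interior of the segment from its top-left corner to its bottom-right corner. For a subdivision of $S$ into finitely many (axis-parallel) rectangles, the walls are the maximal line segments contained in the union of the boundaries of the rectangles, excluding the four edges of $S$. For a set $X$ of $n-1$ distinct points on the diagonal, a diagonal rectangulation of $(S,X)$ is a subdivision of $S$ into rectangles such that no two walls intersect in their interiors, every wall contains a point of $X$, and every point of $X$ lies on exactly one wall. Diagonal rectangulations are considered up to dilation or translation of $S$ and order-preserving motion of the points of $X$ along the diagonal (carrying the walls along); an equivalence class is a diagonal rectangulation of size $n$, and it has a unique integral representative, with $S=[0,n]\times[0,n]$ and $X=\{(i,n-i):1\le i\le n-1\}$. $\mathrm{dRec}_n$ is the set of diagonal rectangulations of size $n$, identified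 with their integral representatives. Such a rectangulation has $n$ rectangles, each with interior meeting the diagonal. The map $\rho:S_n\to\mathrm{dRec}_n$. Let $S=[0,n]\times[0,n]$, $p_i=(i,n-i)$ for $0\le i\le n$, and give the space between $p_{k-1}$ and $p_k$ the label $k$. Read $x_1\cdots x_n$ from left to right, drawing one rectangle for each entry. Let $T_{i-1}$ be the union of the left and bottom edges of $S$ and the rectangles drawn in the first $i-1$ steps. In step $i$, put $k=x_i$, $p=p_{k-1}$, $p'=p_k$, and draw the rectangle with the following top-left and bottom-right corners. If $p\notin T_{i-1}$, the top-left corner is the rightmost point of $T_{i-1}$ directly left of $p$; if $p\in T_{i-1}$, it is the highest point of $T_{i-1}$ directly above (or equal to) $p$. If $p'\notin T_{i-1}$, the bottom-right corner is the highest point of $T_{i-1}$ directly below $p'$; if $p'\in T_{i-1}$, it is the rightmost point of $T_{i-1}$ directly right of (or equal to) $p'$. The $n$ rectangles drawn form $\rho(x)$. The lattice $\mathrm{dRec}_n$. The map $\rho$ restricts to a bijection from twisted Baxter permutations in $S_n$ to $\mathrm{dRec}_n$, and its fibers are the classes of a lattice congruence $\Theta_{\mathrm{tB}}$ of the weak order whose minimal class representatives are the twisted Baxter permutations. The order on $\mathrm{dRec}_n$ is that of the quotient lattice of the weak order by $\Theta_{\mathrm{tB}}$; equivalently, $R\le R'$ if and only if $x\le x'$ in the weak order, where $x,x'$ are the twisted Baxter permutations with $\rho(x)=R$, $\rho(x')=R'$. The map $\beta$. Given $R\in\mathrm{dRec}_n$, label its rectangles $1,\dots,n$ in the order in which the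 diagonal meets them from top-left to bottom-right. Order the rectangles as follows. The first rectangle is the one containing the bottom-left corner of $S$. Suppose $i-1\ge1$ rectangles have been chosen, let $U$ be the one chosen in step $i-1$, let $p$ be the top-right corner of $U$, and let $T_{i-1}$ be the union of the rectangles chosen so far with the left and bottom sides of $S$. Follow the boundary of $T_{i-1}$ left from $p$ until it turns upward, and let $U_A$ be the rectangle of $R$ whose bottom-left corner is the point where it turns ($U_A$ is undefined if the top edge of $U$ lies in the boundary of $S$). Follow the boundary of $T_{i-1}$ down from $p$ until it turns towards the right side of $S$, and let $U_B$ be the rectangle whose bottom-left corner is the point where it turns ($U_B$ is undefined if the right edge of $U$ lies in the boundary of $S$). If both the top and right edges of $U$ lie in the boundary of $S$, stop (all rectangles have been chosen). Otherwise exactly three edges of $R$ (edges of rectangles, subdivided at vertices of rectangles) meet at $p$, and the one not opposite another leaves $p$ either to the left ($p$ is a left vertex) or downward ($p$ is a down vertex); choose $U_A$ in step $i$ if $p$ is a left vertex and $U_B$ if $p$ is a down vertex. Then $\beta(R)\in S_n$ is the permutation whose one-line notation lists the labels of the rectangles in the order chosen; it is a Baxter permutation. -}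

module Defs where

open import Data.Bool using (if_then_else_)
open import Data.Empty using (⊥)
open import Data.Unit using (⊤)
open import Data.List using (List; []; _∷_; _++_; applyUpTo; filter; find; foldl; length; map)
open import Data.List.Membership.Propositional using (_∈_; _∉_)
open import Data.List.Relation.Binary.Permutation.Propositional using (_↭_)
open import Data.List.Relation.Unary.All using (All)
open import Data.List.Relation.Unary.Any using (Any; any?)
open import Data.List.Relation.Unary.Unique.Propositional using (Unique)
open import Data.Maybe using (Maybe; just; nothing)
open import Data.Nat using (ℕ; zero; suc; _≤_; _<_; _∸_; _⊔_; _≟_; _≤?_; _<?_)
open import Data.Product using (Σ; ∃!; ∃-syntax; _×_; _,_; proj₁)
open import Data.Sum using (_⊎_)
open import Function.Bundles using (_⇔_)
open import Relation.Binary.Construct.Closure.ReflexiveTransitive using (Star)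
open import Relation.Binary.PropositionalEquality using (_≡_; _≢_)
open import Relation.Nullary using (¬_; Dec; yes; no; does; ¬?; _×-dec_; _⊎-dec_)
open import Relation.Unary using (Decidable)

------------------------------------------------------------------------
-- Permutations in one-line notation

IsPerm : ℕ → List ℕ → Set
IsPerm n x = x ↭ applyUpTo suc n

data _⋖_ : List ℕ → List ℕ → Set where
  swap-adjacent : ∀ xs {a b} ys → a < b → (xs ++ a ∷ b ∷ ys) ⋖ (xs ++ b ∷ a ∷ ys)

_≤ʷ_ : List ℕ → List ℕ → Set
_≤ʷ_ = Star _⋖_

Contains-3-41-2 : List ℕ → Set
Contains-3-41-2 x = ∃[ xs ] ∃[ ys ] ∃[ a ] ∃[ b ] ∃[ c ] ∃[ d ]
  (x ≡ xs ++ d ∷ a ∷ ys × c ∈ xs × b ∈ ys × a < b × b < c × c < d)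

Contains-2-41-3 : List ℕ → Set
Contains-2-41-3 x = ∃[ xs ] ∃[ ys ] ∃[ a ] ∃[ b ] ∃[ c ] ∃[ d ]
  (x ≡ xs ++ d ∷ a ∷ ys × b ∈ xs × c ∈ ys × a < b × b < c × c < d)

Contains-3-14-2 : List ℕ → Set
Contains-3-14-2 x = ∃[ xs ] ∃[ ys ] ∃[ a ] ∃[ b ] ∃[ c ] ∃[ d ]
  (x ≡ xs ++ a ∷ d ∷ ys × c ∈ xs × b ∈ ys × a < b × b < c × c < d)

IsBaxter : ℕ → List ℕ → Set
IsBaxter n x = IsPerm n x × ¬ Contains-3-14-2 x × ¬ Contains-2-41-3 x

IsTwistedBaxter : ℕ → List ℕ → Set
IsTwistedBaxter n x = IsPerm n x × ¬ Contains-3-41-2 x × ¬ Contains-2-41-3 x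

Baxter : ℕ → Set
Baxter n = Σ (List ℕ) (IsBaxter n)

_≈ᴮ_ : ∀ {n} → Baxter n → Baxter n → Set
x ≈ᴮ y = proj₁ x ≡ proj₁ y

_≤ᴮ_ : ∀ {n} → Baxter n → Baxter n → Set
x ≤ᴮ y = proj₁ x ≤ʷ proj₁ y

------------------------------------------------------------------------
-- Rectangles, segments and unit edges

-- The square S is [0,n] × [0,n].  Only lattice geometry is needed: a wall
-- contains a point (i , n - i), hence lies on a line x = i or y = n - i,
-- and every edge of a rectangle lies in a wall or in an edge of S, so all
-- corners of rectangles are lattice points.

Point : Set
Point = ℕ × ℕ

-- p₀, …, pₙ; the set X consists of p₁, …, pₙ₋₁.
diagPoint : ℕ → ℕ → Point
diagPoint n i = i , n ∸ i

record Rect : Set where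
  constructor rect
  field
    left right bottom top : ℕ
open Rect public

fromCorners : (topLeft bottomRight : Point) → Rect
fromCorners (l , t) (r , b) = rect l r b t

-- Membership in the closed rectangle.
_∈ᴿ_ : Point → Rect → Set
(x , y) ∈ᴿ U = left U ≤ x × x ≤ right U × bottom U ≤ y × y ≤ top U

_∈ᴿ?_ : ∀ p U → Dec (p ∈ᴿ U)
(x , y) ∈ᴿ? U =
  left U ≤? x ×-dec x ≤? right U ×-dec bottom U ≤? y ×-dec y ≤? top U

-- The unit cell [i,i+1] × [j,j+1] is contained in U.
CellIn : ℕ → ℕ → Rect → Set
CellIn i j U = left U ≤ i × i < right U × bottom U ≤ j × j < top U

cellIn? : ∀ i j U → Dec (CellIn i j U)
cellIn? i j U =
  left U ≤? i ×-dec i <? right U ×-dec bottom U ≤? j ×-dec j <? top U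

-- The unit edge [i,i+1] × {y} is contained in the boundary of a member of R.
HEdge : List Rect → ℕ → ℕ → Set
HEdge R i y = Any (λ U → left U ≤ i × i < right U × (y ≡ bottom U ⊎ y ≡ top U)) R

hEdge? : ∀ R i y → Dec (HEdge R i y)
hEdge? R i y = any?
  (λ U → left U ≤? i ×-dec i <? right U ×-dec (y ≟ bottom U ⊎-dec y ≟ top U)) R

-- The unit edge {x} × [j,j+1] is contained in the boundary of a member of R.
VEdge : List Rect → ℕ → ℕ → Set
VEdge R x j = Any (λ U → bottom U ≤ j × j < top U × (x ≡ left U ⊎ x ≡ right U)) R

vEdge? : ∀ R x j → Dec (VEdge R x j)
vEdge? R x j = any?
  (λ U → bottom U ≤? j ×-dec j <? top U ×-dec (x ≟ left U ⊎-dec x ≟ right U)) R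

-- horizontal y a b is [a,b] × {y}; vertical x a b is {x} × [a,b].
data Segment : Set where
  horizontal vertical : (at lo hi : ℕ) → Segment

_∈ˢ_ : Point → Segment → Set
(x , y) ∈ˢ horizontal h a b = y ≡ h × a ≤ x × x ≤ b
(x , y) ∈ˢ vertical   v a b = x ≡ v × a ≤ y × y ≤ b

-- Relative interior.
_∈ˢ°_ : Point → Segment → Set
(x , y) ∈ˢ° horizontal h a b = y ≡ h × a < x × x < b
(x , y) ∈ˢ° vertical   v a b = x ≡ v × a < y × y < b

-- Containment of (nondegenerate) segments.
_⊆ˢ_ : Segment → Segment → Set
horizontal h a b ⊆ˢ horizontal h′ a′ b′ = h ≡ h′ × a′ ≤ a × b ≤ b′
vertical   v a b ⊆ˢ vertical   v′ a′ b′ = v ≡ v′ × a′ ≤ a × b ≤ b′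
_                ⊆ˢ _                   = ⊥

InBoundaries : List Rect → Segment → Set
InBoundaries R (horizontal h a b) = a < b × (∀ i → a ≤ i → i < b → HEdge R i h)
InBoundaries R (vertical   v a b) = a < b × (∀ j → a ≤ j → j < b → VEdge R v j)

edgesOfSquare : ℕ → List Segment
edgesOfSquare n =
  horizontal 0 0 n ∷ horizontal n 0 n ∷ vertical 0 0 n ∷ vertical n 0 n ∷ []

record IsWall (n : ℕ) (R : List Rect) (s : Segment) : Set where
  field
    inBoundaries : InBoundaries R s
    maximal      : ∀ s′ → InBoundaries R s′ → s ⊆ˢ s′ → s′ ≡ s
    notOuter     : s ∉ edgesOfSquare n

------------------------------------------------------------------------
-- Diagonal rectangulations of size n (integral representatives)

record IsRectIn (n : ℕ) (U : Rect) : Set where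
  field
    left<right : left U < right U
    right≤n    : right U ≤ n
    bottom<top : bottom U < top U
    top≤n      : top U ≤ n

-- Rectangles with lattice corners cover S with disjoint interiors iff every
-- unit cell of S is contained in exactly one of them.
record IsSubdivision (n : ℕ) (R : List Rect) : Set where
  field
    unique : Unique R
    inside : All (IsRectIn n) R
    covers : ∀ i j → i < n → j < n → ∃! _≡_ (λ U → U ∈ R × CellIn i j U)

-- In noCrossing, lattice points suffice: distinct walls on a common line are
-- disjoint by maximality, and perpendicular ones meet in a lattice point.
record IsDRec (n : ℕ) (R : List Rect) : Set where
  field
    isSubdivision   : IsSubdivision n R
    noCrossing      : ∀ s s′ → IsWall n R s → IsWall n R s′ → s ≢ s′ →
                      ∀ p → p ∈ˢ° s → ¬ (p ∈ˢ° s′)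
    wallHasPoint    : ∀ s → IsWall n R s →
                      ∃[ i ] (1 ≤ i × i < n × diagPoint n i ∈ˢ s)
    pointOnOneWall  : ∀ i → 1 ≤ i → i < n →
                      ∃! _≡_ (λ s → IsWall n R s × diagPoint n i ∈ˢ s)

dRec : ℕ → Set
dRec n = Σ (List Rect) (IsDRec n)

-- A rectangulation is the set of its rectangles; the order of the list
-- carries no information.
_≈ᴸ_ : List Rect → List Rect → Set
R ≈ᴸ R′ = ∀ U → U ∈ R ⇔ U ∈ R′

_≈ᴰ_ : ∀ {n} → dRec n → dRec n → Set
R ≈ᴰ R′ = proj₁ R ≈ᴸ proj₁ R′

------------------------------------------------------------------------
-- The map ρ

-- The largest m ≤ b satisfying P, or 0 if there is none.
greatest : {P : ℕ → Set} → Decidable P → ℕ → ℕ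
greatest P? zero    = zero
greatest P? (suc b) = if does (P? (suc b)) then suc b else greatest P? b

-- The union of the left and bottom edges of S and the rectangles in D.
InT : ℕ → List Rect → Point → Set
InT n D p@(x , y) = (x ≡ 0 × y ≤ n) ⊎ (y ≡ 0 × x ≤ n) ⊎ Any (p ∈ᴿ_) D

inT? : ∀ n D p → Dec (InT n D p)
inT? n D p@(x , y) =
  (x ≟ 0 ×-dec y ≤? n) ⊎-dec (y ≟ 0 ×-dec x ≤? n) ⊎-dec any? (p ∈ᴿ?_) D

-- The extremal points sought below are lattice points, because each lattice
-- line meets T in a union of intervals with integer ends.  T lies in S, so
-- the searches upward and to the right may start at n.
module _ (n : ℕ) (D : List Rect) where

  rightmostUpTo : (bound y : ℕ) → Point
  rightmostUpTo bound y = greatest (λ x → inT? n D (x , y)) bound , y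

  highestUpTo : (x bound : ℕ) → Point
  highestUpTo x bound = x , greatest (λ y → inT? n D (x , y)) bound

  topLeftCorner : Point → Point
  topLeftCorner p@(x , y) =
    if does (inT? n D p) then highestUpTo x n else rightmostUpTo x y

  bottomRightCorner : Point → Point
  bottomRightCorner p@(x , y) =
    if does (inT? n D p) then rightmostUpTo n y else highestUpTo x y

  newRect : ℕ → Rect
  newRect k = fromCorners (topLeftCorner (diagPoint n (k ∸ 1)))
                          (bottomRightCorner (diagPoint n k))

ρ : ℕ → List ℕ → List Rect
ρ n = foldl (λ D k → newRect n D k ∷ D) []

_≤ᴰ_ : ∀ {n} → dRec n → dRec n → Set
_≤ᴰ_ {n} (R , _) (R′ , _) = ∃[ x ] ∃[ x′ ]
  (IsTwistedBaxter n x × IsTwistedBaxter n x′ × ρ n x ≈ᴸ R × ρ n x′ ≈ᴸ R′ × x ≤ʷ x′)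

------------------------------------------------------------------------
-- The map β

module _ (n : ℕ) (R : List Rect) where

  -- The diagonal t ↦ (t , n - t) enters the interior of U right after this t.
  entry : Rect → ℕ
  entry U = left U ⊔ (n ∸ top U)

  -- The position of U among the members of R ordered by entry.
  label : Rect → ℕ
  label U = length (filter (λ V → entry V ≤? entry U) R)

  -- Edges of R leaving a point in each of the four directions.

  LeftEdge RightEdge UpEdge DownEdge : Point → Set
  LeftEdge (zero  , y) = ⊥
  LeftEdge (suc i , y) = HEdge R i y
  RightEdge (x , y) = HEdge R x y
  UpEdge (x , y) = VEdge R x y
  DownEdge (x , zero ) = ⊥
  DownEdge (x , suc j) = VEdge R x j

  leftEdge? : ∀ p → Dec (LeftEdge p)
  leftEdge? (zero  , y) = no λ ()
  leftEdge? (suc i , y) = hEdge? R i y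

  rightEdge? : ∀ p → Dec (RightEdge p)
  rightEdge? (x , y) = hEdge? R x y

  upEdge? : ∀ p → Dec (UpEdge p)
  upEdge? (x , y) = vEdge? R x y

  downEdge? : ∀ p → Dec (DownEdge p)
  downEdge? (x , zero ) = no λ ()
  downEdge? (x , suc j) = vEdge? R x j

  LeftVertex DownVertex : Point → Set
  LeftVertex p = LeftEdge p × UpEdge p × DownEdge p × ¬ RightEdge p
  DownVertex p = LeftEdge p × RightEdge p × DownEdge p × ¬ UpEdge p

  leftVertex? : ∀ p → Dec (LeftVertex p)
  leftVertex? p =
    leftEdge? p ×-dec upEdge? p ×-dec downEdge? p ×-dec ¬? (rightEdge? p)

  downVertex? : ∀ p → Dec (DownVertex p)
  downVertex? p =
    leftEdge? p ×-dec rightEdge? p ×-dec downEdge? p ×-dec ¬? (upEdge? p)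

  withBottomLeft : Point → Maybe Rect
  withBottomLeft (x , y) = find (λ V → left V ≟ x ×-dec bottom V ≟ y) R

  module _ (C : List Rect) where

    Covered : ℕ → ℕ → Set
    Covered i j = Any (CellIn i j) C

    covered? : ∀ i j → Dec (Covered i j)
    covered? i j = any? (cellIn? i j) C

    -- T is the union of the rectangles in C with the left and bottom sides
    -- of S.  A unit edge inside S is on the boundary of T iff exactly one of
    -- the two cells beside it is in T; the left and bottom sides of S are
    -- always on the boundary.

    -- The edge {x} × [y,y+1] is on the boundary of T.
    TurnsUp : ℕ → ℕ → Set
    TurnsUp zero    y = ⊤
    TurnsUp (suc i) y = (Covered i y × ¬ Covered (suc i) y)
                      ⊎ (¬ Covered i y × Covered (suc i) y)

    turnsUp? : ∀ x y → Dec (TurnsUp x y)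
    turnsUp? zero    y = yes _
    turnsUp? (suc i) y = (covered? i y ×-dec ¬? (covered? (suc i) y))
                   ⊎-dec (¬? (covered? i y) ×-dec covered? (suc i) y)

    -- The edge [x,x+1] × {y} is on the boundary of T.
    TurnsRight : ℕ → ℕ → Set
    TurnsRight x zero    = ⊤
    TurnsRight x (suc j) = (Covered x j × ¬ Covered x (suc j))
                         ⊎ (¬ Covered x j × Covered x (suc j))

    turnsRight? : ∀ x y → Dec (TurnsRight x y)
    turnsRight? x zero    = yes _
    turnsRight? x (suc j) = (covered? x j ×-dec ¬? (covered? x (suc j)))
                      ⊎-dec (¬? (covered? x j) ×-dec covered? x (suc j))

    -- In both cases the first turn strictly after the top-right corner of U
    -- is the one with the greatest remaining coordinate.
    U-A U-B : Rect → Maybe Rect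
    U-A U = withBottomLeft
      (greatest (λ x → turnsUp? x (top U)) (right U ∸ 1) , top U)
    U-B U = withBottomLeft
      (right U , greatest (λ y → turnsRight? (right U) y) (top U ∸ 1))

    -- The successor of U, where C consists of U and its predecessors.
    next : Rect → Maybe Rect
    next U =
      if does (right U ≟ n ×-dec top U ≟ n) then nothing
      else if does (leftVertex? p) then U-A U
      else if does (downVertex? p) then U-B U
      else nothing
      where
      p : Point
      p = right U , top U

  -- The first argument bounds the number of rectangles still to be chosen.
  walk : ℕ → List Rect → Maybe Rect → List Rect
  walk zero    C _        = []
  walk (suc m) C nothing  = []
  walk (suc m) C (just U) = U ∷ walk m (U ∷ C) (next (U ∷ C) U)

  chosenOrder : List Rect
  chosenOrder = walk (length R) [] (find ((0 , 0) ∈ᴿ?_) R)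

β : ℕ → List Rect → List ℕ
β n R = map (label n R) (chosenOrder n R)

{-# OPTIONS --safe #-}

-- Count the rows of S from the top, so that the diagonal becomes X = Y.  The
-- rectangle of ρ(x) labelled k is then [L,R] × [A,B], where L and A are the
-- greatest values below k that come before, respectively after, k in x, and
-- R + 1 and B + 1 are the least values above k that come after, respectively
-- before, k.  A subdivision is a diagonal rectangulation exactly when each
-- rectangle contains exactly one unit cell of the diagonal.
--
-- In the walk of β the union T of the chosen rectangles stays closed under
-- moving left and down, because no wall leaves upwards from the corners of T
-- above the current one, nor rightwards from those below.  Each step goes to the
-- inner corner of T next to the current rectangle, which excludes both
-- patterns, so β(R) is a Baxter permutation with ρ(β(R)) = R.
--
-- For the order, compare inversion sets.  If k < l is a pair with l ∸ k minimal
-- that is inverted in a Baxter permutation x but not in y, and the rectangles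
-- of x precede those of y, then all values between k and l lie before both or
-- after both, both kinds occur, and two consecutive values of different kinds
-- give a forbidden pattern in x or in y.  Conversely, the inversions of a
-- twisted Baxter permutation below y survive all slides d a ↦ a d that carry y
-- to the twisted Baxter permutation with the same rectangulation.

module Submission where

open import Defs
open import Data.Bool using (if_then_else_)
open import Data.Empty using (⊥; ⊥-elim)
open import Data.List as List
  using (List; []; _∷_; _++_; [_]; _∷ʳ_; applyUpTo; filter; find; foldl; length; upTo)
open import Data.List.Membership.Propositional
  using (_∈_; _∉_; lose) renaming (find to find∈)
open import Data.List.Membership.Propositional.Properties
  using ( ∈-∃++; ∈-++⁺ˡ; ∈-++⁺ʳ; ∈-++⁻; ∈-map⁺; ∈-map⁻; ∈-filter⁺; ∈-filter⁻
        ; ∈-applyUpTo⁺; ∈-applyUpTo⁻; ∈-upTo⁺; ∈-upTo⁻)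
open import Data.List.Membership.Propositional.Properties.WithK using (unique∧set⇒bag)
open import Data.List.Properties
  using (++-assoc; ++-identityʳ; ∷-injective; length-map; length-upTo; map-cong-local)
open import Data.List.Relation.Binary.BagAndSetEquality using (∼bag⇒↭)
open import Data.List.Relation.Binary.Permutation.Propositional
  using (_↭_; ↭-sym; ↭-trans; ↭-refl; ↭⇒↭ₛ; swap)
open import Data.List.Relation.Binary.Permutation.Propositional.Properties
  using (∈-resp-↭; drop-mid; ↭-empty-inv; ↭-length; ++⁺ˡ; shift)
import Data.List.Relation.Binary.Permutation.Setoid.Properties as SetoidPerm
open import Data.List.Relation.Unary.All as All using (All; []; _∷_)
open import Data.List.Relation.Unary.AllPairs using ([]; _∷_)
open import Data.List.Relation.Unary.Any as Any using (Any; here; there; any?)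
open import Data.List.Relation.Unary.Unique.Propositional using (Unique)
import Data.List.Relation.Unary.Unique.Propositional.Properties as Unique
open import Data.Maybe using (Maybe; just; nothing)
open import Data.Nat
open import Data.Nat.Properties
open import Data.Product using (∃!; ∃-syntax; Σ-syntax; _×_; _,_; proj₁; proj₂; map)
open import Data.Sum as Sum using (_⊎_; inj₁; inj₂)
open import Function.Base using (_∘_; id; case_of_)
open import Function.Bundles using (mk⇔; Equivalence)
open import Function.Definitions using (Inverseᵇ)
open import Relation.Binary.Construct.Closure.ReflexiveTransitive as Star
  using (Star; ε; _◅_; _◅◅_)
open import Relation.Binary.Definitions using (tri<; tri≈; tri>)
open import Relation.Binary.Morphism.Structures using (IsOrderIsomorphism)
open import Relation.Binary.PropositionalEquality hiding ([_])
open import Relation.Nullary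
  using (¬_; Dec; yes; no; does; contradiction; _×-dec_; _⊎-dec_)
open import Relation.Unary using (Decidable)

-- The link between permutations and rectangulations is read cell by cell. Take a unit cell in
-- column X and row Y, rows counted from the top. If X ≤ Y, its rectangle carries the label among
-- X+1, ..., Y+1 that comes first in x; if Y ≤ X, the label among Y+1, ..., X+1 that comes last.
-- Hence the rectangles partition the square, each meets the diagonal in the cell whose index is its
-- label minus one, and whether a point is already covered depends only on which labels occur in a
-- prefix of x.
--
-- The order on rectangulations is defined through twisted Baxter permutations, which in general
-- differ from the Baxter permutations with the same rectangulation. Inversions do not pass between
-- members of a class; only the positions of the sides do. The obstacle is therefore to recover all
-- inversions of a Baxter permutation from sides alone, and left and top sides turn out to suffice.

private variable
  A : Set
  u v w z : A
  xs ys : List A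

-- Positions of entries in a list without repetition

data Before {A : Set} (u v : A) : List A → Set where
  here  : ∀ {xs} → v ∈ xs → Before u v (u ∷ xs)
  there : ∀ {z xs} → Before u v xs → Before u v (z ∷ xs)

before-∈ˡ : Before u v xs → u ∈ xs
before-∈ˡ (here _)  = here refl
before-∈ˡ (there p) = there (before-∈ˡ p)

before-∈ʳ : Before u v xs → v ∈ xs
before-∈ʳ (here p)  = there p
before-∈ʳ (there p) = there (before-∈ʳ p)

∉-head : Unique (z ∷ xs) → z ∉ xs
∉-head (z∉ ∷ _) z∈ = All.lookup z∉ z∈ refl

∉-start : Unique (z ∷ xs) → ¬ Before u z (z ∷ xs)
∉-start uxs (here z∈) = ∉-head uxs z∈
∉-start uxs (there p) = ∉-head uxs (before-∈ʳ p)

before-asym : Unique xs → Before u v xs → ¬ Before v u xs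
before-asym uxs (here v∈) (here u∈) = ∉-head uxs u∈
before-asym uxs (here v∈) (there q) = ∉-head uxs (before-∈ʳ q)
before-asym uxs (there p) (here u∈) = ∉-head uxs (before-∈ʳ p)
before-asym (_ ∷ uxs) (there p) (there q) = before-asym uxs p q

before-irrefl : Unique xs → ¬ Before u u xs
before-irrefl uxs p = before-asym uxs p p

before-trans : Unique xs → Before u v xs → Before v w xs → Before u w xs
before-trans uxs (here v∈) (here w∈) = ⊥-elim (∉-head uxs v∈)
before-trans uxs (here v∈) (there q) = here (before-∈ʳ q)
before-trans uxs (there p) (here w∈) = ⊥-elim (∉-head uxs (before-∈ʳ p))
before-trans (_ ∷ uxs) (there p) (there q) = there (before-trans uxs p q)

before-total : u ∈ xs → v ∈ xs → u ≢ v → Before u v xs ⊎ Before v u xs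
before-total (here refl) (here refl) u≢v = contradiction refl u≢v
before-total (here refl) (there v∈) _ = inj₁ (here v∈)
before-total (there u∈) (here refl) _ = inj₂ (here u∈)
before-total (there u∈) (there v∈) u≢v =
  Sum.map there there (before-total u∈ v∈ u≢v)

before-++ : u ∈ xs → v ∈ ys → Before u v (xs ++ ys)
before-++ {xs = _ ∷ xs} (here refl) v∈ = here (∈-++⁺ʳ xs v∈)
before-++ (there u∈) v∈ = there (before-++ u∈ v∈)

before-++ʳ : ∀ xs → Before u v ys → Before u v (xs ++ ys)
before-++ʳ [] p = p
before-++ʳ (_ ∷ xs) p = there (before-++ʳ xs p)

before-split : ∀ xs → Unique (xs ++ z ∷ ys) → Before u z (xs ++ z ∷ ys) → u ∈ xs
before-split [] uxs p = ⊥-elim (∉-start uxs p)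
before-split (_ ∷ xs) uxs (here _) = here refl
before-split (_ ∷ xs) (_ ∷ uxs) (there p) = there (before-split xs uxs p)

after-split : ∀ xs → Unique (xs ++ z ∷ ys) → Before z u (xs ++ z ∷ ys) → u ∈ ys
after-split [] uxs (here u∈) = u∈
after-split [] uxs (there p) = ⊥-elim (∉-head uxs (before-∈ˡ p))
after-split (_ ∷ xs) uxs (here _) = ⊥-elim (∉-head uxs (∈-++⁺ʳ xs (here refl)))
after-split (_ ∷ xs) (_ ∷ uxs) (there p) = after-split xs uxs p

before-map : ∀ {B : Set} (f : A → B) → Before u v xs → Before (f u) (f v) (List.map f xs)
before-map f (here v∈) = here (∈-map⁺ f v∈)
before-map f (there p) = there (before-map f p)

before-swap : ∀ xs {a b : A} {ys} → Before u v (xs ++ a ∷ b ∷ ys) →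
  (u ≡ a × v ≡ b) ⊎ Before u v (xs ++ b ∷ a ∷ ys)
before-swap [] (here (here refl)) = inj₁ (refl , refl)
before-swap [] (here (there v∈))  = inj₂ (there (here v∈))
before-swap [] (there (here v∈))  = inj₂ (here (there v∈))
before-swap [] (there (there p))  = inj₂ (there (there p))
before-swap (x ∷ xs) (here v∈) with ∈-++⁻ xs v∈
... | inj₁ v∈xs = inj₂ (here (∈-++⁺ˡ v∈xs))
... | inj₂ (here p)         = inj₂ (here (∈-++⁺ʳ xs (there (here p))))
... | inj₂ (there (here p)) = inj₂ (here (∈-++⁺ʳ xs (here p)))
... | inj₂ (there (there p)) = inj₂ (here (∈-++⁺ʳ xs (there (there p))))
before-swap (x ∷ xs) (there p) with before-swap xs p
... | inj₁ eq = inj₁ eq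
... | inj₂ q  = inj₂ (there q)

-- Going from `u` to `v`, take the first entry found to satisfy `Q`; its predecessor satisfies `P`.
-- This supplies the two adjacent letters of a pattern, and the last two components put the other
-- letters on the correct sides of them.
crossing : ∀ {P Q : A → Set} {u v s} → Unique s → Before u v s → P u → Q v →
  (∀ {z} → Before u z s → Before z v s → P z ⊎ Q z) →
  ∃[ xs ] ∃[ y ] ∃[ z ] ∃[ ys ] (s ≡ xs ++ y ∷ z ∷ ys × P y × Q z ×
    (∀ {b} → Before b u s → b ∈ xs) × (∀ {c} → Before v c s → c ∈ ys))
crossing us@(_ ∷ us′) (there p) Pu Qv mid
  with crossing us′ p Pu Qv (λ q r → mid (there q) (there r))
... | xs , y , z , ys , refl , Py , Qz , below , above =
  _ ∷ xs , y , z , ys , refl , Py , Qz ,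
  (λ { (here _) → here refl ; (there q) → there (below q) }) ,
  (λ { (here _) → ⊥-elim (∉-head us (before-∈ʳ p)) ; (there q) → above q })
crossing us@(_ ∷ us′) (here (here refl)) Pu Qv mid =
  [] , _ , _ , _ , refl , Pu , Qv , (λ b → ⊥-elim (∉-start us b)) ,
  (λ { (here _) → ⊥-elim (∉-head us (here refl)) ; (there (here c∈)) → c∈
     ; (there (there r)) → before-∈ʳ r })
crossing {u = u} us@(_ ∷ us′) (here (there v∈)) Pu Qv mid
  with mid (here (here refl)) (there (here v∈))
... | inj₂ Qz = [] , _ , _ , _ , refl , Pu , Qz , (λ b → ⊥-elim (∉-start us b)) ,
  (λ { (here _) → ⊥-elim (∉-head us (there v∈)) ; (there (here _)) → ⊥-elim (∉-head us′ v∈)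
     ; (there (there r)) → before-∈ʳ r })
... | inj₁ Pz
  with crossing us′ (here v∈) Pz Qv (λ r r′ → mid (here (before-∈ʳ r)) (there r′))
... | xs , y , z , ys , eq , Py , Qz , _ , above =
  _ ∷ xs , y , z , ys , cong (u ∷_) eq , Py , Qz , (λ b → ⊥-elim (∉-start us b)) ,
  (λ { (here _) → ⊥-elim (∉-head us (there v∈)) ; (there r) → above r })

-- The weak order as inclusion of inversion sets

_⊑_ : List ℕ → List ℕ → Set
x ⊑ y = ∀ {k l} → k < l → Before l k x → Before l k y

unique-resp-↭ : ∀ {A : Set} {xs ys : List A} → xs ↭ ys → Unique xs → Unique ys
unique-resp-↭ {A = A} p = SetoidPerm.Unique-resp-↭ (setoid A) (↭⇒↭ₛ p)

perm-unique : ∀ {n x} → IsPerm n x → Unique x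
perm-unique {n} x↭ =
  unique-resp-↭ (↭-sym x↭) (Unique.applyUpTo⁺₁ suc n λ i<j _ eq → <⇒≢ i<j (suc-injective eq))

perm-∈ : ∀ {n x k} → IsPerm n x → k < n → suc k ∈ x
perm-∈ x↭ k<n = ∈-resp-↭ (↭-sym x↭) (∈-applyUpTo⁺ suc k<n)

perm-range : ∀ {n x k} → IsPerm n x → k ∈ x → ∃[ e ] (k ≡ suc e × e < n)
perm-range x↭ k∈ with ∈-applyUpTo⁻ suc (∈-resp-↭ x↭ k∈)
... | e , e<n , eq = e , eq , e<n

≤ʷ⇒⊑ : ∀ {x y} → x ≤ʷ y → x ⊑ y
≤ʷ⇒⊑ ε k<l p = p
≤ʷ⇒⊑ (swap-adjacent xs ys a<b ◅ x≤y) k<l p with before-swap xs p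
... | inj₁ (refl , refl) = contradiction a<b (<-asym k<l)
... | inj₂ q = ≤ʷ⇒⊑ x≤y k<l q

∷-mono-≤ʷ : ∀ z {x y} → x ≤ʷ y → (z ∷ x) ≤ʷ (z ∷ y)
∷-mono-≤ʷ z = Star.gmap (z ∷_) λ { (swap-adjacent xs ys a<b) → swap-adjacent (z ∷ xs) ys a<b }

bubble : ∀ {z} p {s} → All (_< z) p → (p ++ z ∷ s) ≤ʷ (z ∷ p ++ s)
bubble [] [] = ε
bubble (u ∷ p) (u<z ∷ p<z) =
  ∷-mono-≤ʷ u (bubble p p<z) ◅◅ (swap-adjacent [] (p ++ _) u<z ◅ ε)

-- Induction on `y`. Every entry of `x` before the first entry `z` of `y` is smaller than `z`, since
-- a larger one would give an inversion of `x` absent from `y`. So `z` moves to the front of `x` by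
-- upward covers, and the remaining lists are again comparable.
⊑⇒≤ʷ : ∀ {x y} → Unique x → Unique y → x ↭ y → x ⊑ y → x ≤ʷ y
⊑⇒≤ʷ {x} {[]} _ _ x↭y _ with refl ← ↭-empty-inv x↭y = ε
⊑⇒≤ʷ {x} {z ∷ ys} ux uy@(_ ∷ uys) x↭y x⊑y
  with p , s , refl ← ∈-∃++ (∈-resp-↭ (↭-sym x↭y) (here refl)) =
  bubble p (All.tabulate below) ◅◅ ∷-mono-≤ʷ z (⊑⇒≤ʷ ups uys ps↭ys ps⊑ys)
  where
  ps↭ys : p ++ s ↭ ys
  ps↭ys = drop-mid p [] x↭y
  ups : Unique (p ++ s)
  ups = unique-resp-↭ (↭-sym ps↭ys) uys
  below : ∀ {u} → u ∈ p → u < z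
  below {u} u∈ with <-cmp u z
  ... | tri< u<z _ _ = u<z
  ... | tri≈ _ refl _ = ⊥-elim (before-irrefl ux (before-++ u∈ (here refl)))
  ... | tri> _ _ z<u = ⊥-elim (before-asym uy (x⊑y z<u (before-++ u∈ (here refl)))
    (here (∈-resp-↭ ps↭ys (∈-++⁺ˡ u∈))))
  weaken : ∀ p {s u v} → Before u v (p ++ s) → Before u v (p ++ z ∷ s)
  weaken [] b = there b
  weaken (_ ∷ p) (here v∈) with ∈-++⁻ p v∈
  ... | inj₁ v∈p = here (∈-++⁺ˡ v∈p)
  ... | inj₂ v∈s = here (∈-++⁺ʳ p (there v∈s))
  weaken (_ ∷ p) (there b) = there (weaken p b)
  ps⊑ys : (p ++ s) ⊑ ys
  ps⊑ys k<l b with x⊑y k<l (weaken p b)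
  ... | here _ = ⊥-elim (∉-head uy (∈-resp-↭ ps↭ys (before-∈ˡ b)))
  ... | there b′ = b′

⊑-antisym : ∀ {x y} → Unique x → Unique y → x ↭ y → x ⊑ y → y ⊑ x → x ≡ y
⊑-antisym {[]} {y} _ _ x↭y _ _ = sym (↭-empty-inv (↭-sym x↭y))
⊑-antisym {a ∷ xs} {[]} _ _ x↭y _ _ = case ↭-empty-inv x↭y of λ ()
⊑-antisym {a ∷ xs} {b ∷ ys} ux@(_ ∷ uxs) uy@(_ ∷ uys) x↭y x⊑y y⊑x with a ≟ b
... | yes refl = cong (a ∷_) (⊑-antisym uxs uys (drop-mid [] [] x↭y) (strip ux x⊑y) (strip uy y⊑x))
  where
  strip : ∀ {z xs ys} → Unique (z ∷ xs) → (z ∷ xs) ⊑ (z ∷ ys) → xs ⊑ ys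
  strip u sub k<l p with sub k<l (there p)
  ... | here _ = ⊥-elim (∉-head u (before-∈ˡ p))
  ... | there q = q
... | no a≢b with ∈-resp-↭ x↭y (here refl) | ∈-resp-↭ (↭-sym x↭y) (here refl)
... | here eq | _ = contradiction eq a≢b
... | there _ | here eq = contradiction (sym eq) a≢b
... | there a∈ | there b∈ with <-cmp a b
... | tri< a<b _ _ = ⊥-elim (before-asym ux (here b∈) (y⊑x a<b (here a∈)))
... | tri≈ _ eq _ = contradiction eq a≢b
... | tri> _ _ b<a = ⊥-elim (before-asym uy (here a∈) (x⊑y b<a (here b∈)))

-- Comparison of two Baxter permutations

-- The counterpart of `crossing` for consecutive values; it supplies the two middle values of a
-- pattern.
boundary : ∀ {P Q : ℕ → Set} {i} j → i < j → P i → Q j →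
  (∀ {v} → i < v → v < j → P v ⊎ Q v) → ∃[ v ] (i ≤ v × v < j × P v × Q (suc v))
boundary {i = i} (suc j) i<sj Pi Qsj mid with i ≟ j
... | yes refl = j , ≤-refl , ≤-refl , Pi , Qsj
... | no i≢j with i<j ← ≤∧≢⇒< (≤-pred i<sj) i≢j | mid i<j ≤-refl
... | inj₁ Pj = j , <⇒≤ i<j , ≤-refl , Pj , Qsj
... | inj₂ Qj with boundary j i<j Pi Qj (λ i<v v<j → mid i<v (m<n⇒m<1+n v<j))
... | v , i≤v , v<j , Pv , Qv = v , i≤v , m<n⇒m<1+n v<j , Pv , Qv

-- What a rectangulation reveals about `x`: if `U` is the rectangle labelled `l` and `1 ≤ k`, then
-- `EarlyIn x k l` amounts to `k ≤ left U`, and `LateIn x k l` to `k ≤ n ∸ top U`.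
EarlyIn LateIn : List ℕ → ℕ → ℕ → Set
EarlyIn x k l = ∃[ j ] (k ≤ j × j < l × Before j l x)
LateIn  x k l = ∃[ j ] (k ≤ j × j < l × Before l j x)

module _ {n x} (x↭ : IsPerm n x) where

  perm-total : ∀ {u v} → 1 ≤ u → u ≤ n → 1 ≤ v → v ≤ n → u ≢ v → Before u v x ⊎ Before v u x
  perm-total {suc u} {suc v} _ u<n _ v<n = before-total (perm-∈ x↭ u<n) (perm-∈ x↭ v<n)

  perm-≥1 : ∀ {k} → k ∈ x → 1 ≤ k
  perm-≥1 k∈ with perm-range x↭ k∈
  ... | _ , refl , _ = s≤s z≤n

  perm-≤n : ∀ {k} → k ∈ x → k ≤ n
  perm-≤n k∈ with perm-range x↭ k∈
  ... | _ , refl , e<n = e<n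

module _ {n x y} (xB : IsBaxter n x) (yB : IsBaxter n y)
  -- Going up in the weak order moves large values to the left, so smaller values before `l` can
  -- only be lost and those after it only gained: the two implications run in opposite directions.
  (early : ∀ {k l} → 1 ≤ k → k < l → l ≤ n → EarlyIn y k l → EarlyIn x k l)
  (late  : ∀ {k l} → 1 ≤ k → k < l → l ≤ n → LateIn x k l → LateIn y k l)
  where

  private
    x↭ = proj₁ xB
    y↭ = proj₁ yB
    ux = perm-unique x↭
    uy = perm-unique y↭

  -- For a pair k < l inverted in x but not in y, with l ∸ k minimal, every
  -- value between k and l precedes both or follows both, and in the same way
  -- in x and y.  Two consecutive values of different kinds yield a pattern.
  module _ {d k l} (k<l : k < l) (l≤ : l ≤ k + suc d)
    (IH : ∀ {k l} → k < l → l ≤ k + d → Before l k x → Before l k y)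
    (lkx : Before l k x) (kly : Before k l y) where

    private
      1≤k = perm-≥1 x↭ (before-∈ʳ lkx)
      l≤n = perm-≤n x↭ (before-∈ˡ lkx)

      -- The pair reads `l`, `k` in `x` and `k`, `l` in `y`, so `E` says that `v` precedes both
      -- members in both lists, and `F` that it follows both.
      E F : ℕ → Set
      E v = Before v l x × Before v k y
      F v = Before k v x × Before l v y

      module _ {v} (k<v : k < v) (v<l : v < l) where

        low : Before v k x → Before v k y
        low = IH k<v (≤-pred (≤-trans v<l (≤-trans l≤ (≤-reflexive (+-suc k d)))))

        high : Before l v x → Before l v y
        high = IH v<l (≤-trans l≤ (≤-trans (≤-reflexive (+-suc k d)) (+-monoˡ-≤ d k<v)))

        vk = perm-total x↭ (≤-trans 1≤k (<⇒≤ k<v)) (≤-trans (<⇒≤ v<l) l≤n) 1≤k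
          (≤-trans (<⇒≤ k<l) l≤n) (>⇒≢ k<v)
        vl = perm-total x↭ (≤-trans 1≤k (<⇒≤ k<v)) (≤-trans (<⇒≤ v<l) l≤n) (≤-trans 1≤k (<⇒≤ k<l))
          l≤n (<⇒≢ v<l)

        dichotomy : E v ⊎ F v
        dichotomy with vl | vk
        ... | inj₁ vl | _ = inj₁ (vl , low (before-trans ux vl lkx))
        ... | inj₂ lv | inj₂ kv = inj₂ (kv , high lv)
        ... | inj₂ lv | inj₁ vk =
          ⊥-elim (before-asym uy kly (before-trans uy (high lv) (low vk)))

        mid-x : Before l v x → ¬ Before v k x
        mid-x lv vk = before-asym uy kly (before-trans uy (high lv) (low vk))

        mid-y : Before k v y → ¬ Before v l y
        mid-y kv vl′ with vk | vl
        ... | inj₁ vk | _ = before-asym uy kv (low vk)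
        ... | inj₂ _  | inj₂ lv = before-asym uy vl′ (high lv)
        ... | inj₂ kv | inj₁ vl = before-asym ux lkx (before-trans ux kv vl)

      outside : ∀ {z} → (k < z → z < l → ⊥) → z ≤ k ⊎ l ≤ z
      outside {z} no-mid with z ≤? k | l ≤? z
      ... | yes z≤k | _ = inj₁ z≤k
      ... | no _ | yes l≤z = inj₂ l≤z
      ... | no z≰k | no l≰z = ⊥-elim (no-mid (≰⇒> z≰k) (≰⇒> l≰z))

      -- Between `l` and `k` in `x` stands no value between `k` and `l`, so `crossing` finds
      -- adjacent `D`, `A` there with `l ≤ D` and `A ≤ k`. With `v` before and `suc v` after, this
      -- is 2-41-3.
      ascent : ∀ {v} → k < v → suc v < l → E v → F (suc v) → ⊥
      ascent k<v sv<l (vlx , _) (kvx , _)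
        with crossing {P = l ≤_} {Q = _≤ k} ux lkx ≤-refl ≤-refl
               (λ lz zk → Sum.swap (outside λ k<z z<l → mid-x k<z z<l lz zk))
      ... | xs , D , A , ys , eq , l≤D , A≤k , below , above = proj₂ (proj₂ xB)
        (xs , ys , A , _ , _ , D , eq , below vlx , above kvx ,
         ≤-<-trans A≤k k<v , ≤-refl , <-≤-trans sv<l l≤D)

      -- The scan now runs in `y` from `k` to `l`: `suc v`, the adjacent `A`, `D`, and `v` form
      -- 3-14-2.
      descent : ∀ {v} → k < v → suc v < l → F v → E (suc v) → ⊥
      descent k<v sv<l (_ , lvy) (_ , vky)
        with crossing {P = _≤ k} {Q = l ≤_} uy kly ≤-refl ≤-refl
               (λ kz zl → outside λ k<z z<l → mid-y k<z z<l kz zl)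
      ... | xs , A , D , ys , eq , A≤k , l≤D , below , above = proj₁ (proj₂ yB)
        (xs , ys , A , _ , _ , D , eq , below vky , above lvy ,
         ≤-<-trans A≤k k<v , ≤-refl , <-≤-trans sv<l l≤D)

    no-inversion-lost : ⊥
    no-inversion-lost
      -- As `k` precedes `l` in `y`, `early` yields some `i` before `l` in `x`; it differs from `k`,
      -- so it lies strictly between and is of kind `E`. Dually `late` yields `j` of kind `F`.
      with early 1≤k k<l l≤n (k , ≤-refl , k<l , kly) | late 1≤k k<l l≤n (k , ≤-refl , k<l , lkx)
    ... | i , k≤i , i<l , ilx | j , k≤j , j<l , ljy
      with k<i ← ≤∧≢⇒< k≤i (λ { refl → before-asym ux lkx ilx })
         | k<j ← ≤∧≢⇒< k≤j (λ { refl → before-asym uy kly ljy })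
      with dichotomy k<i i<l | dichotomy k<j j<l
    ... | inj₂ (kix , _) | _ = before-asym ux lkx (before-trans ux kix ilx)
    ... | _ | inj₁ (_ , jky) = before-asym uy kly (before-trans uy ljy jky)
    ... | inj₁ Ei | inj₂ Fj with <-cmp i j
    ... | tri≈ _ refl _ = before-asym ux lkx (before-trans ux (proj₁ Fj) (proj₁ Ei))
    ... | tri< i<j _ _ with boundary {E} {F} j i<j Ei Fj
                              (λ i<v v<j → dichotomy (<-trans k<i i<v) (<-trans v<j j<l))
    ...   | v , i≤v , v<j , Ev , Fv = ascent (<-≤-trans k<i i≤v) (≤-<-trans v<j j<l) Ev Fv
    no-inversion-lost | i , k≤i , i<l , ilx | j , k≤j , j<l , ljy | inj₁ Ei | inj₂ Fj | tri> _ _ j<i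
      with boundary {F} {E} i j<i Fj Ei
             (λ j<v v<i → Sum.swap (dichotomy (<-trans k<j j<v) (<-trans v<i i<l)))
    ...   | v , j≤v , v<i , Fv , Ev = descent (<-≤-trans k<j j≤v) (≤-<-trans v<i i<l) Fv Ev

  baxter-⊑ : x ⊑ y
  baxter-⊑ {k} {l} k<l = go l k<l (m≤n+m l k)
    where
    go : ∀ d {k l} → k < l → l ≤ k + d → Before l k x → Before l k y
    go zero {k} k<l l≤ _ = contradiction (<-≤-trans k<l (≤-trans l≤ (≤-reflexive (+-identityʳ k))))
      (<-irrefl refl)
    go (suc d) k<l l≤ lkx
      with perm-total y↭ (perm-≥1 x↭ (before-∈ˡ lkx)) (perm-≤n x↭ (before-∈ˡ lkx))
             (perm-≥1 x↭ (before-∈ʳ lkx)) (perm-≤n x↭ (before-∈ʳ lkx)) (>⇒≢ k<l)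
    ... | inj₁ lky = lky
    ... | inj₂ kly = ⊥-elim (no-inversion-lost k<l l≤ (go d) lkx kly)

-- Descending to the twisted Baxter permutation of a class

-- The order of the values `b` and `c` is left open, so one rule covers both 3-41-2 and 2-41-3; a
-- permutation that admits no slide is twisted Baxter.
data _↘_ : List ℕ → List ℕ → Set where
  slide : ∀ w t {a b c d} → b ∈ w → c ∈ t → a < b → b < d → a < c → c < d →
          (w ++ d ∷ a ∷ t) ↘ (w ++ a ∷ d ∷ t)

↘-⊑ : ∀ {y y′} → y ↘ y′ → y′ ⊑ y
↘-⊑ (slide w t _ _ a<b b<d _ _) k<l p with before-swap w p
... | inj₁ (refl , refl) = contradiction (<-trans a<b b<d) (<-asym k<l)
... | inj₂ q = q

↘-↭ : ∀ {y y′} → y ↘ y′ → y′ ↭ y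
↘-↭ (slide w t _ _ _ _ _ _) = ++⁺ˡ w (swap _ _ ↭-refl)

-- If `s` had `d` before `a`, then `s ⊑ y` would force `b` before `d` and `c` after `a` in `s`, and
-- no value between `a` and `d` could stand between them. Then `crossing` finds adjacent entries,
-- one at least `d` and the next at most `a`, which with `b` and `c` form a pattern forbidden in
-- `s`.
↘-greatest : ∀ {n s y y′} → IsTwistedBaxter n s → IsPerm n y → s ⊑ y → y ↘ y′ → s ⊑ y′
↘-greatest {n} {s} sT y↭ s⊑y (slide w t {a} {b} {c} {d} b∈ c∈ a<b b<d a<c c<d) k<l lks
  with before-swap w (s⊑y k<l lks)
... | inj₂ q = q
... | inj₁ (refl , refl) = ⊥-elim absurd
  where
  y = w ++ d ∷ a ∷ t
  s↭ = proj₁ sT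
  us = perm-unique s↭
  uy = perm-unique y↭
  1≤a = perm-≥1 y↭ (∈-++⁺ʳ w (there (here refl)))
  d≤n = perm-≤n y↭ (∈-++⁺ʳ w (here refl))
  after-a : ∀ {v} → v ∈ t → Before a v y
  after-a v∈ = before-++ʳ w (there (here v∈))
  module _ {v} (a<v : a < v) (v<d : v < d) where
    1≤v = ≤-trans 1≤a (<⇒≤ a<v)
    v≤n = ≤-trans (<⇒≤ v<d) d≤n
    early : v ∈ w → Before v d s
    early v∈ with perm-total s↭ 1≤v v≤n (≤-trans 1≤v (<⇒≤ v<d)) d≤n (<⇒≢ v<d)
    ... | inj₁ vd = vd
    ... | inj₂ dv = ⊥-elim (before-asym uy (before-++ v∈ (here refl)) (s⊑y v<d dv))
    late : v ∈ t → Before a v s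
    late v∈ with perm-total s↭ 1≤a (≤-trans (<⇒≤ a<v) v≤n) 1≤v v≤n (<⇒≢ a<v)
    ... | inj₁ av = av
    ... | inj₂ va = ⊥-elim (before-asym uy (after-a v∈) (s⊑y a<v va))
    mid : Before d v s → Before v a s → ⊥
    mid dv va with ∈-++⁻ w (∈-resp-↭ (↭-trans s↭ (↭-sym y↭)) (before-∈ʳ dv))
    ... | inj₁ v∈w = before-asym us dv (early v∈w)
    ... | inj₂ (here refl) = <-irrefl refl v<d
    ... | inj₂ (there (here refl)) = <-irrefl refl a<v
    ... | inj₂ (there (there v∈t)) = before-asym us va (late v∈t)
  outside : ∀ {z} → Before d z s → Before z a s → d ≤ z ⊎ z ≤ a
  outside {z} dz za with z ≤? a | d ≤? z
  ... | yes z≤a | _ = inj₂ z≤a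
  ... | no _ | yes d≤z = inj₁ d≤z
  ... | no z≰a | no d≰z = ⊥-elim (mid (≰⇒> z≰a) (≰⇒> d≰z) dz za)
  absurd : ⊥
  absurd with crossing {P = d ≤_} {Q = _≤ a} us lks ≤-refl ≤-refl outside
  -- `b < c` gives 2-41-3, and `c < b` gives 3-41-2.
  ... | xs , D , A , ys , eq , d≤D , A≤a , below , above with <-cmp b c
  ... | tri< b<c _ _ = proj₂ (proj₂ sT) (xs , ys , A , b , c , D , eq , below (early a<b b<d b∈) ,
          above (late a<c c<d c∈) , ≤-<-trans A≤a a<b , b<c , <-≤-trans c<d d≤D)
  ... | tri≈ _ refl _ = before-irrefl uy (before-++ {ys = d ∷ a ∷ t} b∈ (there (there c∈)))
  ... | tri> _ _ c<b = proj₁ (proj₂ sT) (xs , ys , A , c , b , D , eq , below (early a<b b<d b∈) ,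
          above (late a<c c<d c∈) , ≤-<-trans A≤a a<c , c<b , <-≤-trans b<d d≤D)

↘? : ∀ y → (∃[ y′ ] y ↘ y′) ⊎ (∀ y′ → ¬ y ↘ y′)
↘? y = Sum.map₂ (λ none y′ → λ { (slide w t {a} {d = d} b∈ c∈ a<b b<d a<c c<d) →
          none w t d a refl ((_ , b∈ , a<b , b<d) , (_ , c∈ , a<c , c<d)) }) (go [] y)
  where
  Mid : List ℕ → List ℕ → ℕ → ℕ → Set
  Mid w t d a = (∃[ b ] (b ∈ w × a < b × b < d)) × (∃[ c ] (c ∈ t × a < c × c < d))
  between? : ∀ xs a d → Dec (∃[ b ] (b ∈ xs × a < b × b < d))
  between? xs a d with any? (λ b → a <? b ×-dec b <? d) xs
  ... | yes p = yes (find∈ p)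
  ... | no ¬p = no λ (_ , b∈ , q) → ¬p (lose b∈ q)
  Result : List ℕ → List ℕ → Set
  Result w t = (∃[ y′ ] (w ++ t) ↘ y′) ⊎
    (∀ p q d a → t ≡ p ++ d ∷ a ∷ q → ¬ Mid (w ++ p) q d a)
  skip : ∀ w {d a t} → ¬ Mid w t d a → Result (w ∷ʳ d) (a ∷ t) → Result w (d ∷ a ∷ t)
  skip w {d} {a} {t} ¬m (inj₁ (y′ , s)) = inj₁ (y′ , subst (_↘ y′) (++-assoc w [ d ] (a ∷ t)) s)
  skip w {d} ¬m (inj₂ none) = inj₂ λ
    { [] _ _ _ refl m → ¬m (subst (λ w → Mid w _ _ _) (++-identityʳ w) m)
    ; (x ∷ p) q d′ a′ eq m → case ∷-injective eq of λ
      { (refl , eq′) → none p q d′ a′ eq′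
          (subst (λ w → Mid w _ _ _) (sym (++-assoc w [ d ] p)) m) } }
  go : ∀ w t → Result w t
  go w [] = inj₂ λ { [] _ _ _ () ; (_ ∷ _) _ _ _ () }
  go w (d ∷ []) = inj₂ λ { [] _ _ _ () ; (_ ∷ []) _ _ _ () ; (_ ∷ _ ∷ _) _ _ _ () }
  go w (d ∷ a ∷ t) with between? w a d | between? t a d | go (w ∷ʳ d) (a ∷ t)
  ... | yes (b , b∈ , a<b , b<d) | yes (c , c∈ , a<c , c<d) | _ =
    inj₁ (_ , slide w t b∈ c∈ a<b b<d a<c c<d)
  ... | no ¬p | _ | r = skip w (λ (p , _) → ¬p p) r
  ... | yes _ | no ¬q | r = skip w (λ (_ , q) → ¬q q) r

-- Each entry counts once for every entry to its right. Moving the smaller `a` in front of `d`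
-- lowers the sum by `d ∸ a`, so slides terminate.
weight : List ℕ → ℕ
weight [] = 0
weight (z ∷ xs) = z * length xs + weight xs

↘-weight : ∀ {y y′} → y ↘ y′ → weight y′ < weight y
↘-weight (slide w t {a} {d = d} _ _ a<b b<d _ _) = go w
  where
  go : ∀ w → weight (w ++ a ∷ d ∷ t) < weight (w ++ d ∷ a ∷ t)
  go [] = begin-strict
    a * suc m + (d * m + k)     ≡⟨ cong (_+ (d * m + k)) (*-suc a m) ⟩
    a + a * m + (d * m + k)     <⟨ +-monoˡ-< (d * m + k) (+-monoˡ-< (a * m) (<-trans a<b b<d)) ⟩
    d + a * m + (d * m + k)     ≡⟨ +-assoc d (a * m) _ ⟩
    d + (a * m + (d * m + k))   ≡⟨ cong (d +_) (sym (+-assoc (a * m) (d * m) k)) ⟩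
    d + (a * m + d * m + k)     ≡⟨ cong (λ z → d + (z + k)) (+-comm (a * m) (d * m)) ⟩
    d + (d * m + a * m + k)     ≡⟨ cong (d +_) (+-assoc (d * m) (a * m) k) ⟩
    d + (d * m + (a * m + k))   ≡⟨ sym (+-assoc d (d * m) _) ⟩
    d + d * m + (a * m + k)     ≡⟨ cong (_+ (a * m + k)) (sym (*-suc d m)) ⟩
    d * suc m + (a * m + k)     ∎
    where
    open ≤-Reasoning
    m = length t
    k = weight t
  go (z ∷ w) = subst (λ ℓ → z * ℓ + weight (w ++ a ∷ d ∷ t) < z * length (w ++ d ∷ a ∷ t) + weight
    (w ++ d ∷ a ∷ t))
    (↭-length (++⁺ˡ w (swap d a ↭-refl)))
    (+-monoʳ-< (z * length (w ++ d ∷ a ∷ t)) (go w))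

lower : ∀ {n y} → IsPerm n y → ∃[ t ] (Star _↘_ y t × IsTwistedBaxter n t)
lower {n} {y} = go (suc (weight y)) y ≤-refl
  where
  go : ∀ m y → weight y < m → IsPerm n y → ∃[ t ] (Star _↘_ y t × IsTwistedBaxter n t)
  go (suc m) y w< y↭ with ↘? y
  ... | inj₁ (y′ , s) with go m y′ (<-≤-trans (↘-weight s) (≤-pred w<)) (↭-trans (↘-↭ s) y↭)
  ...   | t , ss , tT = t , s ◅ ss , tT
  go (suc m) y w< y↭ | inj₂ none = y , ε , y↭ ,
    (λ { (xs , ys , a , b , c , d , refl , c∈ , b∈ , a<b , b<c , c<d) →
         none _ (slide xs ys c∈ b∈ (<-trans a<b b<c) c<d a<b (<-trans b<c c<d)) }) ,
    (λ { (xs , ys , a , b , c , d , refl , b∈ , c∈ , a<b , b<c , c<d) →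
         none _ (slide xs ys b∈ c∈ a<b (<-trans b<c c<d) (<-trans a<b b<c) c<d) })

lower-⊑ : ∀ {y t} → Star _↘_ y t → t ⊑ y
lower-⊑ ε k<l p = p
lower-⊑ (s ◅ ss) k<l p = ↘-⊑ s k<l (lower-⊑ ss k<l p)

-- With `lower-⊑`, the twisted Baxter permutation reached from `y` is the greatest one below `y`.
-- Hence lowering is monotone, which is what `ρ-monotone` rests on.
lower-greatest : ∀ {n s y t} → IsTwistedBaxter n s → IsPerm n y → s ⊑ y → Star _↘_ y t → s ⊑ t
lower-greatest sT y↭ s⊑y ε = s⊑y
lower-greatest sT y↭ s⊑y (r ◅ rs) =
  lower-greatest sT (↭-trans (↘-↭ r) y↭) (↘-greatest sT y↭ s⊑y r) rs

-- Greatest and extremal elements of ranges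

module _ {P : ℕ → Set} (P? : Decidable P) where

  greatest-≤ : ∀ b → greatest P? b ≤ b
  greatest-≤ zero = z≤n
  greatest-≤ (suc b) with P? (suc b)
  ... | yes _ = ≤-refl
  ... | no  _ = m≤n⇒m≤1+n (greatest-≤ b)

  greatest-sat : ∀ b → greatest P? b ≡ 0 ⊎ P (greatest P? b)
  greatest-sat zero = inj₁ refl
  greatest-sat (suc b) with P? (suc b)
  ... | yes p = inj₂ p
  ... | no  _ = greatest-sat b

  greatest-max : ∀ b {j} → greatest P? b < j → j ≤ b → ¬ P j
  greatest-max zero g<j j≤0 = contradiction (<-≤-trans g<j j≤0) (<-irrefl refl)
  greatest-max (suc b) {j} g<j j≤ with P? (suc b)
  ... | yes _ = contradiction (<-≤-trans g<j j≤) (<-irrefl refl)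
  ... | no ¬p with m≤n⇒m<n∨m≡n j≤
  ... | inj₁ j<  = greatest-max b g<j (≤-pred j<)
  ... | inj₂ refl = ¬p

  greatest-unique : ∀ {b m} → m ≤ b → m ≡ 0 ⊎ P m → (∀ {j} → m < j → j ≤ b → ¬ P j) →
    greatest P? b ≡ m
  greatest-unique {b} {m} m≤b sat max with <-cmp (greatest P? b) m
  ... | tri≈ _ eq _ = eq
  ... | tri< g<m _ _ with sat
  ...   | inj₁ refl = contradiction g<m λ ()
  ...   | inj₂ p = contradiction p (greatest-max b g<m m≤b)
  greatest-unique {b} m≤b sat max | tri> _ _ m<g with greatest-sat b
  ...   | inj₁ eq = contradiction (<-≤-trans m<g (≤-reflexive eq)) λ ()
  ...   | inj₂ p = contradiction p (max m<g (greatest-≤ b))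

-- Applied to precedence in `x` and to its converse, this finds the first and the last of a range of
-- values.
extremum : ∀ {_≺_ : ℕ → ℕ → Set} {i} j → i ≤ j →
  (∀ {u v} → i ≤ u → u ≤ j → i ≤ v → v ≤ j → u ≢ v → u ≺ v ⊎ v ≺ u) →
  (∀ {u v w} → u ≺ v → v ≺ w → u ≺ w) →
  ∃[ k ] (i ≤ k × k ≤ j × (∀ {t} → i ≤ t → t ≤ j → t ≢ k → k ≺ t))
extremum {i = i} j i≤j total tr with i ≟ j
... | yes refl = i , ≤-refl , ≤-refl , λ i≤t t≤i t≢i → contradiction (≤-antisym t≤i i≤t) t≢i
extremum zero z≤n total tr | no i≢j = contradiction refl i≢j
extremum {_≺_} {i} (suc j) i≤sj total tr | no i≢sj
  with extremum {_≺_} j (≤-pred (≤∧≢⇒< i≤sj i≢sj))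
         (λ a b c d → total a (m≤n⇒m≤1+n b) c (m≤n⇒m≤1+n d)) tr
... | k , i≤k , k≤j , min with total i≤k (m≤n⇒m≤1+n k≤j) i≤sj ≤-refl (<⇒≢ (s≤s k≤j))
... | inj₁ k≺ = k , i≤k , m≤n⇒m≤1+n k≤j , λ i≤t t≤ t≢k → case m≤n⇒m<n∨m≡n t≤ of λ
  { (inj₁ t<) → min i≤t (≤-pred t<) t≢k ; (inj₂ refl) → k≺ }
... | inj₂ ≺k = suc j , i≤sj , ≤-refl , λ {t} i≤t t≤ t≢ → case t ≟ k of λ
  { (yes refl) → ≺k ; (no t≢k) → tr ≺k (min i≤t (≤-pred (≤∧≢⇒< t≤ t≢)) t≢k) }

-- The rectangle of a label in terms of the order of the entries

-- With Q complementary to P, l is the greatest positive element of P up to e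
-- (0 if there is none), and r + 1 the least element of P above k (n + 1 if none).
MaxBelow : (P Q : ℕ → Set) → ℕ → ℕ → Set
MaxBelow P Q e l = l ≤ e × (l ≡ 0 ⊎ P l) × (∀ {j} → l < j → j ≤ e → Q j)

MinAbove : (P Q : ℕ → Set) → ℕ → ℕ → ℕ → Set
MinAbove P Q k n r = k ≤ r × r ≤ n × (r ≡ n ⊎ P (suc r)) × (∀ {j} → k < j → j ≤ r → Q j)

module _ {P Q : ℕ → Set} where

  maxBelow : ∀ e → (∀ {j} → 1 ≤ j → j ≤ e → P j ⊎ Q j) → ∃[ l ] MaxBelow P Q e l
  maxBelow zero _ = 0 , z≤n , inj₁ refl , λ 0<j j≤0 → contradiction (<-≤-trans 0<j j≤0) λ ()
  maxBelow (suc e) PQ with PQ (s≤s z≤n) ≤-refl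
  ... | inj₁ p = suc e , ≤-refl , inj₂ p ,
    λ l<j j≤l → contradiction (<-≤-trans l<j j≤l) (<-irrefl refl)
  ... | inj₂ q with maxBelow e (λ 1≤j j≤e → PQ 1≤j (m≤n⇒m≤1+n j≤e))
  ... | l , l≤e , sat , max = l , m≤n⇒m≤1+n l≤e , sat , λ l<j j≤ → case m≤n⇒m<n∨m≡n j≤ of λ
    { (inj₁ j<) → max l<j (≤-pred j<) ; (inj₂ refl) → q }

  minAbove : ∀ d {k n} → k + d ≡ n → (∀ {j} → k < j → j ≤ n → P j ⊎ Q j) → ∃[ r ] MinAbove P Q k n r
  minAbove zero {k} refl _ = k , ≤-refl , m≤m+n k 0 , inj₁ (sym (+-identityʳ k)) ,
    λ l<j j≤l → contradiction (<-≤-trans l<j j≤l) (<-irrefl refl)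
  minAbove (suc d) {k} {n} refl PQ with PQ ≤-refl k<n
    where
    k<n : k < k + suc d
    k<n = m<m+n k (s≤s z≤n)
  ... | inj₁ p = k , ≤-refl , m≤m+n k (suc d) , inj₂ p ,
    λ l<j j≤l → contradiction (<-≤-trans l<j j≤l) (<-irrefl refl)
  ... | inj₂ q with minAbove d {suc k} (sym (+-suc k d)) (λ k<j → PQ (<-trans ≤-refl k<j))
  ... | r , k<r , r≤n , sat , min = r , <⇒≤ k<r , r≤n , sat , λ k<j j≤r → case m≤n⇒m<n∨m≡n k<j of λ
    { (inj₁ sk<j) → min sk<j j≤r ; (inj₂ refl) → q }

  module _ (excl : ∀ {j} → P j → ¬ Q j) where

    maxBelow-unique : ∀ {e l l′} → MaxBelow P Q e l → MaxBelow P Q e l′ → l ≡ l′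
    maxBelow-unique m m′ = ≤-antisym (go m m′) (go m′ m)
      where
      go : ∀ {e l l′} → MaxBelow P Q e l → MaxBelow P Q e l′ → l ≤ l′
      go (_ , inj₁ refl , _) _ = z≤n
      go (l≤e , inj₂ p , _) (_ , _ , max) = ≮⇒≥ λ l′<l → excl p (max l′<l l≤e)

    minAbove-unique : ∀ {k n r r′} → MinAbove P Q k n r → MinAbove P Q k n r′ → r ≡ r′
    minAbove-unique m m′ = ≤-antisym (go m m′) (go m′ m)
      where
      go : ∀ {k n r r′} → MinAbove P Q k n r → MinAbove P Q k n r′ → r ≤ r′
      go (_ , r≤n , _) (_ , _ , inj₁ refl , _) = r≤n
      go (_ , _ , _ , min) (k≤r′ , _ , inj₂ p , _) = ≮⇒≥ λ r′<r → excl p (min (s≤s k≤r′) r′<r)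

    module _ {n e L R A B}
      (left  : MaxBelow P Q e L) (right : MinAbove Q P (suc e) n R)
      (above : MaxBelow Q P e A) (below : MinAbove P Q (suc e) n B)
      where

      -- With `P` for earlier and `Q` for later than `suc e`, the conclusion makes `suc e` the first
      -- in `x` of the values X+1, ..., Y+1. Were `e` outside that range, a value next to `suc e`
      -- would be both earlier and later. Exchanging `P` with `Q` and the axes gives the cells on
      -- the other side of the diagonal, with last in place of first.
      cell⇒extremal : ∀ {X Y} → X ≤ Y → L ≤ X → X < R → A ≤ Y → Y < B →
        X ≤ e × e ≤ Y × (∀ {t} → X ≤ t → t ≤ Y → t ≢ e → Q (suc t))
      cell⇒extremal {X} {Y} X≤Y L≤X X<R A≤Y Y<B = ≮⇒≥ e≮X , ≮⇒≥ Y≮e , between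
        where
        e≮X : ¬ e < X
        e≮X e<X = excl (proj₂ (proj₂ (proj₂ right)) ≤-refl (≤-<-trans e<X X<R))
                       (proj₂ (proj₂ (proj₂ below)) ≤-refl (≤-<-trans (≤-trans e<X X≤Y) Y<B))
        Y≮e : ¬ Y < e
        Y≮e Y<e = excl (proj₂ (proj₂ above) (≤-<-trans A≤Y Y<e) ≤-refl)
                       (proj₂ (proj₂ left) (≤-<-trans (≤-trans L≤X X≤Y) Y<e) ≤-refl)
        between : ∀ {t} → X ≤ t → t ≤ Y → t ≢ e → Q (suc t)
        between {t} X≤t t≤Y t≢e with <-cmp t e
        ... | tri< t<e _ _ = proj₂ (proj₂ left) (s≤s (≤-trans L≤X X≤t)) t<e
        ... | tri≈ _ eq _ = contradiction eq t≢e
        ... | tri> _ _ e<t = proj₂ (proj₂ (proj₂ below)) (s≤s e<t) (≤-<-trans t≤Y Y<B)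

      extremal⇒cell : ∀ {X Y} → Y < n → X ≤ e → e ≤ Y →
        (∀ {t} → X ≤ t → t ≤ Y → t ≢ e → Q (suc t)) →
        L ≤ X × X < R × A ≤ Y × Y < B
      extremal⇒cell {X} {Y} Y<n X≤e e≤Y min = ≮⇒≥ (X≮L left) , ≤-<-trans X≤e (proj₁ right) ,
        ≤-trans (proj₁ above) e≤Y , ≰⇒> (B≰Y below)
        where
        X≮L : ∀ {L} → MaxBelow P Q e L → ¬ X < L
        X≮L {suc t} (t<e , inj₂ p , _) X<L =
          excl p (min (≤-pred X<L) (<⇒≤ (<-≤-trans t<e e≤Y)) (<⇒≢ t<e))
        B≰Y : ∀ {B} → MinAbove P Q (suc e) n B → ¬ B ≤ Y
        B≰Y (_ , _ , inj₁ refl , _) B≤Y = <-irrefl refl (≤-<-trans B≤Y Y<n)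
        B≰Y (e<B , _ , inj₂ p , _) B≤Y = excl p (min (≤-trans X≤e (<⇒≤ e<B)) B≤Y (>⇒≢ e<B))

Earlier Later : List ℕ → ℕ → ℕ → Set
Earlier x k j = Before j k x
Later   x k j = Before k j x

-- Rows count from the top, hence the complements; the two bounds by `n` let these truncated
-- differences determine `top U` and `bottom U`. The label is `suc e`, so that `e` is the index of
-- the diagonal cell of `U`.
record Placed (n : ℕ) (x : List ℕ) (e : ℕ) (U : Rect) : Set where
  field
    left-is  : MaxBelow (Earlier x (suc e)) (Later x (suc e)) e (left U)
    above-is : MaxBelow (Later x (suc e)) (Earlier x (suc e)) e (n ∸ top U)
    right-is : MinAbove (Later x (suc e)) (Earlier x (suc e)) (suc e) n (right U)
    below-is : MinAbove (Earlier x (suc e)) (Later x (suc e)) (suc e) n (n ∸ bottom U)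
    top≤n    : top U ≤ n
    bottom≤n : bottom U ≤ n

firstDiag : ℕ → Rect → ℕ
firstDiag n U = left U ⊔ (n ∸ top U)

lastDiag : ℕ → Rect → ℕ
lastDiag n U = right U ⊓ (n ∸ bottom U)

-- Reflected coordinates: row Y counts from the top, so the diagonal is X = Y.
FCell : ℕ → ℕ → ℕ → Rect → Set
FCell n X Y U = left U ≤ X × X < right U × n ∸ top U ≤ Y × Y < n ∸ bottom U

cell⇒fcell : ∀ {n i j U} → j < n → CellIn i j U → FCell n i (n ∸ suc j) U
cell⇒fcell {n} j<n (l , r , b , t) = l , r , ∸-monoʳ-≤ n t , ∸-monoʳ-< (s≤s b) j<n

fcell⇒cell : ∀ {n i j U} → j < n → FCell n i (n ∸ suc j) U → CellIn i j U
fcell⇒cell {n} j<n (l , r , a , b) = l , r , ≤-pred (∸-cancelʳ-< b) , ∸-cancelʳ-≤ j<n a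

suc-∸-suc : ∀ {n Y} → Y < n → suc (n ∸ suc Y) ≡ n ∸ Y
suc-∸-suc {n} Y<n = sym (+-∸-assoc 1 Y<n)

∸-suc-involutive : ∀ {n Y} → Y < n → n ∸ suc (n ∸ suc Y) ≡ Y
∸-suc-involutive {n} Y<n = trans (cong (n ∸_) (suc-∸-suc Y<n)) (m∸[m∸n]≡n (<⇒≤ Y<n))

module _ {n x} (x↭ : IsPerm n x) where

  private
    ux = perm-unique x↭
    asym : ∀ {u v} → Before u v x → ¬ Before v u x
    asym = before-asym ux

  module _ {e U} (pl : Placed n x e U) where
    open Placed pl

    cell-low : ∀ {X Y} → X ≤ Y → FCell n X Y U →
      X ≤ e × e ≤ Y × (∀ {t} → X ≤ t → t ≤ Y → t ≢ e → Later x (suc e) (suc t))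
    cell-low X≤Y (l , r , a , b) = cell⇒extremal asym left-is right-is above-is below-is X≤Y l r a b

    cell-low⁻ : ∀ {X Y} → Y < n → X ≤ e → e ≤ Y →
      (∀ {t} → X ≤ t → t ≤ Y → t ≢ e → Later x (suc e) (suc t)) →
      FCell n X Y U
    cell-low⁻ = extremal⇒cell asym left-is right-is above-is below-is

    cell-high : ∀ {X Y} → Y ≤ X → FCell n X Y U →
      Y ≤ e × e ≤ X × (∀ {t} → Y ≤ t → t ≤ X → t ≢ e → Earlier x (suc e) (suc t))
    cell-high Y≤X (l , r , a , b) = cell⇒extremal asym above-is below-is left-is right-is Y≤X a b l
      r

    cell-high⁻ : ∀ {X Y} → X < n → Y ≤ e → e ≤ X →
      (∀ {t} → Y ≤ t → t ≤ X → t ≢ e → Earlier x (suc e) (suc t)) →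
      FCell n X Y U
    cell-high⁻ X<n Y≤e e≤X max
      with extremal⇒cell asym above-is below-is left-is right-is X<n Y≤e e≤X max
    ... | a , b , l , r = l , r , a , b

    -- If both bounds were below `e`, the value `e` would come both before and after `suc e`. So a
    -- rectangle by itself determines its label.
    placed-firstDiag : firstDiag n U ≡ e
    placed-firstDiag = ≤-antisym (⊔-lub (proj₁ left-is) (proj₁ above-is)) e≤
      where
      e≤ : e ≤ firstDiag n U
      e≤ with e ≤? left U | e ≤? (n ∸ top U)
      ... | yes e≤l | _ = ≤-trans e≤l (m≤m⊔n _ _)
      ... | no _ | yes e≤a = ≤-trans e≤a (m≤n⊔m (left U) _)
      ... | no e≰l | no e≰a = ⊥-elim (asym (proj₂ (proj₂ above-is) (≰⇒> e≰a) ≤-refl)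
                                           (proj₂ (proj₂ left-is) (≰⇒> e≰l) ≤-refl))

    placed-lastDiag : lastDiag n U ≡ suc e
    placed-lastDiag = ≤-antisym ≤e (⊓-glb (proj₁ right-is) (proj₁ below-is))
      where
      ≤e : lastDiag n U ≤ suc e
      ≤e with right U ≤? suc e | (n ∸ bottom U) ≤? suc e
      ... | yes r≤ | _ = ≤-trans (m⊓n≤m _ _) r≤
      ... | no _ | yes b≤ = ≤-trans (m⊓n≤n (right U) _) b≤
      ... | no r≰ | no b≰ = ⊥-elim (asym (proj₂ (proj₂ (proj₂ right-is)) ≤-refl (≰⇒> r≰))
                                         (proj₂ (proj₂ (proj₂ below-is)) ≤-refl (≰⇒> b≰)))

  placed-unique : ∀ {e U V} → Placed n x e U → Placed n x e V → U ≡ V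
  placed-unique {U = rect _ _ _ _} {rect _ _ _ _} p q
    with maxBelow-unique asym (Placed.left-is p) (Placed.left-is q)
       | maxBelow-unique asym (Placed.above-is p) (Placed.above-is q)
       | minAbove-unique asym (Placed.right-is p) (Placed.right-is q)
       | minAbove-unique asym (Placed.below-is p) (Placed.below-is q)
  ... | refl | eqa | refl | eqb
    with ∸-cancelˡ-≡ (Placed.top≤n p) (Placed.top≤n q) eqa
       | ∸-cancelˡ-≡ (Placed.bottom≤n p) (Placed.bottom≤n q) eqb
  ... | refl | refl = refl

  placed-exists : ∀ {e} → e < n → ∃[ U ] Placed n x e U
  placed-exists {e} e<n
    with maxBelow e below | maxBelow e (λ a b → Sum.swap (below a b))
       | minAbove (n ∸ suc e) {suc e} (m+[n∸m]≡n e<n) above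
       | minAbove (n ∸ suc e) {suc e} (m+[n∸m]≡n e<n) (λ a b → Sum.swap (above a b))
    where
    below : ∀ {j} → 1 ≤ j → j ≤ e → Before j (suc e) x ⊎ Before (suc e) j x
    below 1≤j j≤e = perm-total x↭ 1≤j (≤-trans j≤e (<⇒≤ e<n)) (s≤s z≤n) e<n (<⇒≢ (s≤s j≤e))
    above : ∀ {j} → suc e < j → j ≤ n → Before (suc e) j x ⊎ Before j (suc e) x
    above e<j j≤n = perm-total x↭ (s≤s z≤n) e<n (≤-trans (s≤s z≤n) e<j) j≤n (<⇒≢ e<j)
  ... | l , ml | a , ma | r , mr | b , mb = rect l r (n ∸ b) (n ∸ a) , record
    { left-is = ml
    ; above-is = subst (MaxBelow (Later x (suc e)) (Earlier x (suc e)) e)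
      (sym (m∸[m∸n]≡n (≤-trans (proj₁ ma) (<⇒≤ e<n)))) ma
    ; right-is = mr
    ; below-is = subst (MinAbove (Earlier x (suc e)) (Later x (suc e)) (suc e) n)
      (sym (m∸[m∸n]≡n (proj₁ (proj₂ mb)))) mb
    ; top≤n = m∸n≤m n a ; bottom≤n = m∸n≤m n b }

  early-∈ : ∀ {X Y} → X ≤ Y → Y < n → ∃[ e ] (X ≤ e × e ≤ Y ×
    (∀ {t} → X ≤ t → t ≤ Y → t ≢ e → Before (suc e) (suc t) x))
  early-∈ {Y = Y} X≤Y Y<n = extremum Y X≤Y
    (λ _ u≤Y _ v≤Y u≢v → before-total (perm-∈ x↭ (≤-<-trans u≤Y Y<n))
      (perm-∈ x↭ (≤-<-trans v≤Y Y<n)) (u≢v ∘ suc-injective))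
    (before-trans ux)

  late-∈ : ∀ {X Y} → Y ≤ X → X < n → ∃[ e ] (Y ≤ e × e ≤ X ×
    (∀ {t} → Y ≤ t → t ≤ X → t ≢ e → Before (suc t) (suc e) x))
  late-∈ {X} Y≤X X<n = extremum X Y≤X
    (λ _ u≤X _ v≤X u≢v → before-total (perm-∈ x↭ (≤-<-trans v≤X X<n))
      (perm-∈ x↭ (≤-<-trans u≤X X<n)) (u≢v ∘ sym ∘ suc-injective))
    (λ p q → before-trans ux q p)

  placed-cover : ∀ {X Y} → X < n → Y < n → ∃[ e ] (e < n × ∃[ U ] (Placed n x e U × FCell n X Y U))
  placed-cover {X} {Y} X<n Y<n with ≤-total X Y
  ... | inj₁ X≤Y with early-∈ X≤Y Y<n
  ...   | e , X≤e , e≤Y , min with placed-exists (≤-<-trans e≤Y Y<n)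
  ...     | U , p = e , ≤-<-trans e≤Y Y<n , U , p , cell-low⁻ p Y<n X≤e e≤Y min
  placed-cover {X} {Y} X<n Y<n | inj₂ Y≤X with late-∈ Y≤X X<n
  ...   | e , Y≤e , e≤X , max with placed-exists (≤-<-trans e≤X X<n)
  ...     | U , p = e , ≤-<-trans e≤X X<n , U , p , cell-high⁻ p X<n Y≤e e≤X max

  placed-cover-unique : ∀ {X Y e e′ U U′} → Placed n x e U → Placed n x e′ U′ →
    FCell n X Y U → FCell n X Y U′ → e ≡ e′
  placed-cover-unique {X} {Y} {e} {e′} p p′ c c′ with e ≟ e′ | ≤-total X Y
  ... | yes eq | _ = eq
  ... | no e≢e′ | inj₁ X≤Y with cell-low p X≤Y c | cell-low p′ X≤Y c′
  ...   | X≤e , e≤Y , min | X≤e′ , e′≤Y , min′ =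
    ⊥-elim (asym (min X≤e′ e′≤Y (e≢e′ ∘ sym)) (min′ X≤e e≤Y e≢e′))
  placed-cover-unique {X} {Y} {e} {e′} p p′ c c′ | no e≢e′ | inj₂ Y≤X
    with cell-high p Y≤X c | cell-high p′ Y≤X c′
  ...   | Y≤e , e≤X , max | Y≤e′ , e′≤X , max′ =
    ⊥-elim (asym (max Y≤e′ e′≤X (e≢e′ ∘ sym)) (max′ Y≤e e≤X e≢e′))

-- The rectangles drawn by `ρ`

if-yes : ∀ {P A : Set} {a b : A} (P? : Dec P) → P → (if does P? then a else b) ≡ a
if-yes (yes _) _ = refl
if-yes (no ¬p) p = contradiction p ¬p

if-no : ∀ {P A : Set} {a b : A} (P? : Dec P) → ¬ P → (if does P? then a else b) ≡ b
if-no (yes p) ¬p = contradiction p ¬p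
if-no (no _) _ = refl

prefix-closed : ∀ {A : Set} w {s} {u v : A} → Unique (w ++ s) → Before u v (w ++ s) → v ∈ w → u ∈ w
prefix-closed (z ∷ w) uws (here _) _ = here refl
prefix-closed (z ∷ w) uws (there p) (here refl) = ⊥-elim (∉-head uws (before-∈ʳ p))
prefix-closed (z ∷ w) (_ ∷ uws) (there p) (there v∈) = there (prefix-closed w uws p v∈)

-- `Placed` refers to the whole of `x`, not to the prefix `w`: a rectangle is final once drawn, and
-- depends on `x` only through which labels precede its own.
record Built (n : ℕ) (x w : List ℕ) (D : List Rect) : Set where
  field
    sound    : ∀ {U} → U ∈ D → ∃[ e ] (suc e ∈ w × Placed n x e U)
    complete : ∀ {e} → suc e ∈ w → ∃[ U ] (U ∈ D × Placed n x e U)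
    unique   : Unique D

module Step {n e} {w s : List ℕ} (x↭ : IsPerm n (w ++ suc e ∷ s))
  {D} (built : Built n (w ++ suc e ∷ s) w D) where

  open Built built

  private
    x = w ++ suc e ∷ s
    ux = perm-unique x↭

    k≤n : suc e ≤ n
    k≤n = perm-≤n x↭ (∈-++⁺ʳ w (here refl))

    earlier⇒∈ : ∀ {j} → Before j (suc e) x → j ∈ w
    earlier⇒∈ = before-split w ux

    later⇒∉ : ∀ {j} → Before (suc e) j x → j ∉ w
    later⇒∉ p j∈ = before-asym ux p (before-++ j∈ (here refl))

    k∉ : suc e ∉ w
    k∉ k∈ = before-irrefl ux (before-++ k∈ (here refl))

    not-both : ∀ {j} → Before j (suc e) x → ¬ Before (suc e) j x
    not-both = before-asym ux

    inT⇒rect : ∀ {X Y} → 1 ≤ X → Y < n → InT n D (X , n ∸ Y) →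
      ∃[ d ] ∃[ U ] (suc d ∈ w × Placed n x d U × X ≤ right U × n ∸ top U ≤ Y)
    inT⇒rect () _ (inj₁ (refl , _))
    inT⇒rect _ Y<n (inj₂ (inj₁ (eq , _))) = contradiction (m<n⇒0<n∸m Y<n) (<-irrefl (sym eq))
    inT⇒rect _ Y<n (inj₂ (inj₂ p)) with find∈ p
    ... | U , U∈ , _ , r , _ , t with sound U∈
    ... | d , d∈ , pl = d , U , d∈ , pl , r ,
      ≤-trans (∸-monoʳ-≤ n t) (≤-reflexive (m∸[m∸n]≡n (<⇒≤ Y<n)))

    -- The point is the top-right corner of the cell in column `X ∸ 1` and row `Y`, which goes to
    -- the first of the labels X, ..., Y+1. As `w` is a prefix, that label is drawn as soon as any
    -- of them is. In `T-high` the cell goes to the last of its labels, so all of them must be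
    -- drawn.
    T-low : ∀ {X Y} → 1 ≤ X → Y < n → X ≤ suc Y → InT n D (X , n ∸ Y) →
      ∃[ j ] (X ≤ j × j ≤ suc Y × j ∈ w)
    T-low {X} {Y} 1≤X Y<n X≤ p with inT⇒rect 1≤X Y<n p
    ... | d , U , d∈ , pl , r , a with X ≤? suc d | suc d ≤? suc Y
    ... | yes X≤d | yes d≤Y = suc d , X≤d , d≤Y , d∈
    ... | no X≰d | _ = X , ≤-refl , X≤ ,
      prefix-closed w ux (proj₂ (proj₂ (proj₂ (Placed.right-is pl))) (≰⇒> X≰d) r) d∈
    ... | yes _ | no d≰Y = suc Y , X≤ , ≤-refl ,
      prefix-closed w ux (proj₂ (proj₂ (Placed.above-is pl)) (s≤s a) (≤-pred (≰⇒> d≰Y))) d∈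

    T-high : ∀ {X Y} → Y < X → X ≤ n → InT n D (X , n ∸ Y) → ∀ {j} → Y < j → j ≤ X → j ∈ w
    T-high Y<X X≤n p {j} Y<j j≤X with inT⇒rect (≤-trans (s≤s z≤n) Y<X) (<-≤-trans Y<X X≤n) p
    ... | d , U , d∈ , pl , r , a with <-cmp j (suc d)
    ... | tri≈ _ refl _ = d∈
    ... | tri< j< _ _ = prefix-closed w ux (proj₂ (proj₂ (Placed.above-is pl)) (≤-<-trans a Y<j)
      (≤-pred j<)) d∈
    ... | tri> _ _ j> = prefix-closed w ux
      (proj₂ (proj₂ (proj₂ (Placed.right-is pl))) j> (≤-trans j≤X r)) d∈

    corner : ∀ {X Y d} → Y < n → suc d ∈ w → (∀ {U} → Placed n x d U → FCell n X Y U) →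
      InT n D (suc X , n ∸ Y)
    corner {X} {Y} Y<n d∈ c with complete d∈
    ... | U , U∈ , pl with c pl
    ... | l , r , a , b = inj₂ (inj₂ (lose U∈ (m≤n⇒m≤1+n l , r ,
      subst (_≤ n ∸ Y) (m∸[m∸n]≡n (Placed.bottom≤n pl)) (∸-monoʳ-≤ n (<⇒≤ b)) ,
      subst (n ∸ Y ≤_) (m∸[m∸n]≡n (Placed.top≤n pl)) (∸-monoʳ-≤ n a))))

    T-low⁻ : ∀ {X Y j} → 1 ≤ X → Y < n → X ≤ j → j ≤ suc Y → j ∈ w → InT n D (X , n ∸ Y)
    T-low⁻ {suc X} {Y} {suc t} _ Y<n (s≤s X≤t) (s≤s t≤Y) t∈
      with early-∈ x↭ (≤-trans X≤t t≤Y) Y<n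
    ... | d , X≤d , d≤Y , min = corner Y<n d∈ (λ pl → cell-low⁻ x↭ pl Y<n X≤d d≤Y min)
      where
      d∈ : suc d ∈ w
      d∈ with t ≟ d
      ... | yes refl = t∈
      ... | no t≢d = prefix-closed w ux (min X≤t t≤Y t≢d) t∈

    T-high⁻ : ∀ {X Y} → Y < X → X ≤ n → (∀ {j} → Y < j → j ≤ X → j ∈ w) → InT n D (X , n ∸ Y)
    T-high⁻ {suc X} {Y} (s≤s Y≤X) X<n all∈ with late-∈ x↭ Y≤X X<n
    ... | d , Y≤d , d≤X , max =
      corner (≤-<-trans Y≤X X<n) (all∈ (s≤s Y≤d) (s≤s d≤X))
        (λ pl → cell-high⁻ x↭ pl X<n Y≤d d≤X max)

  module _ {U} (pl : Placed n x e U) where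
    open Placed pl

    private
      top′ bottom′ : ℕ
      top′ = n ∸ top U
      bottom′ = n ∸ bottom U

      top≡ : n ∸ top′ ≡ top U
      top≡ = m∸[m∸n]≡n top≤n

      bottom≡ : n ∸ bottom′ ≡ bottom U
      bottom≡ = m∸[m∸n]≡n bottom≤n

      A<y : ∀ {y} → top U < y → y ≤ n → n ∸ y < top′
      A<y t<y y≤n = ∸-monoʳ-< t<y y≤n

    -- The point lies in T exactly when `e` is 0 or the label `e` is drawn. Then `left U` is `e`,
    -- and for `e ≥ 1` the search climbs as long as the labels from `e` downwards are drawn without
    -- a gap. Otherwise `top U` is `n ∸ e`, and the search to the left stops at the greatest drawn
    -- label below `e`, or at 0.
    topLeft≡ : topLeftCorner n D (diagPoint n e) ≡ (left U , top U)
    topLeft≡ = go (inT? n D (e , n ∸ e))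
      where
      go : Dec (InT n D (e , n ∸ e)) → topLeftCorner n D (diagPoint n e) ≡ (left U , top U)
      go (yes inT) = trans (if-yes (inT? n D (e , n ∸ e)) inT)
        (cong₂ _,_ (sym left≡) (greatest-unique (λ y → inT? n D (e , y)) top≤n (inj₂ sat) max))
        where
        e-earlier : 1 ≤ e → Before e (suc e) x
        e-earlier 1≤e with T-low 1≤e k≤n (n≤1+n e) inT
        ... | j , e≤j , j≤k , j∈ with m≤n⇒m<n∨m≡n e≤j
        ...   | inj₂ refl = before-++ j∈ (here refl)
        ...   | inj₁ k≤j = contradiction (subst (_∈ w) (≤-antisym j≤k k≤j) j∈) k∉
        left≡ : left U ≡ e
        left≡ with m≤n⇒m<n∨m≡n (proj₁ left-is)
        ... | inj₂ eq = eq
        ... | inj₁ l<e = contradiction (proj₂ (proj₂ left-is) l<e ≤-refl)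
          (not-both (e-earlier (≤-trans (s≤s z≤n) l<e)))
        A<e : 1 ≤ e → top′ < e
        A<e 1≤e with m≤n⇒m<n∨m≡n (proj₁ above-is) | proj₁ (proj₂ above-is)
        ... | inj₁ A<e | _ = A<e
        ... | inj₂ A≡e | inj₁ A≡0 = contradiction (≤-trans 1≤e (≤-reflexive (trans (sym A≡e) A≡0)))
          λ ()
        ... | inj₂ A≡e | inj₂ l = contradiction (subst (λ j → Before (suc e) j x) A≡e l)
          (not-both (e-earlier 1≤e))
        sat : InT n D (e , top U)
        sat with e ≟ 0
        ... | yes refl = inj₁ (refl , top≤n)
        ... | no e≢0 = subst (λ y → InT n D (e , y)) top≡ (T-high⁻ (A<e (n≢0⇒n>0 e≢0)) (<⇒≤ k≤n)
          (λ A<j j≤e → earlier⇒∈ (proj₂ (proj₂ above-is) A<j j≤e)))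
        max : ∀ {y} → top U < y → y ≤ n → ¬ InT n D (e , y)
        max {y} t<y y≤n p with proj₁ (proj₂ above-is)
        ... | inj₁ A≡0 = contradiction (<-≤-trans (A<y t<y y≤n) (≤-reflexive A≡0)) λ ()
        ... | inj₂ l = later⇒∉ l (T-high (<-≤-trans (A<y t<y y≤n) (proj₁ above-is)) (<⇒≤ k≤n)
          (subst (λ y → InT n D (e , y)) (sym (m∸[m∸n]≡n y≤n)) p) (A<y t<y y≤n) (proj₁ above-is))
      go (no ¬inT) = trans (if-no (inT? n D (e , n ∸ e)) ¬inT)
        (cong₂ _,_ (greatest-unique (λ x → inT? n D (x , n ∸ e)) (proj₁ left-is) sat max)
        (sym top-is))
        where
        1≤e : 1 ≤ e
        1≤e = n≢0⇒n>0 λ { refl → ¬inT (inj₁ (refl , ≤-refl)) }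
        e-later : Before (suc e) e x
        e-later with perm-total x↭ 1≤e (<⇒≤ k≤n) (s≤s z≤n) k≤n (<⇒≢ ≤-refl)
        ... | inj₂ l = l
        ... | inj₁ ea = ⊥-elim (¬inT (T-low⁻ 1≤e k≤n ≤-refl (n≤1+n e) (earlier⇒∈ ea)))
        top-is : top U ≡ n ∸ e
        top-is with m≤n⇒m<n∨m≡n (proj₁ above-is)
        ... | inj₂ A≡e = trans (sym top≡) (cong (n ∸_) A≡e)
        ... | inj₁ A<e = contradiction e-later (not-both (proj₂ (proj₂ above-is) A<e ≤-refl))
        sat : left U ≡ 0 ⊎ InT n D (left U , n ∸ e)
        sat with left U ≟ 0 | proj₁ (proj₂ left-is)
        ... | yes eq | _ = inj₁ eq
        ... | no l≢0 | inj₁ eq = inj₁ eq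
        ... | no l≢0 | inj₂ ea =
          inj₂ (T-low⁻ (n≢0⇒n>0 l≢0) k≤n ≤-refl (m≤n⇒m≤1+n (proj₁ left-is)) (earlier⇒∈ ea))
        max : ∀ {j} → left U < j → j ≤ e → ¬ InT n D (j , n ∸ e)
        max l<j j≤e p with T-low (≤-trans (s≤s z≤n) l<j) k≤n (m≤n⇒m≤1+n j≤e) p
        ... | i , j≤i , i≤k , i∈ with m≤n⇒m<n∨m≡n i≤k
        ...   | inj₂ refl = k∉ i∈
        ...   | inj₁ i<k = later⇒∉ (proj₂ (proj₂ left-is) (<-≤-trans l<j j≤i) (≤-pred i<k)) i∈

    bottomRight≡ : bottomRightCorner n D (diagPoint n (suc e)) ≡ (right U , bottom U)
    bottomRight≡ = go (inT? n D (suc e , n ∸ suc e))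
      where
      go : Dec (InT n D (suc e , n ∸ suc e)) → bottomRightCorner n D (diagPoint n (suc e)) ≡
        (right U , bottom U)
      go (yes inT) = trans (if-yes (inT? n D (suc e , n ∸ suc e)) inT)
        (cong₂ _,_ (greatest-unique (λ x → inT? n D (x , n ∸ suc e)) (proj₁ (proj₂ right-is))
        (inj₂ sat) max) (sym bottom-is))
        where
        next-earlier : suc e < n → Before (suc (suc e)) (suc e) x
        next-earlier k<n with T-low (s≤s z≤n) k<n (n≤1+n _) inT
        ... | j , k≤j , j≤ , j∈ with m≤n⇒m<n∨m≡n k≤j
        ...   | inj₂ refl = contradiction j∈ k∉
        ...   | inj₁ k<j = before-++ (subst (_∈ w) (≤-antisym j≤ k<j) j∈) (here refl)
        bottom-is : bottom U ≡ n ∸ suc e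
        bottom-is with m≤n⇒m<n∨m≡n (proj₁ below-is)
        ... | inj₂ eq = trans (sym bottom≡) (cong (n ∸_) (sym eq))
        ... | inj₁ k<B = contradiction (proj₂ (proj₂ (proj₂ below-is)) ≤-refl k<B)
          (not-both (next-earlier (<-≤-trans k<B (proj₁ (proj₂ below-is)))))
        sat : InT n D (right U , n ∸ suc e)
        sat with m≤n⇒m<n∨m≡n (proj₁ right-is)
        ... | inj₂ eq = subst (λ X → InT n D (X , n ∸ suc e)) eq inT
        ... | inj₁ k<r = T-high⁻ k<r (proj₁ (proj₂ right-is)) (λ k<j j≤r →
          earlier⇒∈ (proj₂ (proj₂ (proj₂ right-is)) k<j j≤r))
        max : ∀ {j} → right U < j → j ≤ n → ¬ InT n D (j , n ∸ suc e)
        max r<j j≤n p with proj₁ (proj₂ (proj₂ right-is))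
        ... | inj₁ refl = <-irrefl refl (<-≤-trans r<j j≤n)
        ... | inj₂ l = later⇒∉ l
          (T-high (≤-<-trans (proj₁ right-is) r<j) j≤n p (s≤s (proj₁ right-is)) r<j)
      go (no ¬inT) = trans (if-no (inT? n D (suc e , n ∸ suc e)) ¬inT)
        (cong₂ _,_ (sym right≡) (greatest-unique (λ y → inT? n D (suc e , y)) bottom≤ sat max))
        where
        k<n : suc e < n
        k<n = ≤∧≢⇒< k≤n λ { refl → ¬inT (inj₂ (inj₁ (n∸n≡0 (suc e) , ≤-refl))) }
        next-later : Before (suc e) (suc (suc e)) x
        next-later with perm-total x↭ (s≤s z≤n) k≤n (s≤s z≤n) k<n (<⇒≢ ≤-refl)
        ... | inj₁ l = l
        ... | inj₂ ea = ⊥-elim (¬inT (T-low⁻ (s≤s z≤n) k<n (n≤1+n _) ≤-refl (earlier⇒∈ ea)))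
        right≡ : right U ≡ suc e
        right≡ with m≤n⇒m<n∨m≡n (proj₁ right-is)
        ... | inj₂ eq = sym eq
        ... | inj₁ k<r = contradiction next-later
          (not-both (proj₂ (proj₂ (proj₂ right-is)) ≤-refl k<r))
        bottom≤ : bottom U ≤ n ∸ suc e
        bottom≤ = subst (_≤ n ∸ suc e) bottom≡ (∸-monoʳ-≤ n (proj₁ below-is))
        sat : bottom U ≡ 0 ⊎ InT n D (suc e , bottom U)
        sat with proj₁ (proj₂ (proj₂ below-is))
        ... | inj₁ B≡n = inj₁ (trans (sym bottom≡) (trans (cong (n ∸_) B≡n) (n∸n≡0 n)))
        ... | inj₂ ea = inj₂ (subst (λ y → InT n D (suc e , y)) bottom≡
          (T-low⁻ (s≤s z≤n) (perm-≤n x↭ (before-∈ˡ ea)) (m≤n⇒m≤1+n (proj₁ below-is)) ≤-refl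
            (earlier⇒∈ ea)))
        max : ∀ {y} → bottom U < y → y ≤ n ∸ suc e → ¬ InT n D (suc e , y)
        max {y} b<y y≤ p with T-low (s≤s z≤n) Y<n (m≤n⇒m≤1+n k≤Y)
          (subst (λ y → InT n D (suc e , y)) (sym (m∸[m∸n]≡n y≤n)) p)
          where
          y≤n = ≤-trans y≤ (m∸n≤m n (suc e))
          k≤Y : suc e ≤ n ∸ y
          k≤Y = subst (_≤ n ∸ y) (m∸[m∸n]≡n k≤n) (∸-monoʳ-≤ n y≤)
          Y<n : n ∸ y < n
          Y<n = ∸-monoʳ-< {n} (≤-<-trans z≤n b<y) y≤n
        ... | i , k≤i , i≤ , i∈ with m≤n⇒m<n∨m≡n k≤i
        ...   | inj₂ refl = k∉ i∈
        ...   | inj₁ k<i = later⇒∉ (proj₂ (proj₂ (proj₂ below-is)) k<i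
          (≤-trans i≤ (∸-monoʳ-< b<y (≤-trans y≤ (m∸n≤m n (suc e)))))) i∈

    newRect≡ : newRect n D (suc e) ≡ U
    newRect≡ = cong₂ fromCorners topLeft≡ bottomRight≡

  built-∷ : Built n x (w ∷ʳ suc e) (newRect n D (suc e) ∷ D)
  built-∷ with placed-exists x↭ k≤n
  ... | U , pl = record
    { sound = λ
      { (here refl) → e , ∈-++⁺ʳ w (here refl) , subst (Placed n x e) (sym (newRect≡ pl)) pl
      ; (there U∈) → case sound U∈ of λ (d , d∈ , p) → d , ∈-++⁺ˡ d∈ , p }
    ; complete = λ d∈ → case ∈-++⁻ w d∈ of λ
      { (inj₁ d∈w) → case complete d∈w of λ (V , V∈ , p) → V , there V∈ , p
      ; (inj₂ (here refl)) → _ , here refl , subst (Placed n x e) (sym (newRect≡ pl)) pl }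
    ; unique = All.tabulate fresh ∷ unique }
    where
    fresh : ∀ {V} → V ∈ D → newRect n D (suc e) ≢ V
    fresh V∈ refl with sound V∈
    ... | d , d∈ , p with trans (sym (placed-firstDiag x↭ p))
                       (trans (cong (firstDiag n) (newRect≡ pl)) (placed-firstDiag x↭ pl))
    ... | refl = k∉ d∈

ρ-built : ∀ {n x} → IsPerm n x → Built n x x (ρ n x)
ρ-built {n} {x} x↭ = go [] x refl record { sound = λ () ; complete = λ () ; unique = [] }
  where
  go : ∀ w s {D} → w ++ s ≡ x → Built n x w D → Built n x x (foldl (λ D k → newRect n D k ∷ D) D s)
  go w [] eq b = subst (λ v → Built n x v _) (trans (sym (++-identityʳ w)) eq) b
  go w (k ∷ s) refl b with perm-range x↭ (∈-++⁺ʳ w (here refl))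
  ... | e , refl , _ = go (w ∷ʳ suc e) s (++-assoc w [ suc e ] s) (Step.built-∷ x↭ b)

module _ {n x} (x↭ : IsPerm n x) where

  ρ-sound : ∀ {U} → U ∈ ρ n x → ∃[ e ] (e < n × Placed n x e U)
  ρ-sound U∈ with Built.sound (ρ-built x↭) U∈
  ... | e , e∈ , pl = e , perm-≤n x↭ e∈ , pl

  ρ-complete : ∀ {e U} → e < n → Placed n x e U → U ∈ ρ n x
  ρ-complete e<n pl with Built.complete (ρ-built x↭) (perm-∈ x↭ e<n)
  ... | V , V∈ , pl′ = subst (_∈ ρ n x) (placed-unique x↭ pl′ pl) V∈

-- Permutations with the same rectangulation

ρ-transfer : ∀ {n x y e U} → IsPerm n x → IsPerm n y → ρ n x ≈ᴸ ρ n y → e < n →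
  Placed n x e U → Placed n y e U
ρ-transfer {n} {y = y} {U = U} x↭ y↭ eq e<n pl
  with ρ-sound y↭ (Equivalence.to (eq U) (ρ-complete x↭ e<n pl))
... | d , _ , pl′ = subst (λ d → Placed n y d U)
  (trans (sym (placed-firstDiag y↭ pl′)) (placed-firstDiag x↭ pl)) pl′

≈ᴸ-sym : ∀ {R S} → R ≈ᴸ S → S ≈ᴸ R
≈ᴸ-sym eq U = mk⇔ (Equivalence.from (eq U)) (Equivalence.to (eq U))

≈ᴸ-trans : ∀ {R S T} → R ≈ᴸ S → S ≈ᴸ T → R ≈ᴸ T
≈ᴸ-trans p q U = mk⇔ (Equivalence.to (q U) ∘ Equivalence.to (p U))
  (Equivalence.from (p U) ∘ Equivalence.from (q U))

-- A slide only swaps a and d, which is invisible because b lies earlier and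
-- c later, both with values between a and d.
↘-placed : ∀ {n y y′ e U} → IsPerm n y → y ↘ y′ → Placed n y e U → Placed n y′ e U
↘-placed {n} {e = e} y↭ (slide w t {a} {b} {c} {d} b∈ c∈ a<b b<d a<c c<d) pl = record
  { left-is = l≤e , Sum.map₂ (λ p → keep p λ { (refl , refl) → <-asym (<-trans a<b b<d) (s≤s l≤e) })
    l-sat ,
      λ l<j j≤e → keep (l-max l<j j≤e) λ { (refl , refl) →
        case l-max (<-trans l<j a<b) (≤-pred b<d) of asym bd }
  ; above-is = a≤e , Sum.map₂ (λ p → keep p λ { (refl , eq) →
        case a-max (subst (_< c) (sym eq) a<c) (≤-pred c<d) of asym dc }) a-sat ,
      λ l<j j≤e → keep (a-max l<j j≤e) λ { (refl , refl) → <-asym (<-trans a<b b<d) (s≤s j≤e) }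
  ; right-is = r≥ , r≤n ,
    Sum.map₂ (λ p → keep p λ { (refl , refl) → <-asym (<-trans a<b b<d) (s≤s r≥) }) r-sat ,
      λ k<j j≤r → keep (r-min k<j j≤r) λ { (refl , refl) →
        case r-min a<c (≤-trans (<⇒≤ c<d) j≤r) of asym ac }
  ; below-is = b≥ , b≤n , Sum.map₂ (λ p → keep p λ { (eq , refl) →
        case b-min a<b (≤-pred (subst (b <_) (sym eq) b<d)) of asym ba }) b-sat ,
      λ k<j j≤b → keep (b-min k<j j≤b) λ { (refl , refl) → <-asym (<-trans a<b b<d) k<j }
  ; top≤n = top≤n ; bottom≤n = bottom≤n }
  where
  open Placed pl
  y = w ++ d ∷ a ∷ t
  asym : ∀ {u v} → Before u v y → ¬ Before v u y
  asym = before-asym (perm-unique y↭)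
  bd : Before b d y
  bd = before-++ b∈ (here refl)
  ba : Before b a y
  ba = before-++ b∈ (there (here refl))
  dc : Before d c y
  dc = before-++ʳ w (here (there c∈))
  ac : Before a c y
  ac = before-++ʳ w (there (here c∈))
  keep : ∀ {u v} → Before u v y → ¬ (u ≡ d × v ≡ a) → Before u v (w ++ a ∷ d ∷ t)
  keep p ¬da with before-swap w p
  ... | inj₁ eq = contradiction eq ¬da
  ... | inj₂ q = q
  l≤e = proj₁ left-is ; l-sat = proj₁ (proj₂ left-is)
  a≤e = proj₁ above-is ; a-sat = proj₁ (proj₂ above-is)
  r≥ = proj₁ right-is ; r≤n = proj₁ (proj₂ right-is) ; r-sat = proj₁ (proj₂ (proj₂ right-is))
  b≥ = proj₁ below-is ; b≤n = proj₁ (proj₂ below-is) ; b-sat = proj₁ (proj₂ (proj₂ below-is))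
  l-max = λ {j} → proj₂ (proj₂ left-is) {j}
  a-max = λ {j} → proj₂ (proj₂ above-is) {j}
  r-min = λ {j} → proj₂ (proj₂ (proj₂ right-is)) {j}
  b-min = λ {j} → proj₂ (proj₂ (proj₂ below-is)) {j}

-- One direction suffices, because each label has exactly one placed rectangle in either
-- permutation.
placed-≈ : ∀ {n x y} → IsPerm n x → IsPerm n y →
  (∀ {e U} → e < n → Placed n x e U → Placed n y e U) → ρ n x ≈ᴸ ρ n y
placed-≈ {n} {x} {y} x↭ y↭ f U = mk⇔ to from
  where
  to : U ∈ ρ n x → U ∈ ρ n y
  to U∈ with ρ-sound x↭ U∈
  ... | e , e<n , pl = ρ-complete y↭ e<n (f e<n pl)
  from : U ∈ ρ n y → U ∈ ρ n x
  from U∈ with ρ-sound y↭ U∈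
  ... | e , e<n , pl with placed-exists x↭ e<n
  ...   | V , pl′ = subst (_∈ ρ n x) (placed-unique y↭ (f e<n pl′) pl) (ρ-complete x↭ e<n pl′)

↘*-perm : ∀ {n y t} → IsPerm n y → Star _↘_ y t → IsPerm n t
↘*-perm y↭ ε = y↭
↘*-perm y↭ (s ◅ ss) = ↘*-perm (↭-trans (↘-↭ s) y↭) ss

↘*-≈ : ∀ {n y t} → IsPerm n y → Star _↘_ y t → ρ n y ≈ᴸ ρ n t
↘*-≈ y↭ ε U = mk⇔ id id
↘*-≈ y↭ (s ◅ ss) =
  ≈ᴸ-trans (placed-≈ y↭ y′↭ (λ _ → ↘-placed y↭ s)) (↘*-≈ y′↭ ss)
  where y′↭ = ↭-trans (↘-↭ s) y↭

-- Order isomorphism on Baxter permutations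

module _ {n x y} (x↭ : IsPerm n x) (y↭ : IsPerm n y) (eq : ρ n x ≈ᴸ ρ n y) where

  early-transfer : ∀ {k l} → 1 ≤ k → k < l → l ≤ n → EarlyIn x k l → EarlyIn y k l
  early-transfer {k} {suc e} 1≤k k<l e<n (j , k≤j , j<l , jl) with placed-exists x↭ e<n
  ... | U , pl = left U , k≤left , s≤s (proj₁ (left-is pl)) ,
    go (proj₁ (proj₂ (left-is (ρ-transfer x↭ y↭ eq e<n pl))))
    where
    open Placed
    k≤left : k ≤ left U
    k≤left = ≤-trans k≤j (≮⇒≥ λ l<j →
      before-asym (perm-unique x↭) jl (proj₂ (proj₂ (left-is pl)) l<j (≤-pred j<l)))
    go : left U ≡ 0 ⊎ Before (left U) (suc e) y → _
    go (inj₁ l≡0) = contradiction (≤-trans 1≤k (≤-trans k≤left (≤-reflexive l≡0))) λ ()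
    go (inj₂ p) = p

  late-transfer : ∀ {k l} → 1 ≤ k → k < l → l ≤ n → LateIn x k l → LateIn y k l
  late-transfer {k} {suc e} 1≤k k<l e<n (j , k≤j , j<l , lj) with placed-exists x↭ e<n
  ... | U , pl = n ∸ top U , k≤above , s≤s (proj₁ (above-is pl)) ,
    go (proj₁ (proj₂ (above-is (ρ-transfer x↭ y↭ eq e<n pl))))
    where
    open Placed
    k≤above : k ≤ n ∸ top U
    k≤above = ≤-trans k≤j (≮⇒≥ λ l<j →
      before-asym (perm-unique x↭) lj (proj₂ (proj₂ (above-is pl)) l<j (≤-pred j<l)))
    go : n ∸ top U ≡ 0 ⊎ Before (suc e) (n ∸ top U) y → _
    go (inj₁ l≡0) = contradiction (≤-trans 1≤k (≤-trans k≤above (≤-reflexive l≡0))) λ ()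
    go (inj₂ p) = p

module _ {n x y} (xB : IsBaxter n x) (yB : IsBaxter n y) where

  private
    x↭ = proj₁ xB
    y↭ = proj₁ yB

  -- The relation `⊑` does not pass directly from `s` and `t` to other members of their classes, but
  -- `EarlyIn` passes along `y`, `t`, `s`, `x`, and `LateIn` along `x`, `s`, `t`, `y`.
  baxter-≤ : ∀ {s t} → IsPerm n s → IsPerm n t → ρ n s ≈ᴸ ρ n x → ρ n t ≈ᴸ ρ n y → s ⊑ t → x ⊑ y
  baxter-≤ {s} {t} s↭ t↭ s≈x t≈y s⊑t = baxter-⊑ xB yB
    (λ 1≤k k<l l≤n → early-transfer s↭ x↭ s≈x 1≤k k<l l≤n ∘ early-⊑ 1≤k l≤n ∘
       early-transfer y↭ t↭ (≈ᴸ-sym t≈y) 1≤k k<l l≤n)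
    (λ 1≤k k<l l≤n → late-transfer t↭ y↭ t≈y 1≤k k<l l≤n ∘ late-⊑ ∘
       late-transfer x↭ s↭ (≈ᴸ-sym s≈x) 1≤k k<l l≤n)
    where
    early-⊑ : ∀ {k l} → 1 ≤ k → l ≤ n → EarlyIn t k l → EarlyIn s k l
    early-⊑ 1≤k l≤n (j , k≤j , j<l , jl)
      with perm-total s↭ (≤-trans 1≤k k≤j) (≤-trans (<⇒≤ j<l) l≤n)
        (≤-trans (≤-trans 1≤k k≤j) (<⇒≤ j<l)) l≤n (<⇒≢ j<l)
    ... | inj₁ jl′ = j , k≤j , j<l , jl′
    ... | inj₂ lj = ⊥-elim (before-asym (perm-unique t↭) jl (s⊑t j<l lj))
    late-⊑ : ∀ {k l} → LateIn s k l → LateIn t k l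
    late-⊑ (j , k≤j , j<l , lj) = j , k≤j , j<l , s⊑t j<l lj

  ρ-injective : ρ n x ≈ᴸ ρ n y → x ≡ y
  ρ-injective eq = ⊑-antisym (perm-unique x↭) (perm-unique y↭) (↭-trans x↭ (↭-sym y↭))
    (baxter-⊑ xB yB (early-transfer y↭ x↭ (≈ᴸ-sym eq)) (late-transfer x↭ y↭ eq))
    (baxter-⊑ yB xB (early-transfer x↭ y↭ eq) (late-transfer y↭ x↭ (≈ᴸ-sym eq)))

  ρ-monotone : x ≤ʷ y → ∃[ s ] ∃[ t ]
    (IsTwistedBaxter n s × IsTwistedBaxter n t × ρ n s ≈ᴸ ρ n x × ρ n t ≈ᴸ ρ n y × s ≤ʷ t)
  ρ-monotone x≤y with lower x↭ | lower y↭
  ... | s , x↘s , sT | t , y↘t , tT = s , t , sT , tT , ≈ᴸ-sym (↘*-≈ x↭ x↘s) ,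
    ≈ᴸ-sym (↘*-≈ y↭ y↘t) ,
    ⊑⇒≤ʷ (perm-unique (proj₁ sT)) (perm-unique (proj₁ tT)) (↭-trans (proj₁ sT) (↭-sym (proj₁ tT)))
      (lower-greatest sT y↭ (λ k<l p → ≤ʷ⇒⊑ x≤y k<l (lower-⊑ x↘s k<l p)) y↘t)

  ρ-cancel : ∃[ s ] ∃[ t ]
    (IsTwistedBaxter n s × IsTwistedBaxter n t × ρ n s ≈ᴸ ρ n x × ρ n t ≈ᴸ ρ n y × s ≤ʷ t) → x ≤ʷ y
  ρ-cancel (s , t , sT , tT , s≈x , t≈y , s≤t) =
    ⊑⇒≤ʷ (perm-unique x↭) (perm-unique y↭) (↭-trans x↭ (↭-sym y↭))
      (baxter-≤ (proj₁ sT) (proj₁ tT) s≈x t≈y (≤ʷ⇒⊑ s≤t))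

-- Unit edges on a line

Run : (ℕ → Set) → ℕ → ℕ → Set
Run E a c = a < c × (∀ i → a ≤ i → i < c → E i)

MaxRun : (ℕ → Set) → ℕ → ℕ → Set
MaxRun E a c = Run E a c × (∀ {a′ c′} → Run E a′ c′ → a′ ≤ a → c ≤ c′ → a′ ≡ a × c′ ≡ c)

run-∪ : ∀ {E a c a′ c′} → Run E a c → Run E a′ c′ → a′ ≤ c → a ≤ c′ → Run E (a ⊓ a′) (c ⊔ c′)
run-∪ {E} {a} {c} {a′} {c′} (a<c , f) (a′<c′ , g) a′≤c a≤c′ =
  ≤-<-trans (m⊓n≤m a a′) (<-≤-trans a<c (m≤m⊔n c c′)) , h
  where
  h : ∀ i → a ⊓ a′ ≤ i → i < c ⊔ c′ → E i
  h i ≤i i< with a ≤? i | i <? c | a′ ≤? i | i <? c′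
  ... | yes p | yes q | _ | _ = f i p q
  ... | _ | _ | yes p | yes q = g i p q
  ... | no p | _ | no q | _ = contradiction (<-≤-trans (⊓-glb (≰⇒> p) (≰⇒> q)) ≤i) (<-irrefl refl)
  ... | _ | no p | _ | no q = contradiction (≤-<-trans (⊔-lub (≮⇒≥ p) (≮⇒≥ q)) i<) (<-irrefl refl)
  ... | no p | yes q | yes r | no s = contradiction (<-≤-trans (≰⇒> p) (≤-trans a≤c′ (≮⇒≥ s)))
    (<-irrefl refl)
  ... | yes p | no q | no r | yes s = contradiction (<-≤-trans (≰⇒> r) (≤-trans a′≤c (≮⇒≥ q)))
    (<-irrefl refl)

max-absorb : ∀ {E a c a′ c′} → MaxRun E a c → Run E a′ c′ → a′ ≤ c → a ≤ c′ → a ≤ a′ × c′ ≤ c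
max-absorb {a = a} {c} {a′} {c′} (run , max) run′ a′≤c a≤c′
  with max (run-∪ run run′ a′≤c a≤c′) (m⊓n≤m a a′) (m≤m⊔n c c′)
... | eq , eq′ = m⊓n≡m⇒m≤n eq , ≤-trans (m≤n⊔m c c′) (≤-reflexive eq′)

max-unique : ∀ {E a c a′ c′ p} → MaxRun E a c → MaxRun E a′ c′ →
  a ≤ p → p ≤ c → a′ ≤ p → p ≤ c′ → a ≡ a′ × c ≡ c′
max-unique m m′ a≤p p≤c a′≤p p≤c′
  with max-absorb m (proj₁ m′) (≤-trans a′≤p p≤c) (≤-trans a≤p p≤c′)
     | max-absorb m′ (proj₁ m) (≤-trans a≤p p≤c′) (≤-trans a′≤p p≤c)
... | a≤a′ , c′≤c | a′≤a , c≤c′ = ≤-antisym a≤a′ a′≤a , ≤-antisym c≤c′ c′≤c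

module _ {E : ℕ → Set} (E? : Decidable E) where

  extend-right : ∀ d {n a c} → (∀ {i} → E i → i < n) → n ≤ c + d → Run E a c →
    ∃[ c′ ] (c ≤ c′ × Run E a c′ × ¬ E c′)
  extend-right zero {n} {a} {c} E<n n≤ run = c , ≤-refl , run ,
    λ Ec → <-irrefl refl (<-≤-trans (E<n Ec) (≤-trans n≤ (≤-reflexive (+-identityʳ c))))
  extend-right (suc d) {n} {a} {c} E<n n≤ run@(a<c , f) with E? c
  ... | no ¬Ec = c , ≤-refl , run , ¬Ec
  ... | yes Ec with extend-right d {c = suc c} E<n (≤-trans n≤ (≤-reflexive (+-suc c d)))
    (m<n⇒m<1+n a<c , f′)
    where
    f′ : ∀ i → a ≤ i → i < suc c → E i
    f′ i a≤i i≤c with m≤n⇒m<n∨m≡n (≤-pred i≤c)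
    ... | inj₁ i<c = f i a≤i i<c
    ... | inj₂ refl = Ec
  ... | c′ , c<c′ , run′ , ¬E = c′ , <⇒≤ c<c′ , run′ , ¬E

  extend-left : ∀ {a c} → Run E a c → ∃[ a′ ] (a′ ≤ a × Run E a′ c × (∀ {i} → suc i ≡ a′ → ¬ E i))
  extend-left {zero} run = 0 , z≤n , run , λ ()
  extend-left {suc a} {c} run@(a<c , f) with E? a
  ... | no ¬Ea = suc a , ≤-refl , run , λ { refl → ¬Ea }
  ... | yes Ea with extend-left {a} (<⇒≤ a<c , f′)
    where
    f′ : ∀ i → a ≤ i → i < c → E i
    f′ i a≤i i<c with m≤n⇒m<n∨m≡n a≤i
    ... | inj₁ a<i = f i a<i i<c
    ... | inj₂ refl = Ea
  ... | a′ , a′≤a , run′ , ¬E = a′ , m≤n⇒m≤1+n a′≤a , run′ , ¬E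

  extend : ∀ {n a c} → (∀ {i} → E i → i < n) → Run E a c →
    ∃[ a′ ] ∃[ c′ ] (a′ ≤ a × c ≤ c′ × MaxRun E a′ c′)
  extend {n} {a} {c} E<n run with extend-right n E<n (m≤n+m n c) run
  ... | c′ , c≤c′ , run₁ , ¬Ec′ with extend-left run₁
  ... | a′ , a′≤a , run₂ , ¬E = a′ , c′ , a′≤a , c≤c′ , run₂ , max
    where
    max : ∀ {a″ c″} → Run E a″ c″ → a″ ≤ a′ → c′ ≤ c″ → a″ ≡ a′ × c″ ≡ c′
    max {a″} {c″} (_ , g) a″≤a′ c′≤c″ = ≤-antisym a″≤a′ (≮⇒≥ not-left) ,
      ≤-antisym (≮⇒≥ not-right) c′≤c″
      where
      not-right : ¬ c′ < c″
      not-right c′<c″ = ¬Ec′ (g c′ (≤-trans a″≤a′ (<⇒≤ (proj₁ run₂))) c′<c″)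
      not-left : ¬ a″ < a′
      not-left (s≤s {n = i} a″≤i) = ¬E refl (g i a″≤i (<-≤-trans (<⇒≤ (proj₁ run₂)) c′≤c″))

-- Everything about vertical edges is proved for arbitrary coordinate functions
-- l, r, b, t, so that exchanging the axes yields the horizontal case.

Cell : (l r b t : Rect → ℕ) → ℕ → ℕ → Rect → Set
Cell l r b t i j U = l U ≤ i × i < r U × b U ≤ j × j < t U

-- `Edge left right bottom top R x j` unfolds to `VEdge R x j`, and
-- `Edge bottom top left right R y i` to `HEdge R i y`, so both orientations match the original
-- notions definitionally.
Edge : (l r b t : Rect → ℕ) → List Rect → ℕ → ℕ → Set
Edge l r b t R x j = Any (λ U → b U ≤ j × j < t U × (x ≡ l U ⊎ x ≡ r U)) R

record Oriented (n : ℕ) (R : List Rect) (l r b t : Rect → ℕ) : Set where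
  field
    l<r : ∀ {U} → U ∈ R → l U < r U
    r≤n : ∀ {U} → U ∈ R → r U ≤ n
    b<t : ∀ {U} → U ∈ R → b U < t U
    t≤n : ∀ {U} → U ∈ R → t U ≤ n
    cover : ∀ {i j} → i < n → j < n → ∃[ U ] (U ∈ R × Cell l r b t i j U)
    cell-unique : ∀ {i j U V} → U ∈ R → V ∈ R → Cell l r b t i j U → Cell l r b t i j V → U ≡ V

oriented : ∀ {n R} → IsSubdivision n R → Oriented n R left right bottom top
oriented {n} {R} S = record
  { l<r = λ U∈ → IsRectIn.left<right (All.lookup inside U∈)
  ; r≤n = λ U∈ → IsRectIn.right≤n (All.lookup inside U∈)
  ; b<t = λ U∈ → IsRectIn.bottom<top (All.lookup inside U∈)
  ; t≤n = λ U∈ → IsRectIn.top≤n (All.lookup inside U∈)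
  ; cover = λ i<n j<n → case covers _ _ i<n j<n of λ (U , (U∈ , c) , _) → U , U∈ , c
  ; cell-unique = λ U∈ V∈ c d → unique′ U∈ V∈ c d
  }
  where
  open IsSubdivision S
  unique′ : ∀ {i j U V} → U ∈ R → V ∈ R → CellIn i j U → CellIn i j V → U ≡ V
  unique′ {i} {j} U∈ V∈ c@(_ , i<r , _ , j<t) d
    with covers i j (<-≤-trans i<r (IsRectIn.right≤n (All.lookup inside U∈)))
                    (<-≤-trans j<t (IsRectIn.top≤n (All.lookup inside U∈)))
  ... | W , _ , only = trans (sym (only (U∈ , c))) (only (V∈ , d))

transpose : ∀ {n R l r b t} → Oriented n R l r b t → Oriented n R b t l r
transpose {l = l} {r} {b} {t} O = record
  { l<r = b<t ; r≤n = t≤n ; b<t = l<r ; t≤n = r≤n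
  ; cover = λ i<n j<n → case cover j<n i<n of λ (U , U∈ , p , q , s , u) → U , U∈ , s , u , p , q
  ; cell-unique = λ { U∈ V∈ (p , q , s , u) (p′ , q′ , s′ , u′) →
      cell-unique U∈ V∈ (s , u , p , q) (s′ , u′ , p′ , q′) } }
  where
  open Oriented O

module OrientedProperties {n R l r b t} (O : Oriented n R l r b t) where
  open Oriented O

  Ed : ℕ → ℕ → Set
  Ed = Edge l r b t R

  Ce : ℕ → ℕ → Rect → Set
  Ce = Cell l r b t

  ed? : ∀ v → Decidable (Ed v)
  ed? v j = any? (λ U → b U ≤? j ×-dec j <? t U ×-dec (v ≟ l U ⊎-dec v ≟ r U)) R

  ed<n : ∀ {v j} → Ed v j → j < n
  ed<n p with find∈ p
  ... | U , U∈ , _ , j<t , _ = <-≤-trans j<t (t≤n U∈)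

  ed≤n : ∀ {v j} → Ed v j → v ≤ n
  ed≤n p with find∈ p
  ... | U , U∈ , _ , _ , inj₁ refl = <⇒≤ (<-≤-trans (l<r U∈) (r≤n U∈))
  ... | U , U∈ , _ , _ , inj₂ refl = r≤n U∈

  -- The cell across the line belongs to some rectangle; if that one reached over the line, it would
  -- share a cell with the first.
  ed-neighbours : ∀ {v j} → suc v < n → Ed (suc v) j →
    (∃[ U ] (U ∈ R × r U ≡ suc v × Ce v j U)) × (∃[ V ] (V ∈ R × l V ≡ suc v × Ce (suc v) j V))
  ed-neighbours {v} {j} v<n p with find∈ p
  ... | U , U∈ , b≤j , j<t , inj₂ eq = (U , U∈ , sym eq , cU) , neighbour
    where
    cU : Ce v j U
    cU = ≤-pred (<-≤-trans (l<r U∈) (≤-reflexive (sym eq))) , ≤-reflexive eq , b≤j , j<t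
    neighbour : ∃[ V ] (V ∈ R × l V ≡ suc v × Ce (suc v) j V)
    neighbour with cover v<n (<-≤-trans j<t (t≤n U∈))
    ... | V , V∈ , c@(l≤ , r> , bj) with m≤n⇒m<n∨m≡n l≤
    ... | inj₂ lV = V , V∈ , lV , c
    ... | inj₁ l< with cell-unique U∈ V∈ cU (≤-pred l< , <-trans ≤-refl r> , bj)
    ... | refl = contradiction r> (<-irrefl eq)
  ... | V , V∈ , b≤j , j<t , inj₁ eq = neighbour , (V , V∈ , sym eq , cV)
    where
    cV : Ce (suc v) j V
    cV = ≤-reflexive (sym eq) , <-≤-trans (s≤s (≤-reflexive eq)) (l<r V∈) , b≤j , j<t
    neighbour : ∃[ U ] (U ∈ R × r U ≡ suc v × Ce v j U)
    neighbour with cover (<-trans ≤-refl v<n) (<-≤-trans j<t (t≤n V∈))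
    ... | U , U∈ , c@(l≤ , r> , bj) with m≤n⇒m<n∨m≡n r>
    ... | inj₂ rU = U , U∈ , sym rU , c
    ... | inj₁ r>> with cell-unique V∈ U∈ cV (m≤n⇒m≤1+n l≤ , r>> , bj)
    ... | refl = contradiction (≤-<-trans l≤ (≤-reflexive eq)) (<-irrefl refl)

  ed-right : ∀ {v j U} → suc v < n → Ed (suc v) j → U ∈ R → Ce v j U → r U ≡ suc v
  ed-right v<n p U∈ c with ed-neighbours v<n p
  ... | (W , W∈ , rW , cW) , _ with cell-unique U∈ W∈ c cW
  ... | refl = rW

  ed-left : ∀ {v j V} → suc v < n → Ed (suc v) j → V ∈ R → Ce (suc v) j V → l V ≡ suc v
  ed-left v<n p V∈ c with ed-neighbours v<n p
  ... | _ , (W , W∈ , lW , cW) with cell-unique V∈ W∈ c cW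
  ... | refl = lW

  ed-inside : ∀ {v j U} → U ∈ R → l U < v → v < r U → b U ≤ j → j < t U → ¬ Ed v j
  ed-inside {suc v} U∈ l<v v<r b≤ j< p =
    <-irrefl (sym (ed-right (<-≤-trans v<r (r≤n U∈)) p U∈ (≤-pred l<v , <-trans ≤-refl v<r , b≤ ,
      j<))) v<r

  left-side : ∀ {U} → U ∈ R → Run (Ed (l U)) (b U) (t U)
  left-side U∈ = b<t U∈ , λ i b≤ i< → lose U∈ (b≤ , i< , inj₁ refl)

  right-side : ∀ {U} → U ∈ R → Run (Ed (r U)) (b U) (t U)
  right-side U∈ = b<t U∈ , λ i b≤ i< → lose U∈ (b≤ , i< , inj₂ refl)

  extend-wall : ∀ {v a c} → Run (Ed v) a c → ∃[ a′ ] ∃[ c′ ] (a′ ≤ a × c ≤ c′ × MaxRun (Ed v) a′ c′)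
  extend-wall {v} = extend (ed? v) ed<n

  max≤n : ∀ {v a c} → MaxRun (Ed v) a c → c ≤ n
  max≤n {c = suc c} ((a<c , f) , _) = ed<n (f c (≤-pred a<c) ≤-refl)

  outer-wall : ∀ {v a c} → MaxRun (Ed v) a c → (∀ {j} → j < n → Ed v j) → a ≡ 0 × c ≡ n
  outer-wall m all with max-absorb m (≤-<-trans z≤n (<-≤-trans (proj₁ (proj₁ m)) (max≤n m)) ,
    λ _ _ → all)
      z≤n (≤-trans (<⇒≤ (proj₁ (proj₁ m))) (max≤n m))
  ... | a≤0 , n≤c = n≤0⇒n≡0 a≤0 , ≤-antisym (max≤n m) n≤c

  left-outer : ∀ {j} → 0 < n → j < n → Ed 0 j
  left-outer 0<n j<n with cover 0<n j<n
  ... | U , U∈ , l≤ , _ , b≤ , j< = lose U∈ (b≤ , j< , inj₁ (sym (n≤0⇒n≡0 l≤)))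

  right-outer : ∀ {j} → j < n → Ed n j
  right-outer {j} j<n with cover {n ∸ 1} {j} (∸-monoʳ-< {n} (s≤s z≤n) (≤-<-trans z≤n j<n)) j<n
  ... | U , U∈ , _ , r> , b≤ , j< = lose U∈ (b≤ , j< , inj₂ (≤-antisym n≤r (r≤n U∈)))
    where
    n≤r : n ≤ r U
    n≤r = subst (_≤ r U) (suc-∸-suc (≤-<-trans z≤n j<n)) r>

  max-inner : ∀ {v a c} → MaxRun (Ed v) a c →
    (v ≡ 0 ⊎ v ≡ n → ¬ (a ≡ 0 × c ≡ n)) → 0 < v × v < n
  max-inner {v} {a} {c} m@((a<c , f) , _) notOuter =
    n≢0⇒n>0 (λ { refl → notOuter (inj₁ refl)
      (outer-wall m (left-outer (≤-<-trans z≤n (<-≤-trans a<c (max≤n m))))) }) ,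
    ≤∧≢⇒< (ed≤n (f a ≤-refl a<c)) (λ { refl → notOuter (inj₂ refl) (outer-wall m right-outer) })

-- Walls in terms of maximal runs

InnerWall : ∀ {n R l r b t} → Oriented n R l r b t → ℕ → ℕ → ℕ → Set
InnerWall {n} O v a c = MaxRun (OrientedProperties.Ed O v) a c × 0 < v × v < n

module Walls {n R} (S : IsSubdivision n R) where

  V : Oriented n R left right bottom top
  V = oriented S

  H : Oriented n R bottom top left right
  H = transpose V

  vertical⇒wall : ∀ {v a c} → InnerWall V v a c → IsWall n R (vertical v a c)
  vertical⇒wall ((run , max) , 0<v , v<n) = record
    { inBoundaries = run
    ; maximal = λ { (horizontal _ _ _) _ () ; (vertical _ _ _) run′ (refl , a′≤a , c≤c′) →
        case max run′ a′≤a c≤c′ of λ { (refl , refl) → refl } }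
    ; notOuter = λ { (here ()) ; (there (here ())) ; (there (there (here refl))) → <-irrefl refl 0<v
                   ; (there (there (there (here refl)))) → <-irrefl refl v<n } }

  horizontal⇒wall : ∀ {v a c} → InnerWall H v a c → IsWall n R (horizontal v a c)
  horizontal⇒wall ((run , max) , 0<v , v<n) = record
    { inBoundaries = run
    ; maximal = λ { (vertical _ _ _) _ () ; (horizontal _ _ _) run′ (refl , a′≤a , c≤c′) →
        case max run′ a′≤a c≤c′ of λ { (refl , refl) → refl } }
    ; notOuter = λ { (here refl) → <-irrefl refl 0<v ; (there (here refl)) → <-irrefl refl v<n
                   ; (there (there (here ()))) ; (there (there (there (here ())))) } }

  wall⇒vertical : ∀ {v a c} → IsWall n R (vertical v a c) → InnerWall V v a c
  wall⇒vertical {v} {a} {c} W = m , OrientedProperties.max-inner V {v} m λ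
    { (inj₁ refl) (refl , refl) → notOuter (there (there (here refl)))
    ; (inj₂ refl) (refl , refl) → notOuter (there (there (there (here refl)))) }
    where
    open IsWall W
    m : MaxRun (VEdge R v) a c
    m = inBoundaries , λ {a′} {c′} run′ a′≤a c≤c′ →
      case maximal (vertical v a′ c′) run′ (refl , a′≤a , c≤c′) of λ { refl → refl , refl }

  wall⇒horizontal : ∀ {v a c} → IsWall n R (horizontal v a c) → InnerWall H v a c
  wall⇒horizontal {v} {a} {c} W = m , OrientedProperties.max-inner H {v} m λ
    { (inj₁ refl) (refl , refl) → notOuter (here refl)
    ; (inj₂ refl) (refl , refl) → notOuter (there (here refl)) }
    where
    open IsWall W
    m : MaxRun (λ i → HEdge R i v) a c
    m = inBoundaries , λ {a′} {c′} run′ a′≤a c≤c′ →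
      case maximal (horizontal v a′ c′) run′ (refl , a′≤a , c≤c′) of λ { refl → refl , refl }

touching-edge : ∀ {E a c p} → Run E a c → a ≤ p → p ≤ c → E p ⊎ ∃[ q ] (suc q ≡ p × E q)
touching-edge {c = c} {p} (a<c , f) a≤p p≤c with m≤n⇒m<n∨m≡n p≤c
... | inj₁ p<c = inj₁ (f p a≤p p<c)
touching-edge {c = suc c} (a<c , f) a≤p p≤c | inj₂ refl = inj₂ (c , refl , f c (≤-pred a<c) ≤-refl)

-- The diagonal cells inside U are those from l U ⊔ (n ∸ t U) up to, but not
-- including, r U ⊓ (n ∸ b U).
OneDiag : (n : ℕ) (R : List Rect) (l r b t : Rect → ℕ) → Set
OneDiag n R l r b t = ∀ {U} → U ∈ R → r U ⊓ (n ∸ b U) ≡ suc (l U ⊔ (n ∸ t U))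

module Diagonal {n R l r b t} (O : Oriented n R l r b t) (one : OneDiag n R l r b t) where
  open Oriented O
  open OrientedProperties O

  -- Exchanging the axes reverses the diagonal: cell `e` becomes cell `n ∸ suc e`, and first and
  -- last diagonal cells change places.
  transpose-one : OneDiag n R b t l r
  transpose-one {U} U∈ = begin
    t U ⊓ (n ∸ l U)               ≡⟨ ⊓-comm (t U) _ ⟩
    (n ∸ l U) ⊓ t U               ≡⟨ cong ((n ∸ l U) ⊓_) (sym (m∸[m∸n]≡n (t≤n U∈))) ⟩
    (n ∸ l U) ⊓ (n ∸ (n ∸ t U))   ≡⟨ sym (∸-distribˡ-⊔-⊓ n (l U) _) ⟩
    n ∸ (l U ⊔ (n ∸ t U))         ≡⟨ sym (suc-∸-suc first<n) ⟩
    suc (n ∸ suc (l U ⊔ (n ∸ t U)))   ≡⟨ cong (λ k → suc (n ∸ k)) (sym (one U∈)) ⟩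
    suc (n ∸ (r U ⊓ (n ∸ b U)))       ≡⟨ cong suc (∸-distribˡ-⊓-⊔ n (r U) _) ⟩
    suc ((n ∸ r U) ⊔ (n ∸ (n ∸ b U))) ≡⟨ cong (λ k → suc ((n ∸ r U) ⊔ k))
      (m∸[m∸n]≡n (<⇒≤ (<-≤-trans (b<t U∈) (t≤n U∈)))) ⟩
    suc ((n ∸ r U) ⊔ b U)             ≡⟨ cong suc (⊔-comm (n ∸ r U) _) ⟩
    suc (b U ⊔ (n ∸ r U))             ∎
    where
    open ≡-Reasoning
    first<n : l U ⊔ (n ∸ t U) < n
    first<n = ≤-trans (≤-reflexive (sym (one U∈))) (≤-trans (m⊓n≤m _ _) (r≤n U∈))

  module _ {U} (U∈ : U ∈ R) where

    private
      F = l U ⊔ (n ∸ t U)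
      F<r : F < r U
      F<r = ≤-trans (≤-reflexive (sym (one U∈))) (m⊓n≤m _ _)
      F<n∸b : F < n ∸ b U
      F<n∸b = ≤-trans (≤-reflexive (sym (one U∈))) (m⊓n≤n (r U) _)

    left-below : l U < n ∸ b U
    left-below = ≤-<-trans (m≤m⊔n _ _) F<n∸b

    right-above : n ∸ t U < r U
    right-above = ≤-<-trans (m≤n⊔m (l U) _) F<r

    last≤ : ∀ {v} → l U ≤ v → n ∸ t U ≤ v → r U ≤ suc v ⊎ n ∸ b U ≤ suc v
    last≤ {v} l≤ t≤ with r U ≤? suc v | (n ∸ b U) ≤? suc v
    ... | yes r≤ | _ = inj₁ r≤
    ... | no _ | yes b≤ = inj₂ b≤
    ... | no r≰ | no b≰ = contradiction
      (≤-trans (⊓-glb (≰⇒> r≰) (≰⇒> b≰)) (≤-trans (≤-reflexive (one U∈)) (s≤s (⊔-lub l≤ t≤))))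
        (<-irrefl refl)

    b≤n : b U ≤ n
    b≤n = <⇒≤ (<-≤-trans (b<t U∈) (t≤n U∈))

    n∸t≤⇒ : ∀ {Y} → n ∸ t U ≤ Y → n ∸ Y ≤ t U
    n∸t≤⇒ {Y} p = subst (n ∸ Y ≤_) (m∸[m∸n]≡n (t≤n U∈)) (∸-monoʳ-≤ n p)

    ≤n∸b⇒ : ∀ {Y} → Y ≤ n ∸ b U → b U ≤ n ∸ Y
    ≤n∸b⇒ {Y} p = subst (_≤ n ∸ Y) (m∸[m∸n]≡n b≤n) (∸-monoʳ-≤ n p)

    rows : ∀ {Y} → Y < n → b U ≤ n ∸ suc Y → n ∸ suc Y < t U → n ∸ t U ≤ Y × Y < n ∸ b U
    rows {Y} Y<n b≤ <t =
      subst (n ∸ t U ≤_) (∸-suc-involutive Y<n) (∸-monoʳ-≤ n <t) ,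
      subst (_< n ∸ b U) (∸-suc-involutive Y<n) (∸-monoʳ-< (s≤s b≤) (∸-monoʳ-< (s≤s z≤n) Y<n))

    rows⁻ : ∀ {Y} → Y < n → n ∸ t U ≤ Y → Y < n ∸ b U → b U ≤ n ∸ suc Y × n ∸ suc Y < t U
    rows⁻ {Y} Y<n t≤ b> = ≤n∸b⇒ b> , ≤-trans (≤-reflexive (suc-∸-suc Y<n)) (n∸t≤⇒ t≤)

  -- Of the two sides forming the edge, the one belonging to a rectangle that
  -- extends across the diagonal contains the diagonal point of the line.
  touch : ∀ {v j} → suc v < n → Ed (suc v) j → ∃[ c ] ∃[ d ] (Run (Ed (suc v)) c d ×
    c ≤ j × j < d × c ≤ n ∸ suc v × n ∸ suc v ≤ d)
  touch {v} {j} v<n p with ed-neighbours v<n p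
  ... | (U , U∈ , rU , _ , _ , bU≤j , j<tU) , (V , V∈ , lV , _ , _ , bV≤j , j<tV)
    with suc v ≤? (n ∸ b U)
  ... | yes v<b = b U , t U , subst (λ v → Run (Ed v) (b U) (t U)) rU (right-side U∈) , bU≤j ,
    j<tU ,
    ≤n∸b⇒ U∈ v<b , n∸t≤⇒ U∈ (<⇒≤ (≤-trans (right-above U∈) (≤-reflexive rU)))
  ... | no v≮b = b V , t V , subst (λ v → Run (Ed v) (b V) (t V)) lV (left-side V∈) , bV≤j , j<tV ,
    ≤n∸b⇒ V∈ (≤-trans (≤-reflexive (sym lV)) (<⇒≤ (left-below V∈))) ,
    n∸t≤⇒ V∈ (<⇒≤ (<-≤-trans (∸-monoʳ-< (≤-<-trans bU≤j j<tV) (t≤n V∈)) (<⇒≤ (≰⇒> v≮b))))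

  wall-meets-diagonal : ∀ {v a c} → InnerWall O v a c → a ≤ n ∸ v × n ∸ v ≤ c
  wall-meets-diagonal {suc v} {a} (m@((a<c , f) , _) , _ , v<n) with touch v<n (f a ≤-refl a<c)
  ... | c′ , d′ , run , c′≤a , a<d′ , c′≤ , ≤d′ with max-absorb m run (≤-trans c′≤a (<⇒≤ a<c))
    (<⇒≤ a<d′)
  ... | a≤c′ , d′≤c = ≤-trans a≤c′ c′≤ , ≤-trans ≤d′ d′≤c

  diag-cell-unique : ∀ {e U} → suc e < n → U ∈ R → Ce e (n ∸ suc e) U →
    ¬ Ce (suc e) (n ∸ suc (suc e)) U
  diag-cell-unique e<n U∈ (l≤ , _ , b≤ , <t) (_ , <r , b≤′ , <t′)
    with last≤ U∈ l≤ (proj₁ (rows U∈ (<⇒≤ e<n) b≤ <t))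
  ... | inj₁ r≤ = <-irrefl refl (<-≤-trans <r r≤)
  ... | inj₂ b≥ = <-irrefl refl (<-≤-trans (proj₂ (rows U∈ e<n b≤′ <t′)) b≥)

  -- Having a diagonal cell, the rectangle at the upper right of the point extends across the line
  -- or downwards. If across, an edge above the point would be interior to it, and an edge below
  -- interior to the rectangle at the lower left. So it extends down to the next diagonal cell. By
  -- symmetry a horizontal wall would join it to the previous diagonal cell, and it would have two.
  upper-right : ∀ {e} → suc e < n →
    (Ed (suc e) (n ∸ suc e) ⊎ ∃[ q ] (suc q ≡ n ∸ suc e × Ed (suc e) q)) →
    ∃[ X ] (X ∈ R × Ce (suc e) (n ∸ suc e) X × Ce (suc e) (n ∸ suc (suc e)) X)
  upper-right {e} e<n p with cover e<n (∸-monoʳ-< {n} (s≤s z≤n) (<⇒≤ e<n))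
  ... | W , W∈ , cW@(l≤ , <r , b≤ , <t) with rows W∈ (<⇒≤ e<n) b≤ <t
  ... | t≤ , b> with last≤-or-more
    where
    last≤-or-more : l W ≤ e ⊎ suc (suc e) ≤ n ∸ b W
    last≤-or-more with l W ≤? e | suc (suc e) ≤? (n ∸ b W)
    ... | yes l≤e | _ = inj₁ l≤e
    ... | no _ | yes b≥ = inj₂ b≥
    ... | no l≰e | no b≱ = contradiction
      (≤-trans (≤-trans (s≤s (≰⇒> l≰e)) (s≤s (m≤m⊔n (l W) (n ∸ t W))))
               (≤-trans (≤-reflexive (sym (one W∈))) (≤-trans (m⊓n≤n (r W) _) (≤-pred (≰⇒> b≱)))))
      (<-irrefl refl)
  ... | inj₂ b≥ = W , W∈ , cW , l≤ , <r , ≤n∸b⇒ W∈ b≥ , ≤-<-trans (∸-monoʳ-≤ n (n≤1+n (suc e))) <t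
  ... | inj₁ l≤e with p
  ... | inj₁ up = ⊥-elim (ed-inside W∈ (s≤s l≤e) <r b≤ <t up)
  ... | inj₂ (q , eq , down) with trans eq (sym (suc-∸-suc e<n))
  ... | refl with cover (<⇒≤ e<n) (∸-monoʳ-< {n} {_} {0} (s≤s z≤n) e<n)
  ... | Z , Z∈ , cZ@(lZ≤ , <rZ , bZ≤ , <tZ) with rows Z∈ e<n bZ≤ <tZ
  ... | tZ≤ , bZ> with m≤n⇒m<n∨m≡n tZ≤
  ... | inj₂ tZ≡ = ⊥-elim
    (ed-inside Z∈ (s≤s lZ≤) (≤-trans (s≤s (≤-reflexive (sym tZ≡))) (right-above Z∈)) bZ≤ <tZ down)
  ... | inj₁ tZ< with cell-unique W∈ Z∈ (l≤e , <-trans ≤-refl <r , b≤ , <t)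
                        (lZ≤ , <rZ , ≤-trans bZ≤ (∸-monoʳ-≤ n (n≤1+n (suc e))) ,
                          proj₂ (rows⁻ Z∈ (<⇒≤ e<n) (≤-pred tZ<) (<⇒≤ bZ>)))
  ... | refl = ⊥-elim (ed-inside Z∈ (s≤s lZ≤) <r bZ≤ <tZ down)

-- The wall conditions and the diagonal cells

module OneDiag⇒DRec {n R} (S : IsSubdivision n R) (one : OneDiag n R left right bottom top) where
  open Walls S
  private
    module V where
      open Oriented V public
      open OrientedProperties V public
      open Diagonal V one public
    module H where
      open Oriented H public
      open OrientedProperties H public
      open Diagonal H V.transpose-one public

  -- A crossing would be the top-right corner of one rectangle, hence strictly above the diagonal,
  -- and the bottom-left corner of another, hence strictly below it.
  no-cross : ∀ {x y} → suc x < n → suc y < n → VEdge R (suc x) y → VEdge R (suc x) (suc y) →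
    HEdge R x (suc y) → HEdge R (suc x) (suc y) → ⊥
  no-cross {x} {y} x<n y<n down up left′ right′
    with V.cover (<⇒≤ x<n) (<⇒≤ y<n) | V.cover x<n y<n
  ... | U , U∈ , cU@(a , b , c , d) | W , W∈ , cW@(a′ , b′ , c′ , d′) = <-irrefl refl (begin-strict
      suc x         ≡⟨ sym (V.ed-left x<n up W∈ cW) ⟩
      left W        <⟨ V.left-below W∈ ⟩
      n ∸ bottom W  ≡⟨ cong (n ∸_) (trans (H.ed-left y<n right′ W∈ (c′ , d′ , a′ , b′))
        (sym (H.ed-right y<n left′ U∈ (c , d , a , b)))) ⟩
      n ∸ top U     <⟨ V.right-above U∈ ⟩
      right U       ≡⟨ V.ed-right x<n down U∈ cU ⟩
      suc x         ∎)
    where open ≤-Reasoning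

  crossing-walls : ∀ {v a c h a′ c′} → InnerWall V v a c → InnerWall H h a′ c′ →
    a < h → h < c → a′ < v → v < c′ → ⊥
  crossing-walls {suc v} {h = suc h} (((_ , f) , _) , _ , v<n) (((_ , g) , _) , _ , h<n) a<h h<c
    a′<v v<c′ =
    no-cross v<n h<n (f _ (≤-pred a<h) (<⇒≤ h<c)) (f _ (<⇒≤ a<h) h<c) (g _ (≤-pred a′<v) (<⇒≤ v<c′))
      (g _ (<⇒≤ a′<v) v<c′)

  walls-share-no-diagPoint : ∀ {i v a c h a′ c′} → i < n → InnerWall V v a c → InnerWall H h a′ c′ →
    diagPoint n i ∈ˢ vertical v a c → ¬ diagPoint n i ∈ˢ horizontal h a′ c′
  walls-share-no-diagPoint {suc e} e<n ((run , _) , _) ((run′ , _) , _ , h<n) (refl , a≤ , ≤c)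
    (refl , a′≤ , ≤c′)
    with V.upper-right e<n (touching-edge run a≤ ≤c)
  ... | X , X∈ , (l≤ , <r , b≤ , <t) , cV
    with H.upper-right {n ∸ suc (suc e)} (≤-trans (≤-reflexive (cong suc p≡)) h<n)
           (subst₂ (λ h p → HEdge R p h ⊎ ∃[ q ] (suc q ≡ p × HEdge R q h))
             (sym p≡) (sym n∸p≡) (touching-edge run′ a′≤ ≤c′))
    where
    p≡ : suc (n ∸ suc (suc e)) ≡ n ∸ suc e
    p≡ = suc-∸-suc e<n
    n∸p≡ : n ∸ suc (n ∸ suc (suc e)) ≡ suc e
    n∸p≡ = trans (cong (n ∸_) p≡) (m∸[m∸n]≡n (<⇒≤ e<n))
  ... | Y , Y∈ , c₁ , c₂
    with subst₂ (λ h i → Cell bottom top left right h i Y) (suc-∸-suc e<n)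
           (trans (cong (n ∸_) (suc-∸-suc e<n)) (m∸[m∸n]≡n (<⇒≤ e<n))) c₁
       | subst₂ (λ h i → Cell bottom top left right h i Y) (suc-∸-suc e<n)
           (trans (cong (λ k → n ∸ suc k) (suc-∸-suc e<n)) (∸-suc-involutive (<⇒≤ e<n))) c₂
  ... | b≤′ , <t′ , l≤′ , <r′ | b≤″ , <t″ , l≤″ , <r″
    with V.cell-unique X∈ Y∈ (l≤ , <r , b≤ , <t) (l≤′ , <r′ , b≤′ , <t′)
  ... | refl = V.diag-cell-unique e<n X∈ (l≤″ , <r″ , b≤″ , <t″) cV
  walls-share-no-diagPoint {zero} _ (_ , () , _) _ (refl , _)

  isDRec : IsDRec n R
  isDRec = record
    { isSubdivision = S ; noCrossing = noCrossing ; wallHasPoint = wallHasPoint ; pointOnOneWall =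
      pointOnOneWall }
    where
    noCrossing : ∀ s s′ → IsWall n R s → IsWall n R s′ → s ≢ s′ → ∀ p → p ∈ˢ° s → ¬ (p ∈ˢ° s′)
    noCrossing (vertical v a c) (vertical v′ a′ c′) w w′ s≢ p (refl , a< , <c) (refl , a′< , <c′)
      with max-unique (proj₁ (wall⇒vertical w)) (proj₁ (wall⇒vertical w′)) (<⇒≤ a<) (<⇒≤ <c)
        (<⇒≤ a′<) (<⇒≤ <c′)
    ... | refl , refl = s≢ refl
    noCrossing (horizontal v a c) (horizontal v′ a′ c′) w w′ s≢ p (refl , a< , <c) (refl , a′< ,
      <c′)
      with max-unique (proj₁ (wall⇒horizontal w)) (proj₁ (wall⇒horizontal w′)) (<⇒≤ a<) (<⇒≤ <c)
        (<⇒≤ a′<) (<⇒≤ <c′)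
    ... | refl , refl = s≢ refl
    noCrossing (vertical _ _ _) (horizontal _ _ _) w w′ _ p (refl , a< , <c) (refl , a′< , <c′) =
      crossing-walls (wall⇒vertical w) (wall⇒horizontal w′) a< <c a′< <c′
    noCrossing (horizontal _ _ _) (vertical _ _ _) w w′ _ p (refl , a< , <c) (refl , a′< , <c′) =
      crossing-walls (wall⇒vertical w′) (wall⇒horizontal w) a′< <c′ a< <c

    wallHasPoint : ∀ s → IsWall n R s → ∃[ i ] (1 ≤ i × i < n × diagPoint n i ∈ˢ s)
    wallHasPoint (vertical v a c) w with wall⇒vertical w
    ... | iw@(_ , 0<v , v<n) = v , 0<v , v<n , refl , V.wall-meets-diagonal iw
    wallHasPoint (horizontal h a c) w with wall⇒horizontal w
    ... | iw@(_ , 0<h , h<n) = n ∸ h , m<n⇒0<n∸m h<n , ∸-monoʳ-< {n} 0<h (<⇒≤ h<n) ,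
      m∸[m∸n]≡n (<⇒≤ h<n) , H.wall-meets-diagonal iw

    -- The rectangle of diagonal cell `e` has no later diagonal cell, so its right or bottom side
    -- passes through the point and extends to a wall.
    wallAt : ∀ {e} → suc e < n → ∃[ s ] (IsWall n R s × diagPoint n (suc e) ∈ˢ s)
    wallAt {e} e<n with V.cover {j = n ∸ suc e} (<⇒≤ e<n) (∸-monoʳ-< {n} (s≤s z≤n) (<⇒≤ e<n))
    ... | U , U∈ , l≤ , <r , b≤ , <t with V.last≤ U∈ l≤ (proj₁ (V.rows U∈ (<⇒≤ e<n) b≤ <t))
    ... | inj₁ r≤ with V.extend-wall (subst (λ v → Run (VEdge R v) (bottom U) (top U))
      (≤-antisym r≤ <r) (V.right-side U∈))
    ...   | a , c , a≤ , ≤c , m = vertical (suc e) a c , vertical⇒wall (m , s≤s z≤n , e<n) ,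
      refl , ≤-trans a≤ b≤ , ≤-trans (<⇒≤ <t) ≤c
    wallAt {e} e<n | U , U∈ , l≤ , <r , b≤ , <t | inj₂ b≥
      with H.extend-wall (subst (λ h → Run (λ i → HEdge R i h) (left U) (right U)) b≡
        (H.left-side U∈))
      where
      b≡ : bottom U ≡ n ∸ suc e
      b≡ = ≤-antisym b≤ (subst (n ∸ suc e ≤_) (m∸[m∸n]≡n (V.b≤n U∈)) (∸-monoʳ-≤ n b≥))
    ...   | a , c , a≤ , ≤c , m = horizontal (n ∸ suc e) a c ,
      horizontal⇒wall (m , m<n⇒0<n∸m e<n , ∸-monoʳ-< {n} (s≤s z≤n) (<⇒≤ e<n)) ,
      refl , ≤-trans a≤ (m≤n⇒m≤1+n l≤) , ≤-trans <r ≤c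

    unique-wall : ∀ {i s s′} → i < n → IsWall n R s → IsWall n R s′ →
      diagPoint n i ∈ˢ s → diagPoint n i ∈ˢ s′ → s ≡ s′
    unique-wall {s = vertical _ _ _} {vertical _ _ _} _ w w′ (refl , a , b) (refl , c , d)
      with max-unique (proj₁ (wall⇒vertical w)) (proj₁ (wall⇒vertical w′)) a b c d
    ... | refl , refl = refl
    unique-wall {s = horizontal _ _ _} {horizontal _ _ _} _ w w′ (refl , a , b) (refl , c , d)
      with max-unique (proj₁ (wall⇒horizontal w)) (proj₁ (wall⇒horizontal w′)) a b c d
    ... | refl , refl = refl
    unique-wall {s = vertical _ _ _} {horizontal _ _ _} i<n w w′ p q =
      ⊥-elim (walls-share-no-diagPoint i<n (wall⇒vertical w) (wall⇒horizontal w′) p q)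
    unique-wall {s = horizontal _ _ _} {vertical _ _ _} i<n w w′ p q =
      ⊥-elim (walls-share-no-diagPoint i<n (wall⇒vertical w′) (wall⇒horizontal w) q p)

    pointOnOneWall : ∀ i → 1 ≤ i → i < n → ∃! _≡_ (λ s → IsWall n R s × diagPoint n i ∈ˢ s)
    pointOnOneWall (suc e) _ e<n with wallAt e<n
    ... | s , w , p = s , (w , p) , λ (w′ , p′) → unique-wall e<n w w′ p p′

module DRec⇒OneDiag {n R} (D : IsDRec n R) where
  open IsDRec D
  open Walls isSubdivision
  private
    module V where
      open Oriented V public
      open OrientedProperties V public
    module H where
      open Oriented H public
      open OrientedProperties H public

  -- The point between two consecutive diagonal cells of `U` would be interior to `U`, yet some wall
  -- contains it.
  not-two : ∀ {U} → U ∈ R → lastDiag n U ≤ suc (firstDiag n U)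
  not-two {U} U∈ = ≮⇒≥ λ lt → absurd (firstDiag n U) (m≤m⊔n _ _) (m≤n⊔m (left U) _)
      (<-≤-trans lt (m⊓n≤m _ _)) (<-≤-trans lt (m⊓n≤n (right U) _))
    where
    absurd : ∀ e → left U ≤ e → n ∸ top U ≤ e → suc e < right U → suc e < n ∸ bottom U → ⊥
    absurd e l≤ t≤ <r <b = at-wall (pointOnOneWall (suc e) (s≤s z≤n) e<n)
      where
      e<n = <-≤-trans <r (V.r≤n U∈)
      b<p : bottom U < n ∸ suc e
      b<p = subst (_< n ∸ suc e) (m∸[m∸n]≡n (<⇒≤ (<-≤-trans (V.b<t U∈) (V.t≤n U∈))))
        (∸-monoʳ-< <b (m∸n≤m n (bottom U)))
      p<t : n ∸ suc e < top U
      p<t = subst (n ∸ suc e <_) (m∸[m∸n]≡n (V.t≤n U∈)) (∸-monoʳ-< (s≤s t≤) (<⇒≤ e<n))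
      at-wall : ∃! _≡_ (λ s → IsWall n R s × diagPoint n (suc e) ∈ˢ s) → ⊥
      at-wall (vertical v a c , (w , refl , a≤ , ≤c) , _) =
        case touching-edge (IsWall.inBoundaries w) a≤ ≤c of λ
          { (inj₁ p) → V.ed-inside U∈ (s≤s l≤) <r (<⇒≤ b<p) p<t p
          ; (inj₂ (q , eq , p)) → V.ed-inside U∈ (s≤s l≤) <r
              (≤-pred (subst (bottom U <_) (sym eq) b<p)) (<-trans (≤-reflexive eq) p<t) p }
      at-wall (horizontal h a c , (w , refl , a≤ , ≤c) , _) =
        case touching-edge (IsWall.inBoundaries w) a≤ ≤c of λ
          { (inj₁ p) → H.ed-inside U∈ b<p p<t (m≤n⇒m≤1+n l≤) <r p
          ; (inj₂ (_ , refl , p)) → H.ed-inside U∈ b<p p<t l≤ (<⇒≤ <r) p }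

  private
    one-wall : ∀ {v a c h a′ c′} → InnerWall V v a c → InnerWall H h a′ c′ →
      n ∸ v ≡ h → a ≤ h → h ≤ c → a′ ≤ v → v ≤ c′ → ⊥
    one-wall {v} vw@(_ , 0<v , v<n) hw refl a≤ ≤c a′≤ ≤c′ with pointOnOneWall v 0<v v<n
    ... | s , _ , only with trans (sym (only (vertical⇒wall vw , refl , a≤ , ≤c)))
      (only (horizontal⇒wall hw , refl , a′≤ , ≤c′))
    ... | ()

    not-both-cross : ∀ {v a c h a′ c′} → InnerWall V v a c → InnerWall H h a′ c′ →
      a < h → h < c → a′ < v → v < c′ → ⊥
    not-both-cross {v} {h = h} vw hw a< <c a′< <c′ =
      noCrossing _ _ (vertical⇒wall vw) (horizontal⇒wall hw) (λ ()) (v , h) (refl , a< , <c)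
        (refl , a′< , <c′)

    vertical-point : ∀ {v a c} → InnerWall V v a c → a ≤ n ∸ v × n ∸ v ≤ c
    vertical-point vw with wallHasPoint _ (vertical⇒wall vw)
    ... | _ , _ , _ , refl , p = p

    horizontal-point : ∀ {h a c} → InnerWall H h a c → a ≤ n ∸ h × n ∸ h ≤ c
    horizontal-point hw with wallHasPoint _ (horizontal⇒wall hw)
    ... | i , _ , i<n , refl , a≤ , ≤c rewrite m∸[m∸n]≡n (<⇒≤ i<n) = a≤ , ≤c

  -- Suppose the top-right corner is on or below the diagonal. The walls along the right and top
  -- sides both reach the diagonal, so either both run past the corner and cross there, or one ends
  -- at the corner, which is then a diagonal point on two walls. The bottom-left corner is treated
  -- alike.
  at-least-one : ∀ {U} → U ∈ R → firstDiag n U < lastDiag n U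
  at-least-one {U} U∈ =
    ⊔-lub-< (⊓-glb l<r (≰⇒> not-above)) (⊓-glb (≰⇒> not-below) (∸-monoʳ-< (V.b<t U∈) (V.t≤n U∈)))
    where
    ⊔-lub-< : ∀ {a b c} → a < c → b < c → a ⊔ b < c
    ⊔-lub-< {a} {b} a<c b<c with ⊔-sel a b
    ... | inj₁ eq = subst (_< _) (sym eq) a<c
    ... | inj₂ eq = subst (_< _) (sym eq) b<c
    l<r = V.l<r U∈
    b<t = V.b<t U∈
    r≤n = V.r≤n U∈
    t≤n = V.t≤n U∈
    not-below : ¬ right U ≤ n ∸ top U
    not-below r≤ with V.extend-wall (V.right-side U∈) | H.extend-wall (H.right-side U∈)
    ... | a , c , a≤ , ≤c , m | a′ , c′ , a′≤ , ≤c′ , m′ = absurd (m≤n⇒m<n∨m≡n ≤c) (m≤n⇒m<n∨m≡n ≤c′)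
      where
      t≤n∸r : top U ≤ n ∸ right U
      t≤n∸r = subst (_≤ n ∸ right U) (m∸[m∸n]≡n t≤n) (∸-monoʳ-≤ n r≤)
      vw : InnerWall V (right U) a c
      vw = m , ≤-<-trans z≤n l<r , ≤-<-trans r≤ (∸-monoʳ-< {n} (≤-<-trans z≤n b<t) t≤n)
      hw : InnerWall H (top U) a′ c′
      hw = m′ , ≤-<-trans z≤n b<t , ≤-<-trans t≤n∸r (∸-monoʳ-< {n} (≤-<-trans z≤n l<r) r≤n)
      meet : n ∸ right U ≡ top U → ⊥
      meet eq = one-wall vw hw eq (≤-trans a≤ (<⇒≤ b<t)) ≤c (≤-trans a′≤ (<⇒≤ l<r)) ≤c′
      absurd : top U < c ⊎ top U ≡ c → right U < c′ ⊎ right U ≡ c′ → ⊥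
      absurd (inj₁ t<c) (inj₁ r<c′) = not-both-cross vw hw (≤-<-trans a≤ b<t) t<c
        (≤-<-trans a′≤ l<r) r<c′
      absurd (inj₂ refl) _ = meet (≤-antisym (proj₂ (vertical-point vw)) t≤n∸r)
      absurd _ (inj₂ refl) =
        meet (trans (cong (n ∸_) (≤-antisym r≤ (proj₂ (horizontal-point hw)))) (m∸[m∸n]≡n t≤n))
    not-above : ¬ n ∸ bottom U ≤ left U
    not-above b≤ with V.extend-wall (V.left-side U∈) | H.extend-wall (H.left-side U∈)
    ... | a , c , a≤ , ≤c , m | a′ , c′ , a′≤ , ≤c′ , m′ = absurd (m≤n⇒m<n∨m≡n a≤) (m≤n⇒m<n∨m≡n a′≤)
      where
      l<n = <-≤-trans l<r r≤n
      b<n = <-≤-trans b<t t≤n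
      n∸l≤b : n ∸ left U ≤ bottom U
      n∸l≤b = subst (n ∸ left U ≤_) (m∸[m∸n]≡n (<⇒≤ b<n)) (∸-monoʳ-≤ n b≤)
      vw : InnerWall V (left U) a c
      vw = m , <-≤-trans (m<n⇒0<n∸m b<n) b≤ , l<n
      hw : InnerWall H (bottom U) a′ c′
      hw = m′ , <-≤-trans (m<n⇒0<n∸m l<n) n∸l≤b , b<n
      meet : n ∸ left U ≡ bottom U → ⊥
      meet eq = one-wall vw hw eq a≤ (≤-trans (<⇒≤ b<t) ≤c) a′≤ (≤-trans (<⇒≤ l<r) ≤c′)
      absurd : a < bottom U ⊎ a ≡ bottom U → a′ < left U ⊎ a′ ≡ left U → ⊥
      absurd (inj₁ a<b) (inj₁ a′<l) = not-both-cross vw hw a<b (<-≤-trans b<t ≤c) a′<l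
        (<-≤-trans l<r ≤c′)
      absurd (inj₂ refl) _ = meet (≤-antisym n∸l≤b (proj₁ (vertical-point vw)))
      absurd _ (inj₂ refl) =
        meet (trans (cong (n ∸_) (≤-antisym (proj₁ (horizontal-point hw)) b≤))
        (m∸[m∸n]≡n (<⇒≤ b<n)))

  one : OneDiag n R left right bottom top
  one U∈ = ≤-antisym (not-two U∈) (at-least-one U∈)

ρ-isDRec : ∀ {n x} → IsPerm n x → IsDRec n (ρ n x)
ρ-isDRec {n} {x} x↭ = OneDiag⇒DRec.isDRec record
  { unique = Built.unique (ρ-built x↭) ; inside = All.tabulate inside ; covers = covers }
  one
  where
  one : OneDiag n (ρ n x) left right bottom top
  one U∈ with ρ-sound x↭ U∈
  ... | e , _ , pl = trans (placed-lastDiag x↭ pl) (cong suc (sym (placed-firstDiag x↭ pl)))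
  inside : ∀ {U} → U ∈ ρ n x → IsRectIn n U
  inside U∈ with ρ-sound x↭ U∈
  ... | e , _ , pl = record
    { left<right = ≤-<-trans (proj₁ left-is) (proj₁ right-is) ; right≤n = proj₁ (proj₂ right-is)
    ; bottom<top = ∸-cancelʳ-< (≤-<-trans (proj₁ above-is) (proj₁ below-is)) ; top≤n = top≤n }
    where open Placed pl
  covers : ∀ i j → i < n → j < n → ∃! _≡_ (λ U → U ∈ ρ n x × CellIn i j U)
  covers i j i<n j<n with placed-cover x↭ i<n (∸-monoʳ-< {n} (s≤s z≤n) j<n)
  ... | e , e<n , U , pl , c = U , (ρ-complete x↭ e<n pl , fcell⇒cell j<n c) , only
    where
    only : ∀ {V} → V ∈ ρ n x × CellIn i j V → U ≡ V
    only (V∈ , d) with ρ-sound x↭ V∈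
    ... | e′ , _ , pl′ with placed-cover-unique x↭ pl pl′ c (cell⇒fcell j<n d)
    ... | refl = placed-unique x↭ pl pl′

-- The staircase followed by the walk of `β`

-- Scanning back from an uncovered cell, the first change of coverage has the covered cell on the
-- far side. If there is no change, `greatest` returns 0, where the side of the square ends the
-- scan.
corner-spec : ∀ {Cv T : ℕ → Set} (T? : Decidable T) b →
  (∀ {i} → T (suc i) → (Cv i × ¬ Cv (suc i)) ⊎ (¬ Cv i × Cv (suc i))) →
  (∀ {i} → Cv i → ¬ Cv (suc i) → T (suc i)) → ¬ Cv b →
  ¬ Cv (greatest T? b) × (∀ {i} → suc i ≡ greatest T? b → Cv i)
corner-spec T? zero _ _ ¬Cv = ¬Cv , λ ()
corner-spec T? (suc b) turn turn⁻ ¬Cv with T? (suc b)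
... | no ¬T = corner-spec T? b turn turn⁻ λ Cvb → ¬T (turn⁻ Cvb ¬Cv)
... | yes T with turn T
...   | inj₁ (Cvb , _) = ¬Cv , λ { refl → Cvb }
...   | inj₂ (_ , Cv) = contradiction Cv ¬Cv

Cov : (l r b t : Rect → ℕ) → List Rect → ℕ → ℕ → Set
Cov l r b t C i j = Any (Cell l r b t i j) C

DownClosed : (l r b t : Rect → ℕ) → List Rect → Set
DownClosed l r b t C = ∀ {i j i′ j′} → i′ ≤ i → j′ ≤ j → Cov l r b t C i j → Cov l r b t C i′ j′

-- The top-right corner of K is a corner of the union of C.
Outer : (l r b t : Rect → ℕ) → List Rect → Rect → Set
Outer l r b t C K = ¬ Cov l r b t C (r K) (t K ∸ 1) × ¬ Cov l r b t C (r K ∸ 1) (t K)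

-- At corners of the union of C to the upper left of the top-right corner of U,
-- no wall leaves upwards.
NoUpperWall : (R : List Rect) (l r b t : Rect → ℕ) → List Rect → Rect → Set
NoUpperWall R l r b t C U = ∀ {K V} → K ∈ C → Outer l r b t C K → r K < r U →
  V ∈ R → l V ≡ r K → b V < t K → ¬ t K < t V

-- `C` holds what was chosen before `U`. Closure of `C` keeps the cells to the upper right of `U`
-- free; closure of `U ∷ C` supports the next rectangle. The record is symmetric in the axes, so one
-- argument serves `U-A` and `U-B`.
record State (R : List Rect) (l r b t : Rect → ℕ) (C : List Rect) (U : Rect) : Set where
  field
    C⊆R : ∀ {K} → K ∈ C → K ∈ R
    U∈R : U ∈ R
    U∉C : U ∉ C
    closed-C  : DownClosed l r b t C
    closed-UC : DownClosed l r b t (U ∷ C)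
    no-upper  : NoUpperWall R l r b t (U ∷ C) U
    no-right  : NoUpperWall R b t l r (U ∷ C) U

cov-transpose : ∀ {l r b t C i j} → Cov l r b t C i j → Cov b t l r C j i
cov-transpose = Any.map λ (p , q , u , v) → u , v , p , q

closed-transpose : ∀ {l r b t C} → DownClosed l r b t C → DownClosed b t l r C
closed-transpose dc p q c = cov-transpose (dc q p (cov-transpose c))

state-transpose : ∀ {R l r b t C U} → State R l r b t C U → State R b t l r C U
state-transpose s = record
  { C⊆R = C⊆R ; U∈R = U∈R ; U∉C = U∉C
  ; closed-C = closed-transpose closed-C ; closed-UC = closed-transpose closed-UC
  ; no-upper = no-right ; no-right = no-upper }
  where open State s

module Turn {n R l r b t} (O : Oriented n R l r b t) {C U} (st : State R l r b t C U) where
  open Oriented O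
  open OrientedProperties O
  open State st

  private
    Cv = Cov l r b t
    UC = U ∷ C

    UC⊆R : ∀ {K} → K ∈ UC → K ∈ R
    UC⊆R (here refl) = U∈R
    UC⊆R (there K∈) = C⊆R K∈

    owner : ∀ {i j D} → (∀ {K} → K ∈ D → K ∈ R) → Cv D i j → ∃[ K ] (K ∈ D × K ∈ R × Ce i j K)
    owner D⊆R c with find∈ c
    ... | K , K∈ , cK = K , K∈ , D⊆R K∈ , cK

    uncovered : ∀ {i j V} → V ∈ R → V ∉ UC → Ce i j V → ¬ Cv UC i j
    uncovered V∈ V∉ cV c with owner UC⊆R c
    ... | K , K∈ , K∈R , cK with cell-unique V∈ K∈R cV cK
    ... | refl = V∉ K∈

    pred-r : ∀ {K} → K ∈ R → suc (r K ∸ 1) ≡ r K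
    pred-r K∈ = suc-∸-suc {n = r _} (≤-<-trans z≤n (l<r K∈))

    pred-t : ∀ {K} → K ∈ R → suc (t K ∸ 1) ≡ t K
    pred-t K∈ = suc-∸-suc {n = t _} (≤-<-trans z≤n (b<t K∈))

    top-right : ∀ {K} → K ∈ R → Ce (r K ∸ 1) (t K ∸ 1) K
    top-right K∈ = ≤-pred (≤-trans (l<r K∈) (≤-reflexive (sym (pred-r K∈)))) ,
      ≤-reflexive (pred-r K∈) ,
      ≤-pred (≤-trans (b<t K∈) (≤-reflexive (sym (pred-t K∈)))) , ≤-reflexive (pred-t K∈)

    below-U : ∀ {i j} → i < r U → j < t U → Cv UC i j
    below-U i< j< = closed-UC (≤-pred (≤-trans i< (≤-reflexive (sym (pred-r U∈R)))))
      (≤-pred (≤-trans j< (≤-reflexive (sym (pred-t U∈R))))) (here (top-right U∈R))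

    -- Such a cell, being outside `U`, would be covered by `C`; closure of `C` would then cover the
    -- top-right cell of `U` and put `U` into `C`.
    U-cell-fresh : ∀ {i j} → Cv UC i j → r U ≤ i ⊎ t U ≤ j → r U ∸ 1 ≤ i → t U ∸ 1 ≤ j → ⊥
    U-cell-fresh (here (_ , <r , _ , <t)) (inj₁ r≤) _ _ = <-irrefl refl (<-≤-trans <r r≤)
    U-cell-fresh (here (_ , <r , _ , <t)) (inj₂ t≤) _ _ = <-irrefl refl (<-≤-trans <t t≤)
    U-cell-fresh (there c) _ i≥ j≥ with owner C⊆R (closed-C i≥ j≥ c)
    ... | K , K∈ , K∈R , cK with cell-unique U∈R K∈R (top-right U∈R) cK
    ... | refl = U∉C K∈

  ¬above-U : ¬ Cv UC (r U ∸ 1) (t U)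
  ¬above-U c = U-cell-fresh c (inj₂ ≤-refl) ≤-refl (m∸n≤m (t U) 1)

  ¬right-of-U : ¬ Cv UC (r U) (t U ∸ 1)
  ¬right-of-U c = U-cell-fresh c (inj₁ ≤-refl) (m∸n≤m (r U) 1) ≤-refl

  module _ (t<n : t U < n) (up : Ed (r U) (t U)) {m} (m≤ : m ≤ r U ∸ 1)
    (¬m : ¬ Cv UC m (t U)) (m-1 : ∀ {i} → suc i ≡ m → Cv UC i (t U)) where

    private
      m<r : m < r U
      m<r = ≤-trans (s≤s m≤) (≤-reflexive (pred-r U∈R))

      up-blocks : ∀ {V} → V ∈ R → l V < r U → b V ≤ t U → t U < t V → r V ≤ r U
      up-blocks V∈ l< b≤ <t = ≮⇒≥ λ r< → ed-inside V∈ l< r< b≤ <t up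

    -- Take the rectangle of the cell in column `m` just above the level `t U`. It is not chosen,
    -- while the cells to the left of and below that cell are covered, so it extends in neither
    -- direction.
    corner-rect : ∃[ V ] (V ∈ R × l V ≡ m × b V ≡ t U)
    corner-rect with cover (<-≤-trans m<r (r≤n U∈R)) t<n
    ... | V , V∈ , cV@(l≤ , <r , b≤ , <t) = V , V∈ , l≡ (m≤n⇒m<n∨m≡n l≤) , b≡ (m≤n⇒m<n∨m≡n b≤)
      where
      V∉ : V ∉ UC
      V∉ V∈UC = ¬m (lose V∈UC cV)
      l≡ : l V < m ⊎ l V ≡ m → l V ≡ m
      l≡ (inj₂ eq) = eq
      l≡ (inj₁ (s≤s {n = i} l<)) =
        ⊥-elim (uncovered V∈ V∉ (l< , <-trans ≤-refl <r , b≤ , <t) (m-1 refl))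
      b≡ : b V < t U ⊎ b V ≡ t U → b V ≡ t U
      b≡ (inj₂ eq) = eq
      b≡ (inj₁ b<) = ⊥-elim (uncovered V∈ V∉
        (l≤ , <r , ≤-pred (≤-trans b< (≤-reflexive (sym (pred-t U∈R)))) ,
          ≤-<-trans (m∸n≤m (t U) 1) <t)
        (below-U m<r (≤-reflexive (pred-t U∈R))))

    module _ {V} (V∈ : V ∈ R) (lV : l V ≡ m) (bV : b V ≡ t U) where

      private
        cV : Ce m (t U) V
        cV = ≤-reflexive lV , <-≤-trans (s≤s (≤-reflexive (sym lV))) (l<r V∈) ,
             ≤-reflexive bV , <-≤-trans (s≤s (≤-reflexive (sym bV))) (b<t V∈)

        V∉UC : V ∉ UC
        V∉UC V∈UC = ¬m (lose V∈UC cV)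

        rV≤rU : r V ≤ r U
        rV≤rU = up-blocks V∈ (≤-<-trans (≤-reflexive lV) m<r) (≤-reflexive bV)
          (<-≤-trans (s≤s (≤-reflexive (sym bV))) (b<t V∈))

        -- Otherwise the left side of V would leave a corner K of the union upwards.
        left-covered : ∀ j d → j ≡ t U + d → j < t V → ∀ {i} → suc i ≡ m → Cv UC i j
        left-covered j zero refl _ eq = subst (Cv UC _) (sym (+-identityʳ (t U))) (m-1 eq)
        left-covered _ (suc d) refl j< {i} refl
          with Any.any? (λ W → l W ≤? i ×-dec i <? r W ×-dec b W ≤? (t U + suc d) ×-dec
          (t U + suc d) <? t W) UC
        ... | yes c = c
        ... | no ¬c with owner UC⊆R
          (left-covered (t U + d) d refl (<-trans (≤-reflexive (sym (+-suc (t U) d))) j<) refl)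
        ... | K , K∈ , K∈R , l≤ , <r , b≤ , <t = ⊥-elim (no-upper K∈ outer
                (≤-<-trans (≤-reflexive rK) m<r) V∈ (trans lV (sym rK))
                (≤-<-trans (≤-reflexive bV)
                  (<-≤-trans (m<m+n (t U) (s≤s z≤n)) (≤-reflexive (sym tK))))
                (≤-<-trans (≤-reflexive tK) j<))
          where
          in-V : Ce (suc i) (t U + d) V
          in-V = ≤-reflexive lV , proj₁ (proj₂ cV) , ≤-trans (≤-reflexive bV) (m≤m+n (t U) d) ,
                 <-trans (≤-reflexive (sym (+-suc (t U) d))) j<
          rK : r K ≡ suc i
          rK = ≤-antisym (≮⇒≥ λ r> → uncovered V∈ V∉UC in-V (lose K∈ (m≤n⇒m≤1+n l≤ , r> , b≤ , <t)))
            <r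
          tK : t K ≡ t U + suc d
          tK = ≤-antisym
            (≮⇒≥ λ t> → ¬c (lose K∈ (l≤ , <r ,
              ≤-trans b≤ (≤-trans (n≤1+n _) (≤-reflexive (sym (+-suc (t U) d)))) , t>)))
            (≤-trans (≤-reflexive (+-suc (t U) d)) <t)
          outer : Outer l r b t UC K
          outer = subst₂ (λ x y → ¬ Cv UC x y) (sym rK)
            (sym (trans (cong (_∸ 1) tK) (cong (_∸ 1) (+-suc (t U) d))))
                    (uncovered V∈ V∉UC in-V) ,
                  subst₂ (λ x y → ¬ Cv UC x y) (sym (cong (_∸ 1) rK)) (sym tK) ¬c

        -- The upward wall gives `r V ≤ r U`, so everything under `V` below the level `t U` is
        -- covered already; to the left of column `m`, `left-covered` applies.
        closed-V : DownClosed l r b t (V ∷ UC)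
        closed-V p q (there c) = there (closed-UC p q c)
        closed-V {i} {j} {i′} {j′} p q (here (l≤ , <r , b≤ , <t)) with j′ <? t U | i′ <? m
        ... | yes j′< | _ = there (below-U (≤-<-trans p (<-≤-trans <r rV≤rU)) j′<)
        ... | no j′≮ | no i′≮ = here (≤-trans (≤-reflexive lV) (≮⇒≥ i′≮) , ≤-<-trans p <r ,
                                     ≤-trans (≤-reflexive bV) (≮⇒≥ j′≮) , ≤-<-trans q <t)
        ... | no j′≮ | yes (s≤s i′≤) = there (closed-UC i′≤ ≤-refl
                (left-covered j′ (j′ ∸ t U) (sym (m+[n∸m]≡n (≮⇒≥ j′≮))) (≤-<-trans q <t) refl))

        outer-UC : ∀ {l r b t K} → Outer l r b t (V ∷ UC) K → Outer l r b t UC K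
        outer-UC (p , q) = (λ c → p (there c)) , (λ c → q (there c))

        no-upper-V : NoUpperWall R l r b t (V ∷ UC) V
        no-upper-V (here refl) _ r< = contradiction r< (<-irrefl refl)
        no-upper-V (there K∈) o r< = no-upper K∈ (outer-UC o) (<-≤-trans r< rV≤rU)

        -- By the height of the corner of `K`. Below `t U` the old invariant applies. Above `t U`
        -- the corner is not to the right of column `m`, and closure covers the cell above it, so it
        -- is no corner of the union. At height `t U` only the corner of `U` remains, where the
        -- upward wall blocks any wall to the right.
        no-right-V : NoUpperWall R b t l r (V ∷ UC) V
        no-right-V (here refl) _ t< = contradiction t< (<-irrefl refl)
        no-right-V {K} (there K∈) o t< W∈ bW lW rW with <-cmp (t K) (t U) | UC⊆R K∈
        ... | tri< tK< _ _ | _ = no-right K∈ (outer-UC o) tK< W∈ bW lW rW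
        ... | tri> _ _ tK> | K∈R = proj₁ o (there (cov-transpose above-K))
          where
          rK≤m : r K ≤ m
          rK≤m = ≮⇒≥ λ m< → ¬m (closed-UC (≤-pred (≤-trans m< (≤-reflexive (sym (pred-r K∈R)))))
            (≤-pred (≤-trans tK> (≤-reflexive (sym (pred-t K∈R))))) (lose K∈ (top-right K∈R)))
          above-K : Cv UC (r K ∸ 1) (t K)
          above-K with closed-V (≤-trans (m∸n≤m (r K) 1) rK≤m) ≤-refl
                         (here (proj₁ cV , proj₁ (proj₂ cV) , ≤-trans (≤-reflexive bV) (<⇒≤ tK>) ,
                           t<))
          ... | there c = c
          ... | here (l≤ , _) = contradiction
            (≤-<-trans (≤-trans (≤-reflexive (sym lV)) l≤)
              (<-≤-trans (≤-reflexive (pred-r K∈R)) rK≤m)) (<-irrefl refl)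
        ... | tri≈ _ tK≡ _ | K∈R with <-cmp (r K) (r U)
        ... | tri< rK< _ _ = proj₂ o
          (there (cov-transpose (subst (λ y → Cv UC (r K) (y ∸ 1)) (sym tK≡)
                (below-U rK< (≤-reflexive (pred-t U∈R))))))
        ... | tri> _ _ rK> = ¬right-of-U
          (closed-UC (≤-pred (≤-trans rK> (≤-reflexive (sym (pred-r K∈R)))))
                (≤-reflexive (cong (_∸ 1) (sym tK≡))) (lose K∈ (top-right K∈R)))
        ... | tri≈ _ rK≡ _ = <-irrefl refl (<-≤-trans rW (≤-trans
                (up-blocks W∈ (<-≤-trans lW (≤-reflexive rK≡)) (≤-reflexive (trans bW tK≡))
                  (≤-<-trans (≤-reflexive (trans (sym tK≡) (sym bW))) (b<t W∈)))
                (≤-reflexive (sym rK≡))))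

      turn-state : State R l r b t UC V
      turn-state = record
        { C⊆R = UC⊆R ; U∈R = V∈ ; U∉C = V∉UC ; closed-C = closed-UC ; closed-UC = closed-V
        ; no-upper = no-upper-V ; no-right = no-right-V }

find-just : ∀ {A : Set} {P : A → Set} (P? : Decidable P) {xs x} → x ∈ xs → P x →
  ∃[ y ] (find P? xs ≡ just y × y ∈ xs × P y)
find-just P? {z ∷ xs} x∈ p with P? z
... | yes q = z , refl , here refl , q
find-just P? {z ∷ xs} (here refl) p | no ¬q = contradiction p ¬q
find-just P? {z ∷ xs} (there x∈) p | no ¬q with find-just P? x∈ p
... | y , eq , y∈ , q = y , eq , there y∈ , q

module WalkOn {n R} (S : IsSubdivision n R) (one : OneDiag n R left right bottom top) where
  open Walls S
  open OneDiag⇒DRec S one using (no-cross)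
  private
    module V where
      open Oriented V public
      open OrientedProperties V public
    module H where
      open Oriented H public
      open OrientedProperties H public

  VState : List Rect → Rect → Set
  VState = State R left right bottom top

  -- All that the exclusion of patterns uses of the choice between `U-A` and `U-B`.
  Adjacent : Rect → Rect → Set
  Adjacent U V = bottom V ≡ top U ⊎ left V ≡ right U

  module Next {C U} (st : VState C U) where
    open State st

    private
      x = right U
      y = top U
      UC = U ∷ C

      x-1 = x ∸ 1
      y-1 = y ∸ 1

      sx : suc x-1 ≡ x
      sx = suc-∸-suc {x} (≤-<-trans z≤n (V.l<r U∈R))

      sy : suc y-1 ≡ y
      sy = suc-∸-suc {y} (≤-<-trans z≤n (V.b<t U∈R))

      top-right : CellIn x-1 y-1 U
      top-right = ≤-pred (≤-trans (V.l<r U∈R) (≤-reflexive (sym sx))) , ≤-reflexive sx ,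
                  ≤-pred (≤-trans (V.b<t U∈R) (≤-reflexive (sym sy))) , ≤-reflexive sy

      leftEdge : LeftEdge n R (x , y)
      leftEdge = subst (λ x → LeftEdge n R (x , y)) sx
        (proj₂ (H.right-side U∈R) x-1 (proj₁ top-right) (proj₁ (proj₂ top-right)))

      downEdge : DownEdge n R (x , y)
      downEdge = subst (λ y → DownEdge n R (x , y)) sy
        (proj₂ (V.right-side U∈R) y-1 (proj₁ (proj₂ (proj₂ top-right)))
          (proj₂ (proj₂ (proj₂ top-right))))

    NotCorner : Set
    NotCorner = ¬ (x ≡ n × y ≡ n)

    -- Both edges at once would make a crossing. With neither, inside the square, the rectangle at
    -- the upper right would overlap `U`; on the right or top side, the side itself supplies an
    -- edge.
    vertex : NotCorner →
      (LeftVertex n R (x , y) × y < n) ⊎ (¬ LeftVertex n R (x , y) × DownVertex n R (x , y) × x < n)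
    vertex nc with vEdge? R x y | hEdge? R x y
    ... | yes up | no ¬right = inj₁ ((leftEdge , up , downEdge , ¬right) , V.ed<n up)
    ... | no ¬up | yes right′ = inj₂ ((λ (_ , up , _) → ¬up up) ,
      (leftEdge , right′ , downEdge , ¬up) , H.ed<n right′)
    ... | yes up | yes right′ = ⊥-elim (no-cross
      (≤-<-trans (≤-reflexive sx) (H.ed<n right′)) (≤-<-trans (≤-reflexive sy) (V.ed<n up))
      (subst (λ x → VEdge R x y-1) (sym sx)
        (proj₂ (V.right-side U∈R) y-1 (proj₁ (proj₂ (proj₂ top-right)))
        (proj₂ (proj₂ (proj₂ top-right)))))
      (subst₂ (VEdge R) (sym sx) (sym sy) up)
      (subst (λ y → HEdge R x-1 y) (sym sy)
        (proj₂ (H.right-side U∈R) x-1 (proj₁ top-right) (proj₁ (proj₂ top-right))))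
      (subst₂ (HEdge R) (sym sx) (sym sy) right′))
    ... | no ¬up | no ¬right with m≤n⇒m<n∨m≡n (V.r≤n U∈R) | m≤n⇒m<n∨m≡n (V.t≤n U∈R)
    ... | inj₂ x≡n | inj₂ y≡n = ⊥-elim (nc (x≡n , y≡n))
    ... | inj₂ x≡n | inj₁ y<n =
      ⊥-elim (¬up (subst (λ x → VEdge R x y) (sym x≡n) (V.right-outer y<n)))
    ... | inj₁ x<n | inj₂ y≡n =
      ⊥-elim (¬right (subst (λ y → HEdge R x y) (sym y≡n) (H.right-outer x<n)))
    ... | inj₁ x<n | inj₁ y<n with V.cover x<n y<n
    ... | W , W∈ , l≤ , <r , b≤ , <t with m≤n⇒m<n∨m≡n l≤ | m≤n⇒m<n∨m≡n b≤
    ... | inj₂ refl | _ = ⊥-elim (¬up (proj₂ (V.left-side W∈) y b≤ <t))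
    ... | inj₁ _ | inj₂ refl = ⊥-elim (¬right (proj₂ (H.left-side W∈) x l≤ <r))
    ... | inj₁ l< | inj₁ b< with V.cell-unique U∈R W∈ top-right
             (≤-pred (≤-trans l< (≤-reflexive (sym sx))) , ≤-<-trans (m∸n≤m x 1) <r ,
              ≤-pred (≤-trans b< (≤-reflexive (sym sy))) , ≤-<-trans (m∸n≤m y 1) <t)
    ... | refl = contradiction <r (<-irrefl refl)

    Proceeds : Maybe Rect → Set
    Proceeds M = ∃[ V ] (M ≡ just V × VState UC V × Adjacent U V)

    withBottomLeft-just : ∀ {p q} → ∃[ V ] (V ∈ R × left V ≡ p × bottom V ≡ q) →
      ∃[ V ] (withBottomLeft n R (p , q) ≡ just V × V ∈ R × left V ≡ p × bottom V ≡ q)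
    withBottomLeft-just {p} {q} (V , V∈ , lV , bV) =
      find-just (λ V → left V ≟ p ×-dec bottom V ≟ q) V∈ (lV , bV)

    proceeds-A : y < n → VEdge R x y → Proceeds (U-A n R UC U)
    proceeds-A y<n up = go (corner-spec (λ x → turnsUp? n R UC x y) x-1 id (λ c ¬c → inj₁ (c , ¬c))
      ¬above-U)
      where
      open Turn V st
      m = greatest (λ x → turnsUp? n R UC x y) x-1
      m≤ = greatest-≤ (λ x → turnsUp? n R UC x y) x-1
      go : ¬ Covered n R UC m y × (∀ {i} → suc i ≡ m → Covered n R UC i y) → Proceeds (U-A n R UC U)
      go (¬m , m-1) with withBottomLeft-just (corner-rect y<n up m≤ ¬m m-1)
      ... | W , eq , W∈ , lW , bW = W , eq , turn-state y<n up m≤ ¬m m-1 W∈ lW bW , inj₁ bW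

    proceeds-B : x < n → HEdge R x y → Proceeds (U-B n R UC U)
    proceeds-B x<n right′ =
      go (corner-spec (λ y → turnsRight? n R UC x y) y-1 id (λ c ¬c → inj₁ (c , ¬c))
        (λ c → ¬above-U (cov-transpose c)))
      where
      -- After exchanging the axes, `U-B` is found as `U-A` was; only the coverage statements must
      -- be transposed.
      open Turn H (state-transpose st)
      m = greatest (λ y → turnsRight? n R UC x y) y-1
      m≤ = greatest-≤ (λ y → turnsRight? n R UC x y) y-1
      go : ¬ Covered n R UC x m × (∀ {i} → suc i ≡ m → Covered n R UC x i) → Proceeds (U-B n R UC U)
      go (¬m , m-1) with withBottomLeft-just
          (case corner-rect x<n right′ m≤ (λ c → ¬m (cov-transpose c))
            (λ eq → cov-transpose (m-1 eq)) of
            λ (V , V∈ , bV , lV) → V , V∈ , lV , bV)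
      ... | W , eq , W∈ , lW , bW = W , eq ,
        state-transpose (turn-state x<n right′ m≤ (λ c → ¬m (cov-transpose c))
          (λ eq → cov-transpose (m-1 eq)) W∈ bW lW) , inj₂ lW

    next-spec : (next n R UC U ≡ nothing × x ≡ n × y ≡ n) ⊎ Proceeds (next n R UC U)
    next-spec = go (x ≟ n ×-dec y ≟ n)
      where
      go : Dec (x ≡ n × y ≡ n) →
        (next n R UC U ≡ nothing × x ≡ n × y ≡ n) ⊎ Proceeds (next n R UC U)
      go (yes p) = inj₁ (if-yes (x ≟ n ×-dec y ≟ n) p , p)
      go (no nc) with vertex nc
      ... | inj₁ (lv@(_ , up , _) , y<n) = inj₂ (subst Proceeds (sym eq) (proceeds-A y<n up))
        where
        eq : next n R UC U ≡ U-A n R UC U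
        eq = trans (if-no (x ≟ n ×-dec y ≟ n) nc) (if-yes (leftVertex? n R (x , y)) lv)
      ... | inj₂ (¬lv , dv@(_ , right′ , _) , x<n) =
        inj₂ (subst Proceeds (sym eq) (proceeds-B x<n right′))
        where
        eq : next n R UC U ≡ U-B n R UC U
        eq = trans (if-no (x ≟ n ×-dec y ≟ n) nc)
          (trans (if-no (leftVertex? n R (x , y)) ¬lv) (if-yes (downVertex? n R (x , y)) dv))

    all-chosen : x ≡ n → y ≡ n → ∀ {V} → V ∈ R → V ∈ UC
    all-chosen x≡n y≡n {W} W∈ with find∈ (closed-UC
        (≤-pred (≤-trans (<-≤-trans (V.l<r W∈) (V.r≤n W∈)) (≤-reflexive (sym (trans sx x≡n)))))
        (≤-pred (≤-trans (<-≤-trans (V.b<t W∈) (V.t≤n W∈)) (≤-reflexive (sym (trans sy y≡n)))))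
        (here top-right))
    ... | K , K∈ , cK with V.cell-unique W∈ (UC⊆R K∈) (≤-refl , V.l<r W∈ , ≤-refl , V.b<t W∈) cK
      where
      UC⊆R : ∀ {K} → K ∈ UC → K ∈ R
      UC⊆R (here refl) = U∈R
      UC⊆R (there K∈) = C⊆R K∈
    ... | refl = K∈

  data Chain (C : List Rect) : List Rect → Set where
    stop : (∀ {U} → U ∈ R → U ∈ C) → Chain C []
    step : ∀ {U s} → VState C U → (∀ {V s′} → s ≡ V ∷ s′ → Adjacent U V) → Chain (U ∷ C) s →
      Chain C (U ∷ s)

  -- `rest` lists the rectangles not yet chosen, so the bound on the walk is exact: it runs out only
  -- when nothing is left.
  walk-chain : ∀ m {C U rest} → VState C U → (U ∷ C) ++ rest ↭ R → length rest ≡ m →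
    Chain C (walk n R (suc m) C (just U))
  walk-chain zero {C} {U} {[]} st p refl = step st (λ ()) (stop λ {W} W∈ →
    subst (W ∈_) (++-identityʳ (U ∷ C)) (∈-resp-↭ (↭-sym p) W∈))
  walk-chain (suc m) {C} {U} {rest} st p len = go (Next.next-spec st)
    where
    continue = λ M → Chain C (U ∷ walk n R (suc m) (U ∷ C) M)
    go : (next n R (U ∷ C) U ≡ nothing × right U ≡ n × top U ≡ n) ⊎
      Next.Proceeds st (next n R (U ∷ C) U) → continue (next n R (U ∷ C) U)
    go (inj₁ (eq , x≡n , y≡n)) =
      subst continue (sym eq) (step st (λ ()) (stop (Next.all-chosen st x≡n y≡n)))
    go (inj₂ (V , eq , st′ , adj)) with ∈-++⁻ (U ∷ C) (∈-resp-↭ (↭-sym p) (State.U∈R st′))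
    ... | inj₁ V∈ = contradiction V∈ (State.U∉C st′)
    ... | inj₂ V∈ with ∈-∃++ V∈
    ... | as , bs , refl = subst continue (sym eq) (step st (λ { refl → adj })
      (walk-chain m {rest = as ++ bs} st′
        (↭-trans (↭-sym (shift V (U ∷ C) (as ++ bs)))
          (↭-trans (++⁺ˡ (U ∷ C) (↭-sym (shift V as bs))) p))
        (suc-injective (trans (sym (↭-length (shift V as bs))) len))))

  chosenOrder-chain : 1 ≤ n → Chain [] (chosenOrder n R)
  chosenOrder-chain 1≤n with V.cover 1≤n 1≤n
  ... | W , W∈ , l≤ , <r , b≤ , <t with find-just ((0 , 0) ∈ᴿ?_) W∈ (l≤ , z≤n , b≤ , z≤n)
  ... | U , eq , U∈ , l≤0 , _ , b≤0 , _ with ∈-∃++ U∈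
  ... | as , bs , R≡ = subst₂ (λ k M → Chain [] (walk n R k [] M)) len (sym eq)
    (walk-chain (length (as ++ bs)) start (↭-sym p) refl)
    where
    p : R ↭ U ∷ as ++ bs
    p = subst (_↭ U ∷ as ++ bs) (sym R≡) (shift U as bs)
    len : suc (length (as ++ bs)) ≡ length R
    len = sym (↭-length p)
    start : VState [] U
    start = record
      { C⊆R = λ () ; U∈R = U∈ ; U∉C = λ () ; closed-C = λ _ _ ()
      ; closed-UC = λ { p q (here (_ , <r , _ , <t)) →
          here (≤-trans l≤0 z≤n , ≤-<-trans p <r , ≤-trans b≤0 z≤n , ≤-<-trans q <t) }
      ; no-upper = λ { (here refl) _ r< → contradiction r< (<-irrefl refl) }
      ; no-right = λ { (here refl) _ r< → contradiction r< (<-irrefl refl) } }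

  chain-∈ : ∀ {C s} → Chain C s → ∀ {U} → U ∈ s → U ∈ R × U ∉ C
  chain-∈ (step st _ ch) (here refl) = State.U∈R st , State.U∉C st
  chain-∈ (step st _ ch) (there U∈) with chain-∈ ch U∈
  ... | U∈R , U∉ = U∈R , λ U∈C → U∉ (there U∈C)

  chain-unique : ∀ {C s} → Chain C s → Unique s
  chain-unique (stop _) = []
  chain-unique (step st _ ch) = All.tabulate (λ { V∈ refl → proj₂ (chain-∈ ch V∈) (here refl) }) ∷
    chain-unique ch

  chain-all : ∀ {C s} → Chain C s → ∀ {U} → U ∈ R → U ∈ C ⊎ U ∈ s
  chain-all (stop all) U∈ = inj₁ (all U∈)
  chain-all (step st _ ch) U∈ with chain-all ch U∈
  ... | inj₁ (here refl) = inj₂ (here refl)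
  ... | inj₁ (there U∈C) = inj₁ U∈C
  ... | inj₂ U∈s = inj₂ (there U∈s)

  -- Closure at the moment `U` is chosen already covers the given cell of `V`.
  chain-before : ∀ {C s} → Chain C s → ∀ {U V i j i′ j′} → U ∈ s → V ∈ R →
    CellIn i j U → CellIn i′ j′ V → i′ ≤ i → j′ ≤ j → V ∈ C ⊎ V ≡ U ⊎ Before V U s
  chain-before (step st _ ch) (here refl) V∈ cU cV p q with find∈ (State.closed-UC st p q (here cU))
  ... | _ , here refl , cK = inj₂ (inj₁ (V.cell-unique V∈ (State.U∈R st) cV cK))
  ... | K , there K∈ , cK = inj₁ (subst (_∈ _) (V.cell-unique (State.C⊆R st K∈) V∈ cK cV) K∈)
  chain-before (step st _ ch) (there U∈) V∈ cU cV p q with chain-before ch U∈ V∈ cU cV p q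
  ... | inj₁ (here refl) = inj₂ (inj₂ (here U∈))
  ... | inj₁ (there V∈C) = inj₁ V∈C
  ... | inj₂ (inj₁ eq) = inj₂ (inj₁ eq)
  ... | inj₂ (inj₂ b) = inj₂ (inj₂ (there b))

  chain-adjacent : ∀ {C} xs {U V ys} → Chain C (xs ++ U ∷ V ∷ ys) → Adjacent U V
  chain-adjacent [] (step _ adj _) = adj refl
  chain-adjacent (_ ∷ xs) (step _ _ ch) = chain-adjacent xs ch

-- The permutation read off the walk

unique-set⇒↭ : ∀ {A : Set} {xs ys : List A} → Unique xs → Unique ys →
  (∀ {z} → z ∈ xs → z ∈ ys) → (∀ {z} → z ∈ ys → z ∈ xs) → xs ↭ ys
unique-set⇒↭ uxs uys f g = ∼bag⇒↭ (unique∧set⇒bag uxs uys (mk⇔ f g))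

unique-map : ∀ {A B : Set} {f : A → B} {xs} → (∀ {u v} → u ∈ xs → v ∈ xs → f u ≡ f v → u ≡ v) →
  Unique xs → Unique (List.map f xs)
unique-map inj [] = []
unique-map {f = f} inj (z∉ ∷ uxs) =
  All.tabulate (λ w∈ eq →
    case ∈-map⁻ f w∈ of λ { (v , v∈ , refl) → All.lookup z∉ v∈ (inj (here refl) (there v∈) eq) })
  ∷ unique-map (λ u∈ v∈ → inj (there u∈) (there v∈)) uxs

map-split : ∀ {A B : Set} (f : A → B) s xs {d a ys} → List.map f s ≡ xs ++ d ∷ a ∷ ys →
  ∃[ s₁ ] ∃[ D ] ∃[ C ] ∃[ s₂ ]
    (s ≡ s₁ ++ D ∷ C ∷ s₂ × List.map f s₁ ≡ xs × f D ≡ d × f C ≡ a × List.map f s₂ ≡ ys)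
map-split f (D ∷ C ∷ s₂) [] refl = [] , D , C , s₂ , refl , refl , refl , refl , refl
map-split f (z ∷ s) (_ ∷ xs) eq with ∷-injective eq
... | refl , eq′ with map-split f s xs eq′
... | s₁ , D , C , s₂ , refl , refl , rest = z ∷ s₁ , D , C , s₂ , refl , refl , rest
map-split f [] [] ()
map-split f [] (_ ∷ _) ()
map-split f (_ ∷ []) [] ()

module ChainLabels {n R} (S : IsSubdivision n R) (one : OneDiag n R left right bottom top)
  {s} (ch : WalkOn.Chain S one [] s) where

  open WalkOn S one

  private
    F = firstDiag n
    module V where
      open Oriented (oriented S) public
      open Diagonal (oriented S) one public
    us = chain-unique ch

    module _ {U} (U∈ : U ∈ R) where

      F<right : F U < right U
      F<right = ≤-trans (≤-reflexive (sym (one U∈))) (m⊓n≤m _ _)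

      F<below : F U < n ∸ bottom U
      F<below = ≤-trans (≤-reflexive (sym (one U∈))) (m⊓n≤n (right U) _)

      F<n : F U < n
      F<n = <-≤-trans F<right (V.r≤n U∈)

      left≤F : left U ≤ F U
      left≤F = m≤m⊔n _ _

      above≤F : n ∸ top U ≤ F U
      above≤F = m≤n⊔m (left U) _

      diag-cell : CellIn (F U) (n ∸ suc (F U)) U
      diag-cell = left≤F , F<right , V.rows⁻ U∈ F<n above≤F F<below

      firstDiag-unique : ∀ {e} → e < n → CellIn e (n ∸ suc e) U → F U ≡ e
      firstDiag-unique e<n (l≤ , <r , b≤ , <t) with V.rows U∈ e<n b≤ <t
      ... | t≤ , <b = ≤-antisym (⊔-lub l≤ t≤)
        (≤-pred (≤-trans (⊓-glb <r <b) (≤-reflexive (one U∈))))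

    firstDiag-injective : ∀ {U W} → U ∈ R → W ∈ R → F U ≡ F W → U ≡ W
    firstDiag-injective {U} {W} U∈ W∈ eq = V.cell-unique U∈ W∈ (diag-cell U∈)
      (subst (λ e → CellIn e (n ∸ suc e) W) (sym eq) (diag-cell W∈))

    at : ∀ {e} → e < n → ∃[ U ] (U ∈ R × F U ≡ e)
    at e<n with V.cover e<n (∸-monoʳ-< {n} (s≤s z≤n) e<n)
    ... | U , U∈ , c = U , U∈ , firstDiag-unique U∈ e<n c

    lab : Rect → ℕ
    lab U = suc (F U)

    -- `entry` is `firstDiag`, which maps the rectangles bijectively onto 0, ..., `n ∸ 1`, so the
    -- filter keeps one rectangle for each value up to `F U`.
    label≡ : ∀ {U} → U ∈ R → label n R U ≡ lab U
    label≡ {U} U∈ = begin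
      length L                    ≡⟨ sym (length-map F L) ⟩
      length (List.map F L)       ≡⟨ ↭-length (unique-set⇒↭ uL (Unique.upTo⁺ (lab U)) to from) ⟩
      length (upTo (lab U))       ≡⟨ length-upTo (lab U) ⟩
      lab U                       ∎
      where
      open ≡-Reasoning
      L = filter (λ V → F V ≤? F U) R
      L⊆ : ∀ {V} → V ∈ L → V ∈ R × F V ≤ F U
      L⊆ = ∈-filter⁻ (λ V → F V ≤? F U)
      uL : Unique (List.map F L)
      uL = unique-map (λ V∈ W∈ → firstDiag-injective (proj₁ (L⊆ V∈)) (proj₁ (L⊆ W∈)))
        (Unique.filter⁺ (λ V → F V ≤? F U) (IsSubdivision.unique S))
      to : ∀ {z} → z ∈ List.map F L → z ∈ upTo (lab U)
      to z∈ with ∈-map⁻ F z∈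
      ... | V , V∈ , refl = ∈-upTo⁺ (s≤s (proj₂ (L⊆ V∈)))
      from : ∀ {z} → z ∈ upTo (lab U) → z ∈ List.map F L
      from z∈ with at (<-≤-trans (∈-upTo⁻ z∈) (F<n U∈))
      ... | V , V∈ , refl = ∈-map⁺ F (∈-filter⁺ (λ V → F V ≤? F U) V∈ (≤-pred (∈-upTo⁻ z∈)))

    s⊆R : ∀ {U} → U ∈ s → U ∈ R
    s⊆R U∈ = proj₁ (chain-∈ ch U∈)

    R⊆s : ∀ {U} → U ∈ R → U ∈ s
    R⊆s U∈ with chain-all ch U∈
    ... | inj₂ U∈s = U∈s

    labels≡ : List.map (label n R) s ≡ List.map lab s
    labels≡ = map-cong-local (All.tabulate (λ U∈ → label≡ (s⊆R U∈)))

    x : List ℕ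
    x = List.map lab s

    x↭ : IsPerm n x
    x↭ = unique-set⇒↭
      (unique-map (λ U∈ W∈ eq → firstDiag-injective (s⊆R U∈) (s⊆R W∈) (suc-injective eq)) us)
      (Unique.applyUpTo⁺₁ suc n λ i<j _ eq → <⇒≢ i<j (suc-injective eq)) to from
      where
      to : ∀ {z} → z ∈ x → z ∈ applyUpTo suc n
      to z∈ with ∈-map⁻ lab z∈
      ... | V , V∈ , refl = ∈-applyUpTo⁺ suc (F<n (s⊆R V∈))
      from : ∀ {z} → z ∈ applyUpTo suc n → z ∈ x
      from z∈ with ∈-applyUpTo⁻ suc z∈
      ... | e , e<n , refl with at e<n
      ... | V , V∈ , refl = ∈-map⁺ lab (R⊆s V∈)

    rect-before : ∀ {U W i j i′ j′} → U ∈ R → W ∈ R → CellIn i j U → CellIn i′ j′ W →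
      i ≤ i′ → j ≤ j′ → U ≢ W → Before U W s
    rect-before U∈ W∈ cU cW p q U≢W with chain-before ch (R⊆s W∈) U∈ cW cU p q
    ... | inj₂ (inj₁ eq) = contradiction eq U≢W
    ... | inj₂ (inj₂ b) = b

    -- Unless a side of `U` lies on the square, the neighbour across it in the diagonal row or
    -- column of `U` carries the extremal label. The rectangles of the diagonal cells in between
    -- compare with `U` in the opposite order. Both orders come from `rect-before`.
    placed : ∀ {U} → U ∈ R → Placed n x (F U) U
    placed {U} U∈ = record
      { left-is = left≤F U∈ , left-sat (left U) refl , λ {j} → left-max {j}
      ; above-is = above≤F U∈ , above-sat (n ∸ top U) refl , λ {j} → above-max {j}
      ; right-is = F<right U∈ , V.r≤n U∈ , right-sat , λ {j} → right-min {j}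
      ; below-is = F<below U∈ , m∸n≤m n (bottom U) , below-sat (bottom U) refl ,
        λ {j} → below-min {j}
      ; top≤n = V.t≤n U∈ ; bottom≤n = V.b≤n U∈ }
      where
      k = lab U
      row = n ∸ k
      b≤row = proj₁ (proj₂ (proj₂ (diag-cell U∈)))
      row<t = proj₂ (proj₂ (proj₂ (diag-cell U∈)))
      b<t = V.b<t U∈
      before : ∀ {W e i j i′ j′} → W ∈ R → F W ≡ e → CellIn i j U → CellIn i′ j′ W →
        i ≤ i′ → j ≤ j′ → F U ≢ e → Before k (suc e) x
      before W∈ refl cU cW p q ne =
        before-map lab (rect-before U∈ W∈ cU cW p q (λ { refl → ne refl }))
      after : ∀ {W e i j i′ j′} → W ∈ R → F W ≡ e → CellIn i j U → CellIn i′ j′ W →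
        i′ ≤ i → j′ ≤ j → F U ≢ e → Before (suc e) k x
      after W∈ refl cU cW p q ne =
        before-map lab (rect-before W∈ U∈ cW cU p q (λ { refl → ne refl }))
      pred-right : suc (right U ∸ 1) ≡ right U
      pred-right = suc-∸-suc {right U} (≤-<-trans z≤n (V.l<r U∈))
      pred-top : suc (top U ∸ 1) ≡ top U
      pred-top = suc-∸-suc {top U} (≤-<-trans z≤n b<t)
      leftmost : CellIn (left U) row U
      leftmost = ≤-refl , V.l<r U∈ , b≤row , row<t
      rightmost : CellIn (right U ∸ 1) row U
      rightmost = ≤-pred (≤-trans (V.l<r U∈) (≤-reflexive (sym pred-right))) ,
        ≤-reflexive pred-right , b≤row , row<t
      topmost : CellIn (F U) (top U ∸ 1) U
      topmost = left≤F U∈ , F<right U∈ , ≤-pred (≤-trans b<t (≤-reflexive (sym pred-top))) ,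
        ≤-reflexive pred-top
      bottommost : CellIn (F U) (bottom U) U
      bottommost = left≤F U∈ , F<right U∈ , ≤-refl , b<t
      module _ {e} (e<n : e < n) where
        W∈ = proj₁ (proj₂ (at e<n))
        F≡ = proj₂ (proj₂ (at e<n))
        cW : CellIn e (n ∸ suc e) (proj₁ (at e<n))
        cW = subst (λ e → CellIn e (n ∸ suc e) (proj₁ (at e<n))) F≡ (diag-cell W∈)
      left-sat : ∀ l → l ≡ left U → l ≡ 0 ⊎ Before l k x
      left-sat zero _ = inj₁ refl
      left-sat (suc l) eq with V.cover {l} {row} (<-trans (<-≤-trans (≤-reflexive eq) (left≤F U∈))
        (F<n U∈)) (<-≤-trans row<t (V.t≤n U∈))
      ... | W , W∈ , c@(l≤ , <r , b≤ , <t) =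
        inj₂ (after W∈ FW leftmost c (≤-trans (n≤1+n l) (≤-reflexive eq)) ≤-refl (>⇒≢ l<F))
        where
        l<F : l < F U
        l<F = ≤-trans (≤-reflexive eq) (left≤F U∈)
        rW : right W ≡ suc l
        rW with m≤n⇒m<n∨m≡n <r
        ... | inj₂ r≡ = sym r≡
        ... | inj₁ r> with V.cell-unique U∈ W∈ leftmost
          (≤-trans l≤ (≤-trans (n≤1+n l) (≤-reflexive eq)) , ≤-<-trans (≤-reflexive (sym eq)) r> ,
          b≤ , <t)
        ... | refl = contradiction (≤-<-trans l≤ (≤-reflexive eq)) (<-irrefl refl)
        FW : F W ≡ l
        FW = suc-injective (trans (sym (one W∈))
          (trans (m≤n⇒m⊓n≡m (≤-trans (≤-reflexive rW)
          (≤-trans (s≤s (<⇒≤ l<F)) (proj₂ (V.rows W∈ (F<n U∈) b≤ <t))))) rW))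
      left-max : ∀ {j} → left U < j → j ≤ F U → Before k j x
      left-max {suc e} (s≤s l≤e) e<F = before (W∈ e<n) (F≡ e<n) leftmost (cW e<n) l≤e
        (∸-monoʳ-≤ n (s≤s (<⇒≤ e<F))) (>⇒≢ e<F)
        where e<n = <-trans e<F (F<n U∈)
      above-sat : ∀ a → a ≡ n ∸ top U → a ≡ 0 ⊎ Before k a x
      above-sat zero _ = inj₁ refl
      above-sat (suc a) eq with V.cover {F U} {top U} (F<n U∈) t<n
        where
        t<n : top U < n
        t<n = ≰⇒> λ n≤t → 1+n≢0 (trans eq (m≤n⇒m∸n≡0 n≤t))
      ... | W , W∈ , c@(l≤ , <r , b≤ , <t) =
        inj₂ (before W∈ FW topmost c ≤-refl (m∸n≤m (top U) 1) (>⇒≢ a<F))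
        where
        a<F : a < F U
        a<F = ≤-trans (≤-reflexive eq) (above≤F U∈)
        bW : bottom W ≡ top U
        bW with m≤n⇒m<n∨m≡n b≤
        ... | inj₂ b≡ = b≡
        ... | inj₁ b< with V.cell-unique U∈ W∈ topmost (l≤ , <r ,
          ≤-pred (≤-trans b< (≤-reflexive (sym pred-top))) , ≤-<-trans (m∸n≤m (top U) 1) <t)
        ... | refl = contradiction <t (<-irrefl refl)
        n∸bW : n ∸ bottom W ≡ suc a
        n∸bW = trans (cong (n ∸_) bW) (sym eq)
        FW : F W ≡ a
        FW = suc-injective (trans (sym (one W∈))
          (trans (m≥n⇒m⊓n≡n (≤-trans (≤-reflexive n∸bW) (≤-trans a<F (<⇒≤ <r)))) n∸bW))
      above-max : ∀ {j} → n ∸ top U < j → j ≤ F U → Before j k x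
      above-max {suc e} t<j e<F = after (W∈ e<n) (F≡ e<n) topmost (cW e<n) (<⇒≤ e<F)
        (≤-pred (≤-trans (subst (n ∸ suc e <_) (m∸[m∸n]≡n (V.t≤n U∈)) (∸-monoʳ-< t<j e<n))
          (≤-reflexive (sym pred-top)))) (>⇒≢ e<F)
        where e<n = <-trans e<F (F<n U∈)
      right-sat : right U ≡ n ⊎ Before k (suc (right U)) x
      right-sat with m≤n⇒m<n∨m≡n (V.r≤n U∈)
      ... | inj₂ eq = inj₁ eq
      ... | inj₁ r<n with V.cover {right U} {row} r<n (<-≤-trans row<t (V.t≤n U∈))
      ... | W , W∈ , c@(l≤ , <r , b≤ , <t) =
        inj₂ (before W∈ FW rightmost c (m∸n≤m (right U) 1) ≤-refl (<⇒≢ (F<right U∈)))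
        where
        lW : left W ≡ right U
        lW with m≤n⇒m<n∨m≡n l≤
        ... | inj₂ l≡ = l≡
        ... | inj₁ l< with V.cell-unique U∈ W∈ rightmost
          (≤-pred (≤-trans l< (≤-reflexive (sym pred-right))) , ≤-<-trans (m∸n≤m (right U) 1) <r ,
          b≤ , <t)
        ... | refl = contradiction <r (<-irrefl refl)
        FW : F W ≡ right U
        FW = trans (m≥n⇒m⊔n≡m
          (≤-trans (proj₁ (V.rows W∈ (F<n U∈) b≤ <t))
          (≤-trans (<⇒≤ (F<right U∈)) (≤-reflexive (sym lW))))) lW
      right-min : ∀ {j} → k < j → j ≤ right U → Before j k x
      right-min {suc e} (s≤s F<e) e<r = after (W∈ e<n) (F≡ e<n) rightmost (cW e<n)
        (≤-pred (≤-trans e<r (≤-reflexive (sym pred-right)))) (∸-monoʳ-≤ n (s≤s (<⇒≤ F<e)))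
          (<⇒≢ F<e)
        where e<n = <-≤-trans e<r (V.r≤n U∈)
      below-sat : ∀ b → b ≡ bottom U → n ∸ bottom U ≡ n ⊎ Before (suc (n ∸ bottom U)) k x
      below-sat zero eq = inj₁ (cong (n ∸_) (sym eq))
      below-sat (suc b) eq with V.cover {F U} {b} (F<n U∈)
        (<-trans (≤-reflexive eq) (<-≤-trans b<t (V.t≤n U∈)))
      ... | W , W∈ , c@(l≤ , <r , b≤ , <t) =
        inj₂ (after W∈ FW bottommost c ≤-refl (≤-trans (n≤1+n b) (≤-reflexive eq))
        (<⇒≢ (F<below U∈)))
        where
        tW : top W ≡ suc b
        tW with m≤n⇒m<n∨m≡n <t
        ... | inj₂ t≡ = sym t≡
        ... | inj₁ t> with V.cell-unique U∈ W∈ bottommost (l≤ , <r ,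
          ≤-trans b≤ (≤-trans (n≤1+n b) (≤-reflexive eq)) , ≤-<-trans (≤-reflexive (sym eq)) t>)
        ... | refl = contradiction (≤-<-trans b≤ (≤-reflexive eq)) (<-irrefl refl)
        FW : F W ≡ n ∸ bottom U
        FW = trans (m≤n⇒m⊔n≡n
          (≤-trans l≤ (≤-trans (<⇒≤ (F<below U∈)) (≤-reflexive (cong (n ∸_) (sym (trans tW eq)))))))
          (cong (n ∸_) (trans tW eq))
      below-min : ∀ {j} → k < j → j ≤ n ∸ bottom U → Before k j x
      below-min {suc e} (s≤s F<e) e< = before (W∈ e<n) (F≡ e<n) bottommost (cW e<n) (<⇒≤ F<e)
        (V.≤n∸b⇒ U∈ e<) (<⇒≢ F<e)
        where e<n = <-≤-trans e< (m∸n≤m n (bottom U))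

    -- `P` comes after `A` on the diagonal, so adjacency means `bottom A ≡ top P`. If the diagonal
    -- cell of `C` is below this level, `C` precedes `P`; otherwise that of `B` is above it too, and
    -- `A` precedes `B`.
    no-2-41-3 : ¬ Contains-2-41-3 x
    no-2-41-3 (xs , ys , _ , _ , _ , _ , eq , b∈ , c∈ , a<b , b<c , c<d) with map-split lab s xs eq
    ... | s₁ , P , A , s₂ , s≡ , refl , refl , refl , refl with ∈-map⁻ lab b∈ | ∈-map⁻ lab c∈
    ... | B , B∈s₁ , refl | C , C∈s₂ , refl = absurd (chain-adjacent s₁ (subst (Chain []) s≡ ch))
      where
      ∈s : ∀ {U} → U ∈ s₁ ++ P ∷ A ∷ s₂ → U ∈ R
      ∈s U∈ = s⊆R (subst (_ ∈_) (sym s≡) U∈)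
      P∈ = ∈s (∈-++⁺ʳ s₁ (here refl))
      A∈ = ∈s (∈-++⁺ʳ s₁ (there (here refl)))
      B∈ = ∈s (∈-++⁺ˡ B∈s₁)
      C∈ = ∈s (∈-++⁺ʳ s₁ (there (there C∈s₂)))
      BA : Before B A s
      BA = subst (Before B A) (sym s≡) (before-++ B∈s₁ (there (here refl)))
      PC : Before P C s
      PC = subst (Before P C) (sym s≡) (before-++ʳ s₁ (here (there C∈s₂)))
      FA<FB = ≤-pred a<b
      FB<FC = ≤-pred b<c
      FC<FP = ≤-pred c<d
      pred-top : suc (top P ∸ 1) ≡ top P
      pred-top = suc-∸-suc {top P} (≤-<-trans z≤n (V.b<t P∈))
      absurd : Adjacent P A → ⊥
      absurd (inj₂ lA) = <-irrefl refl
        (≤-<-trans (≤-trans (left≤F A∈) (<⇒≤ (<-trans FA<FB (<-trans FB<FC FC<FP))))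
        (<-≤-trans (F<right P∈) (≤-reflexive (sym lA))))
      absurd (inj₁ bA) with top P ≤? n ∸ suc (F C)
      ... | no t≰ = before-asym us PC (rect-before C∈ P∈ (diag-cell C∈)
        (left≤F P∈ , F<right P∈ , ≤-pred (≤-trans (V.b<t P∈) (≤-reflexive (sym pred-top))) ,
          ≤-reflexive pred-top)
        (<⇒≤ FC<FP) (≤-pred (≤-trans (≰⇒> t≰) (≤-reflexive (sym pred-top)))) λ { refl →
          <-irrefl refl FC<FP })
      ... | yes t≤ = before-asym us BA (rect-before A∈ B∈
        (left≤F A∈ , F<right A∈ , ≤-refl , V.b<t A∈) (diag-cell B∈) (<⇒≤ FA<FB)
        (≤-trans (≤-reflexive bA) (≤-trans t≤ (∸-monoʳ-≤ n (s≤s (<⇒≤ FB<FC))))) λ { refl →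
          <-irrefl refl FA<FB })

    -- Here adjacency means `left P ≡ right A`. If the diagonal cell of `B` is to the left of this
    -- line, `B` precedes `A`; otherwise that of `C` is to the right of it too, and `P` precedes
    -- `C`.
    no-3-14-2 : ¬ Contains-3-14-2 x
    no-3-14-2 (xs , ys , _ , _ , _ , _ , eq , c∈ , b∈ , a<b , b<c , c<d) with map-split lab s xs eq
    ... | s₁ , A , P , s₂ , s≡ , refl , refl , refl , refl with ∈-map⁻ lab b∈ | ∈-map⁻ lab c∈
    ... | B , B∈s₂ , refl | C , C∈s₁ , refl = absurd (chain-adjacent s₁ (subst (Chain []) s≡ ch))
      where
      ∈s : ∀ {U} → U ∈ s₁ ++ A ∷ P ∷ s₂ → U ∈ R
      ∈s U∈ = s⊆R (subst (_ ∈_) (sym s≡) U∈)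
      A∈ = ∈s (∈-++⁺ʳ s₁ (here refl))
      P∈ = ∈s (∈-++⁺ʳ s₁ (there (here refl)))
      C∈ = ∈s (∈-++⁺ˡ C∈s₁)
      B∈ = ∈s (∈-++⁺ʳ s₁ (there (there B∈s₂)))
      CP : Before C P s
      CP = subst (Before C P) (sym s≡) (before-++ C∈s₁ (there (here refl)))
      AB : Before A B s
      AB = subst (Before A B) (sym s≡) (before-++ʳ s₁ (here (there B∈s₂)))
      FA<FB = ≤-pred a<b
      FB<FC = ≤-pred b<c
      FC<FP = ≤-pred c<d
      FA<FP = <-trans FA<FB (<-trans FB<FC FC<FP)
      pred-right : suc (right A ∸ 1) ≡ right A
      pred-right = suc-∸-suc {right A} (≤-<-trans z≤n (V.l<r A∈))
      absurd : Adjacent A P → ⊥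
      absurd (inj₁ bP) = <-irrefl refl (<-trans
        (≤-<-trans (≤-trans (≤-reflexive (sym bP)) (proj₁ (proj₂ (proj₂ (diag-cell P∈)))))
          (∸-monoʳ-< (s≤s FA<FP) (F<n P∈)))
        (proj₂ (proj₂ (proj₂ (diag-cell A∈)))))
      absurd (inj₂ lP) with right A ≤? F B
      ... | no r≰ = before-asym us AB (rect-before B∈ A∈ (diag-cell B∈)
        (≤-pred (≤-trans (V.l<r A∈) (≤-reflexive (sym pred-right))) , ≤-reflexive pred-right ,
          proj₂ (proj₂ (diag-cell A∈)))
        (≤-pred (≤-trans (≰⇒> r≰) (≤-reflexive (sym pred-right)))) (∸-monoʳ-≤ n (s≤s (<⇒≤ FA<FB)))
          λ { refl → <-irrefl refl FA<FB })
      ... | yes r≤ = before-asym us CP (rect-before P∈ C∈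
        (≤-refl , V.l<r P∈ , proj₂ (proj₂ (diag-cell P∈))) (diag-cell C∈)
        (≤-trans (≤-reflexive lP) (≤-trans r≤ (<⇒≤ FB<FC))) (∸-monoʳ-≤ n (s≤s (<⇒≤ FC<FP)))
          λ { refl → <-irrefl refl FC<FP })

  labels-baxter : IsBaxter n (List.map (label n R) s)
  labels-baxter = subst (IsBaxter n) (sym labels≡) (x↭ , no-3-14-2 , no-2-41-3)

  ρ-labels : ρ n (List.map (label n R) s) ≈ᴸ R
  ρ-labels = subst (λ y → ρ n y ≈ᴸ R) (sym labels≡) λ U → mk⇔ to from
    where
    from : ∀ {U} → U ∈ R → U ∈ ρ n x
    from U∈ = ρ-complete x↭ (F<n U∈) (placed U∈)
    to : ∀ {U} → U ∈ ρ n x → U ∈ R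
    to U∈ with ρ-sound x↭ U∈
    ... | e , e<n , pl with at e<n
    ... | W , W∈ , refl = subst (_∈ R) (placed-unique x↭ (placed W∈) pl) W∈

module _ {n R} (1≤n : 1 ≤ n) (D : IsDRec n R) where

  private
    S = IsDRec.isSubdivision D
    one = DRec⇒OneDiag.one D
    ch : WalkOn.Chain S one [] (chosenOrder n R)
    ch = WalkOn.chosenOrder-chain S one 1≤n

  β-isBaxter : IsBaxter n (β n R)
  β-isBaxter = ChainLabels.labels-baxter S one ch

  ρ-β : ρ n (β n R) ≈ᴸ R
  ρ-β = ChainLabels.ρ-labels S one ch

corollary8p7 : (n : ℕ) → 1 ≤ n →
    Σ[ ρ-dRec ∈ (∀ {x : List ℕ} → IsBaxter n x → IsDRec n (ρ n x)) ]
    Σ[ β-Baxter ∈ (∀ {R : List Rect} → IsDRec n R → IsBaxter n (β n R)) ]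
    let ρᴮ : Baxter n → dRec n
        ρᴮ = map (ρ n) ρ-dRec
        βᴰ : dRec n → Baxter n
        βᴰ = map (β n) β-Baxter
    in IsOrderIsomorphism _≈ᴮ_ _≈ᴰ_ _≤ᴮ_ _≤ᴰ_ ρᴮ × Inverseᵇ _≈ᴮ_ _≈ᴰ_ ρᴮ βᴰ
corollary8p7 n 1≤n = (λ xB → ρ-isDRec (proj₁ xB)) , (λ D → β-isBaxter 1≤n D) ,
  record
    { isOrderMonomorphism = record
      { isOrderHomomorphism = record
        { cong = λ { refl U → mk⇔ id id }
        ; mono = λ { {_ , xB} {_ , yB} → ρ-monotone xB yB } }
      ; injective = λ { {_ , xB} {_ , yB} → ρ-injective xB yB }
      ; cancel = λ { {_ , xB} {_ , yB} → ρ-cancel xB yB } }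
    ; surjective = λ { (R , D) → (β n R , β-isBaxter 1≤n D) , λ { refl → ρ-β 1≤n D } } } ,
  (λ { {_ , D} refl → ρ-β 1≤n D }) ,
  -- Both `β n R` and `x` are Baxter with the same rectangulation, so this half of the inverse law
  -- is injectivity.
  (λ { {_ , xB} {_ , D} R≈ρx → ρ-injective (β-isBaxter 1≤n D) xB (≈ᴸ-trans (ρ-β 1≤n D) R≈ρx) })
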